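{- Let $G$ be a finite simple graph with $\mathrm{mad}(G)<4$. Then $\chi'_a(G)\leq \Delta(G)+2$.
   Context: A proper edge coloring of a graph is acyclic if there is no bichromatic cycle, i.e. the union of any two color classes induces a forest. The acyclic chromatic index $\chi'_a(G)$ is the least $k$ such that $G$ has an acyclic proper edge coloring with $k$ colors. $\Delta(G)$ is the maximum degree. The maximum average degree is $\mathrm{mad}(G)=\max_{H\subseteq G}\frac{2|E(H)|}{|V(H)|}$, the maximum over all (nonempty) subgraphs $H$. -}

module Defs where

open import Data.Nat using (ℕ; zero; suc; _+_; _*_; _≤_; _<_; _⊔_)
open import Data.Bool using (Bool; true; false; if_then_else_)
open import Data.Fin using (Fin; toℕ)
open import Data.Fin.Subset using (Subset; _∈_; ∣_∣)
open import Data.List using (List; []; _∷_; map; foldr; length; allFin; concatMap)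
open import Data.List.Relation.Unary.All using (All)
open import Data.List.Relation.Unary.Unique.Propositional using (Unique)
open import Data.Product using (_×_; _,_; Σ; ∃)
open import Data.Sum using (_⊎_)
open import Relation.Binary.PropositionalEquality using (_≡_; _≢_)
open import Relation.Nullary using (¬_)
open import Relation.Nullary.Decidable using (⌊_⌋)
open import Data.Nat.Properties using (_<?_)

record Graph (n : ℕ) : Set where
  field
    adj    : Fin n → Fin n → Bool
    sym    : ∀ u v → adj u v ≡ adj v u
    irrefl : ∀ v → adj v v ≡ false
open Graph public

countTrue : List Bool → ℕ
countTrue []            = 0
countTrue (true ∷ bs)   = suc (countTrue bs)
countTrue (false ∷ bs)  = countTrue bs

degree : ∀ {n} → Graph n → Fin n → ℕ
degree {n} G v = countTrue (map (adj G v) (allFin n))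

maxDegree : ∀ {n} → Graph n → ℕ
maxDegree {n} G = foldr _⊔_ 0 (map (degree G) (allFin n))

edgeCount : ∀ {n} → (Fin n → Fin n → Bool) → ℕ
edgeCount {n} F =
  countTrue (concatMap (λ i → map (λ j → if ⌊ toℕ i <? toℕ j ⌋ then F i j else false)
                                  (allFin n))
                       (allFin n))

record Subgraph {n : ℕ} (G : Graph n) : Set where
  field
    S        : Subset n
    F        : Fin n → Fin n → Bool
    F-sym    : ∀ u v → F u v ≡ F v u
    F-sub    : ∀ u v → F u v ≡ true → adj G u v ≡ true
    F-inside : ∀ u v → F u v ≡ true → (u ∈ S × v ∈ S)
open Subgraph public

-- mad(G) < 4 :  for every nonempty subgraph H,  2|E(H)| / |V(H)| < 4,
-- i.e. 2|E(H)| < 4|V(H)|.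
madLessThan4 : ∀ {n} → Graph n → Set
madLessThan4 G = ∀ (H : Subgraph G) → 1 ≤ ∣ S H ∣ → 2 * edgeCount (F H) < 4 * ∣ S H ∣

-- Edge colouring with k colours: a colour for each ordered pair, required to be
-- symmetric on edges so that it is a function of the (unordered) edge.
EdgeColouring : ℕ → ℕ → Set
EdgeColouring n k = Fin n → Fin n → Fin k

IsProper : ∀ {n k} → Graph n → EdgeColouring n k → Set
IsProper {n} G c =
  (∀ u v → adj G u v ≡ true → c u v ≡ c v u) ×
  (∀ u v w → adj G u v ≡ true → adj G u w ≡ true → v ≢ w → c u v ≢ c u w)

cycleEdgesAux : ∀ {n} → Fin n → List (Fin n) → List (Fin n × Fin n)
cycleEdgesAux first []            = []
cycleEdgesAux first (v ∷ [])      = (v , first) ∷ []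
cycleEdgesAux first (v ∷ w ∷ vs)  = (v , w) ∷ cycleEdgesAux first (w ∷ vs)

cycleEdges : ∀ {n} → List (Fin n) → List (Fin n × Fin n)
cycleEdges []       = []
cycleEdges (v ∷ vs) = cycleEdgesAux v (v ∷ vs)

IsCycle : ∀ {n} → Graph n → List (Fin n) → Set
IsCycle G vs = (3 ≤ length vs) × Unique vs × All (λ e → adj G (Data.Product.proj₁ e) (Data.Product.proj₂ e) ≡ true) (cycleEdges vs)

IsAcyclic : ∀ {n k} → Graph n → EdgeColouring n k → Set
IsAcyclic {n} {k} G c =
  ∀ (a b : Fin k) (vs : List (Fin n)) → IsCycle G vs →
    ¬ All (λ e → c (Data.Product.proj₁ e) (Data.Product.proj₂ e) ≡ a ⊎
                 c (Data.Product.proj₁ e) (Data.Product.proj₂ e) ≡ b) (cycleEdges vs)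

-- G has an acyclic proper edge colouring with k colours  (i.e. χ'_a(G) ≤ k)
AcyclicEdgeColourable : ∀ {n} → Graph n → ℕ → Set
AcyclicEdgeColourable {n} G k = Σ (EdgeColouring n k) λ c → IsProper G c × IsAcyclic G c

{-# OPTIONS --safe #-}
-- Let k = Δ + 2 and let G be a counterexample with fewest edges.  A colour is blocked
-- for an uncoloured edge only by a bichromatic path, and a component of a bichromatic
-- subgraph has at most two ends; recolouring one or two edges at a vertex moves such a
-- path to a wrong end.  Playing this off against the number of colours available shows:
-- (1) degrees are at least 2, and a vertex with a neighbour of degree 2 has b neighbours
--     of degree at least 4 and t of degree 3 with 8 ≤ 2b + t;
-- (2) the neighbours of a vertex of degree 3 have degree at least 4;
-- (3) if one of them has degree 4, the other two have degree at least 5, at least two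
--     neighbours of degree at least 4, and at least three if their degree is 5;
-- (4) a vertex of degree 5 next to one of degree 3 has at least two neighbours of degree
--     at least 4.
-- Now let every vertex of degree 2 receive 1 from each neighbour, every vertex of degree
-- 3 with a neighbour of degree 4 receive 1/2 from the other two, and every other vertex
-- of degree 3 receive 1/3 from each neighbour.  Starting from the degrees, every vertex
-- ends up with at least 4, so the average degree is at least 4.
module Submission where

open import Data.Nat using (ℕ; zero; suc; _+_; _*_; _≤_; _<_; _⊔_; z≤n; s≤s)
import Data.Nat.Properties as ℕ
open import Data.Nat.Solver using (module +-*-Solver)
open import Data.Bool using (Bool; true; false; if_then_else_; _∧_; not)
import Data.Bool.Properties as Bool
open import Data.Fin using (Fin; zero; suc; toℕ; _≟_)
open import Data.Fin.Properties using (any?; all?; toℕ-injective)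
open import Data.Fin.Subset using (Subset; ∣_∣)
import Data.Fin.Subset as Subset
open import Data.Fin.Subset.Properties using (anySubset?)
import Data.Fin.Subset.Properties as Subset
open import Data.Maybe using (Maybe; just; nothing; fromMaybe)
open import Data.Maybe.Properties using (just-injective) renaming (≡-dec to ≡-decᵐ)
open import Data.List using (List; []; _∷_; _++_; map; filter; foldr; length; allFin; mapMaybe; concatMap)
open import Data.Nat.ListAction using (sum)
open import Data.List.Properties using (length-++; length-mapMaybe; filter-notAll)
open import Data.List.Membership.Propositional using (_∈_; _∉_)
open import Data.List.Membership.Propositional.Properties using (∈-filter⁺; ∈-filter⁻; ∈-++⁺ˡ; ∈-++⁺ʳ; ∈-++⁻; ∈-allFin)
import Data.List.Membership.DecPropositional as DecMembership
open import Data.List.Relation.Unary.Any using (Any; here; there)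
open import Data.List.Relation.Unary.All as All using (All; []; _∷_)
open import Data.List.Relation.Unary.AllPairs using ([]; _∷_)
open import Data.List.Relation.Unary.Unique.Propositional using (Unique)
import Data.List.Relation.Unary.Unique.Propositional.Properties as Unique
open import Data.Vec using (Vec; []; _∷_; lookup; tabulate)
open import Data.Vec.Properties using (lookup∘tabulate; lookup⇒[]=; []=⇒lookup)
open import Data.Product using (Σ; ∃; ∃₂; _×_; _,_; proj₁; proj₂)
open import Data.Sum using (_⊎_; inj₁; inj₂; [_,_]′)
open import Data.Empty using (⊥; ⊥-elim)
open import Function using (_∘_; id; case_of_)
open import Relation.Nullary using (¬_; Dec; yes; no; contradiction; does)
open import Relation.Nullary.Decidable using (decidable-stable; ¬?; _×-dec_; _⊎-dec_; _→-dec_; map′; ⌊_⌋; dec-true)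
open import Relation.Binary.PropositionalEquality using (_≡_; _≢_; refl; sym; trans; cong; cong₂; subst; module ≡-Reasoning)
open import Defs hiding (S; F; sym; irrefl)
open import Defs using () renaming (sym to adj-sym; irrefl to adj-irrefl)

-- Where the constants come from: with Δ + 2 colours every vertex misses at least two, and a vertex
-- with a deleted neighbour at least three. If a deleted x cannot be put back next to y because of a
-- colour used on ys, then the blocking paths pass through s and give s every colour free at y; so s
-- carries three free colours besides that of ys and has degree at least 4. Counting such ends
-- yields the numbers of neighbours of degree at least 4. Conversely, an end that sees all colours
-- outside a set of three, and one of these three, misses the other two; this is what lets two edges
-- at a vertex exchange their colours. A bichromatic path is handled as a vertex set with local
-- closure conditions, so no walk is ever traversed. In exchange its existence is not decided, and
-- facts about paths are kept doubly negated. This is harmless, since the structural lemmas refute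
-- something or conclude decidable statements, and the final colouring is recovered by a finite
-- search. The bound Δ is that of the original graph and stays fixed while edges are removed, so the
-- palette never changes along the induction.

private
  variable
    m n : ℕ

-- Lists without repetition and the pigeonhole principle.

module _ {m : ℕ} where
  open DecMembership (_≟_ {m}) public using () renaming (_∈?_ to _∈ᶠ?_)

remove : Fin m → List (Fin m) → List (Fin m)
remove e = filter (λ z → ¬? (z ≟ e))

remove-length : ∀ {e : Fin m} {xs} → e ∈ xs → length (remove e xs) < length xs
remove-length {e = e} {xs} e∈ = filter-notAll (λ z → ¬? (z ≟ e)) xs (lose e∈)
  where
  lose : ∀ {ys} → e ∈ ys → Any (λ z → ¬ (z ≢ e)) ys
  lose (here refl) = here (λ ne → ne refl)
  lose (there i)   = there (lose i)

∈-remove : ∀ {e z : Fin m} {xs} → z ∈ xs → z ≢ e → z ∈ remove e xs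
∈-remove {e = e} z∈ z≢e = ∈-filter⁺ (λ z → ¬? (z ≟ e)) z∈ z≢e

Unique-length : ∀ {xs ys : List (Fin m)} → Unique xs → (∀ {z} → z ∈ xs → z ∈ ys) →
                length xs ≤ length ys
Unique-length {xs = []} [] _ = z≤n
Unique-length {xs = x ∷ xs} (x∉ ∷ u) sub =
  ℕ.≤-trans (s≤s (Unique-length u λ {z} z∈ →
               ∈-remove (sub (there z∈)) (λ e → All.lookup x∉ z∈ (sym e))))
            (remove-length (sub (here refl)))

opaque
  fresh : (ys : List (Fin m)) → length ys < m → ∃ λ a → a ∉ ys
  fresh {m} ys lt with any? (λ a → ¬? (a ∈ᶠ? ys))
  ... | yes r = r
  ... | no ¬r = contradiction
    (Unique-length (Unique.allFin⁺ m) λ {z} _ → decidable-stable (z ∈ᶠ? ys) λ z∉ → ¬r (z , z∉))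
    (ℕ.<⇒≱ (subst (length ys <_) (sym (Data.List.Properties.length-tabulate id)) lt))

-- Finite sums.

∑ : ∀ {A : Set} → List A → (A → ℕ) → ℕ
∑ xs f = sum (map f xs)

module _ {A : Set} where

  ∑-mono : ∀ (xs : List A) {f g : A → ℕ} → (∀ {x} → x ∈ xs → f x ≤ g x) → ∑ xs f ≤ ∑ xs g
  ∑-mono [] h = z≤n
  ∑-mono (x ∷ xs) h = ℕ.+-mono-≤ (h (here refl)) (∑-mono xs (h ∘ there))

  ∑-cong : ∀ (xs : List A) {f g : A → ℕ} → (∀ x → f x ≡ g x) → ∑ xs f ≡ ∑ xs g
  ∑-cong [] h = refl
  ∑-cong (x ∷ xs) h = cong₂ _+_ (h x) (∑-cong xs h)

  ∑-+ : ∀ (xs : List A) (f g : A → ℕ) → ∑ xs (λ x → f x + g x) ≡ ∑ xs f + ∑ xs g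
  ∑-+ [] f g = refl
  ∑-+ (x ∷ xs) f g = begin
    f x + g x + ∑ xs (λ x → f x + g x) ≡⟨ cong (f x + g x +_) (∑-+ xs f g) ⟩
    f x + g x + (∑ xs f + ∑ xs g)      ≡⟨ solve 4 (λ a b c d → a :+ b :+ (c :+ d) := a :+ c :+ (b :+ d)) refl (f x) (g x) _ _ ⟩
    f x + ∑ xs f + (g x + ∑ xs g)      ∎
    where
    open ≡-Reasoning
    open +-*-Solver

  ∑-* : ∀ (xs : List A) c (f : A → ℕ) → ∑ xs (λ x → c * f x) ≡ c * ∑ xs f
  ∑-* [] c f = sym (ℕ.*-zeroʳ c)
  ∑-* (x ∷ xs) c f = trans (cong (c * f x +_) (∑-* xs c f)) (sym (ℕ.*-distribˡ-+ c (f x) _))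

  ∑-0 : ∀ (xs : List A) → ∑ xs (λ _ → 0) ≡ 0
  ∑-0 [] = refl
  ∑-0 (x ∷ xs) = ∑-0 xs

  ∑-const : ∀ (xs : List A) c → ∑ xs (λ _ → c) ≡ c * length xs
  ∑-const [] c = sym (ℕ.*-zeroʳ c)
  ∑-const (x ∷ xs) c = trans (cong (c +_) (∑-const xs c)) (sym (ℕ.*-suc c (length xs)))

  ∑-swap : ∀ {B : Set} (xs : List A) (ys : List B) (h : A → B → ℕ) →
           ∑ xs (λ x → ∑ ys (h x)) ≡ ∑ ys (λ y → ∑ xs (λ x → h x y))
  ∑-swap [] ys h = sym (zeros ys)
    where
    zeros : ∀ {B : Set} (ys : List B) → ∑ ys (λ _ → 0) ≡ 0
    zeros [] = refl
    zeros (_ ∷ ys) = zeros ys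
  ∑-swap (x ∷ xs) ys h = trans (cong (∑ ys (h x) +_) (∑-swap xs ys h)) (sym (plus ys))
    where
    plus : ∀ ys → ∑ ys (λ y → h x y + ∑ xs (λ x → h x y)) ≡ ∑ ys (h x) + ∑ ys (λ y → ∑ xs (λ x → h x y))
    plus [] = refl
    plus (y ∷ ys) = begin
      h x y + ∑ xs (λ x → h x y) + ∑ ys (λ y → h x y + ∑ xs (λ x → h x y)) ≡⟨ cong (h x y + ∑ xs (λ x → h x y) +_) (plus ys) ⟩
      h x y + ∑ xs (λ x → h x y) + (∑ ys (h x) + ∑ ys (λ y → ∑ xs (λ x → h x y)))
        ≡⟨ solve 4 (λ a b c d → a :+ b :+ (c :+ d) := a :+ c :+ (b :+ d)) refl (h x y) _ (∑ ys (h x)) _ ⟩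
      h x y + ∑ ys (h x) + (∑ xs (λ x → h x y) + ∑ ys (λ y → ∑ xs (λ x → h x y))) ∎
      where
      open ≡-Reasoning
      open +-*-Solver

  ∑-filter : ∀ {P : A → Set} (P? : ∀ x → Dec (P x)) (xs : List A) (f : A → ℕ) →
             ∑ (filter P? xs) f ≡ ∑ xs (λ x → if does (P? x) then f x else 0)
  ∑-filter P? [] f = refl
  ∑-filter P? (x ∷ xs) f with does (P? x)
  ... | true = cong (f x +_) (∑-filter P? xs f)
  ... | false = ∑-filter P? xs f

  ∑-two : ∀ {xs : List A} {f : A → ℕ} {a b} → a ∈ xs → b ∈ xs → a ≢ b → f a + f b ≤ ∑ xs f
  ∑-two {f = f} (here refl) (here refl) ne = ⊥-elim (ne refl)
  ∑-two {f = f} (here refl) (there j) ne = ℕ.+-monoʳ-≤ (f _) (one j)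
    where
    one : ∀ {xs b} → b ∈ xs → f b ≤ ∑ xs f
    one (here refl) = ℕ.m≤m+n _ _
    one {x ∷ _} (there i) = ℕ.≤-trans (one i) (ℕ.m≤n+m _ (f x))
  ∑-two {f = f} {a} {b} (there i) (here refl) ne =
    ℕ.≤-trans (ℕ.≤-reflexive (ℕ.+-comm (f a) (f b))) (∑-two {f = f} (here refl) (there i) (ne ∘ sym))
  ∑-two {x ∷ xs} {f} (there i) (there j) ne = ℕ.≤-trans (∑-two {f = f} i j ne) (ℕ.m≤n+m _ (f x))

-- Degrees and edge counts as sums.

bit : Bool → ℕ
bit b = if b then 1 else 0

countTrue-++ : ∀ xs ys → countTrue (xs ++ ys) ≡ countTrue xs + countTrue ys
countTrue-++ [] ys = refl
countTrue-++ (true ∷ xs) ys = cong suc (countTrue-++ xs ys)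
countTrue-++ (false ∷ xs) ys = countTrue-++ xs ys

countTrue-map : ∀ {A : Set} (h : A → Bool) xs → countTrue (map h xs) ≡ ∑ xs (bit ∘ h)
countTrue-map h [] = refl
countTrue-map h (x ∷ xs) with h x
... | true = cong suc (countTrue-map h xs)
... | false = countTrue-map h xs

countTrue-concatMap : ∀ {A : Set} (g : A → List Bool) xs → countTrue (concatMap g xs) ≡ ∑ xs (countTrue ∘ g)
countTrue-concatMap g [] = refl
countTrue-concatMap g (x ∷ xs) = trans (countTrue-++ (g x) (concatMap g xs)) (cong (countTrue (g x) +_) (countTrue-concatMap g xs))

∣tabulate∣ : ∀ (g : Fin n → Bool) → ∣ tabulate g ∣ ≡ ∑ (allFin n) (bit ∘ g)
∣tabulate∣ {n} g = trans (go g) (cong sum (sym (Data.List.Properties.map-tabulate id (bit ∘ g))))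
  where
  go : ∀ {n} (g : Fin n → Bool) → ∣ tabulate g ∣ ≡ sum (Data.List.tabulate (bit ∘ g))
  go {zero} g = refl
  go {suc n} g with g zero
  ... | true = cong suc (go (g ∘ suc))
  ... | false = go (g ∘ suc)

-- Handshake lemma: `edgeCount` sees a pair only in increasing order, so the indicator of adjacency
-- splits into two orientations, and one of the two double sums is the other transposed.
degree-sum : (G : Graph n) → ∑ (allFin n) (degree G) ≡ 2 * edgeCount (adj G)
degree-sum {n} G = begin
  ∑ V (degree G) ≡⟨ ∑-cong V (λ i → countTrue-map (adj G i) V) ⟩
  ∑ V (λ i → ∑ V (bit ∘ adj G i)) ≡⟨ ∑-cong V (λ i → trans (∑-cong V (split i)) (∑-+ V (e i) (λ j → e j i))) ⟩
  ∑ V (λ i → ∑ V (e i) + ∑ V (λ j → e j i)) ≡⟨ ∑-+ V _ _ ⟩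
  ∑ V (λ i → ∑ V (e i)) + ∑ V (λ i → ∑ V (λ j → e j i)) ≡⟨ cong (∑ V (λ i → ∑ V (e i)) +_) (sym (∑-swap V V e)) ⟩
  ∑ V (λ i → ∑ V (e i)) + ∑ V (λ i → ∑ V (e i)) ≡⟨ cong₂ _+_ edges (trans edges (sym (ℕ.+-identityʳ _))) ⟩
  2 * edgeCount (adj G) ∎
  where
  open ≡-Reasoning
  V = allFin n
  forward : Fin n → Fin n → Bool
  forward i j = if ⌊ toℕ i ℕ.<? toℕ j ⌋ then adj G i j else false
  e : Fin n → Fin n → ℕ
  e i j = bit (forward i j)
  edges : ∑ V (λ i → ∑ V (e i)) ≡ edgeCount (adj G)
  edges = sym (trans (countTrue-concatMap (λ i → map (forward i) V) V) (∑-cong V λ i → countTrue-map (forward i) V))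
  split : ∀ i j → bit (adj G i j) ≡ e i j + e j i
  split i j with toℕ i ℕ.<? toℕ j | toℕ j ℕ.<? toℕ i
  ... | yes p | yes q = ⊥-elim (ℕ.<-asym p q)
  ... | yes p | no _ = sym (ℕ.+-identityʳ _)
  ... | no _ | yes q = cong bit (adj-sym G i j)
  ... | no p | no q with toℕ-injective (ℕ.≤-antisym (ℕ.≮⇒≥ q) (ℕ.≮⇒≥ p))
  ... | refl = cong bit (adj-irrefl G i)

-- Partial colourings and bichromatic paths.

module Colourings (n k : ℕ) where

  -- A partial colouring records a subgraph together with its colouring: an edge uv
  -- belongs to the subgraph iff c u v is not nothing.
  Colouring : Set
  Colouring = Fin n → Fin n → Maybe (Fin k)

  record has (c : Colouring) (u : Fin n) (a : Fin k) : Set where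
    constructor _,_
    field
      nbr  : Fin n
      edge : c u nbr ≡ just a

  miss : Colouring → Fin n → Fin k → Set
  miss c u a = ∀ w → c u w ≢ just a

  opaque
    has? : ∀ c u a → Dec (has c u a)
    has? c u a = map′ (λ (w , e) → w , e) (λ (w , e) → w , e) (any? λ w → ≡-decᵐ _≟_ (c u w) (just a))

  opaque
    has⊎miss : ∀ c u a → has c u a ⊎ miss c u a
    has⊎miss c u a with has? c u a
    ... | yes h = inj₁ h
    ... | no ¬h = inj₂ λ w e → ¬h (w , e)

  opaque
    ¬miss⇒has : ∀ {c u a} → ¬ miss c u a → has c u a
    ¬miss⇒has {c} {u} {a} nm with has⊎miss c u a
    ... | inj₁ h = h
    ... | inj₂ m = ⊥-elim (nm m)

  -- A vertex that misses one of the two colours can be an end of a bichromatic path but never an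
  -- inner vertex.
  Half : Colouring → Fin k → Fin k → Fin n → Set
  Half c a b p = miss c p a ⊎ miss c p b

  NbrIn : Colouring → (Fin n → Set) → Fin k → Fin n → Set
  NbrIn c S a w = ∃ λ w′ → S w′ × c w w′ ≡ just a

  -- In a finite properly coloured graph a nonempty vertex set in which every vertex
  -- has both an a- and a b-coloured edge inside contains an (a,b)-bichromatic cycle.
  record Good (c : Colouring) : Set₁ where
    field
      symm    : ∀ u v → c u v ≡ c v u
      loopless : ∀ v → c v v ≡ nothing
      proper  : ∀ {u v w a} → c u v ≡ just a → c u w ≡ just a → v ≡ w
      acyclic : ∀ {a b} (S : Fin n → Set) → a ≢ b →
                (∀ w → S w → NbrIn c S a w × NbrIn c S b w) → ∀ w → ¬ S w

    flip : ∀ {u v a} → c u v ≡ just a → c v u ≡ just a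
    flip {u} {v} e = trans (symm v u) e

    no-loop : ∀ {u v a} → c u v ≡ just a → u ≢ v
    no-loop {u} e refl with trans (sym e) (loopless u)
    ... | ()

  -- An (a,b)-bichromatic path from p to q, given by its vertex set.
  record Link (c : Colouring) (a b : Fin k) (p q : Fin n) : Set₁ where
    field
      S     : Fin n → Set
      p∈    : S p
      q∈    : S q
      p≢q   : p ≢ q
      inner : ∀ w → S w → w ≢ p → w ≢ q → NbrIn c S a w × NbrIn c S b w
      endˡ  : NbrIn c S a p ⊎ NbrIn c S b p
      endʳ  : NbrIn c S a q ⊎ NbrIn c S b q

  -- Paths are given by arbitrary predicates on vertices and are not decided; with the double
  -- negation a path may be assumed absent while a contradiction is derived.
  L : Colouring → Fin k → Fin k → Fin n → Fin n → Set₁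
  L c a b p q = ¬ ¬ Link c a b p q

  _⊑_ : Colouring → Colouring → Set
  c′ ⊑ c = ∀ p q a → c′ p q ≡ just a → c p q ≡ just a

  swap⊎ : ∀ {A B : Set} → A ⊎ B → B ⊎ A
  swap⊎ = [ inj₂ , inj₁ ]′

  Link-flip : ∀ {c a b p q} → Link c a b p q → Link c a b q p
  Link-flip l = record { S = S ; p∈ = q∈ ; q∈ = p∈ ; p≢q = p≢q ∘ sym
    ; inner = λ w s n₁ n₂ → inner w s n₂ n₁ ; endˡ = endʳ ; endʳ = endˡ }
    where open Link l

  Link-recolour : ∀ {c a b p q} → Link c a b p q → Link c b a p q
  Link-recolour l = record { S = S ; p∈ = p∈ ; q∈ = q∈ ; p≢q = p≢q
    ; inner = λ w s n₁ n₂ → let (x , y) = inner w s n₁ n₂ in y , x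
    ; endˡ = swap⊎ endˡ ; endʳ = swap⊎ endʳ }
    where open Link l

  L-flip : ∀ {c a b p q} → L c a b p q → L c a b q p
  L-flip l n = l (n ∘ Link-flip)

  Nbr-mono : ∀ {c c′ S T} → c ⊑ c′ → (∀ w → S w → T w) → ∀ {a w} → NbrIn c S a w → NbrIn c′ T a w
  Nbr-mono le st (w′ , s , e) = w′ , st _ s , le _ _ _ e

  Link-mono : ∀ {c c′} → c ⊑ c′ → ∀ {a b p q} → Link c a b p q → Link c′ a b p q
  Link-mono {c} {c′} le l = record { S = S ; p∈ = p∈ ; q∈ = q∈ ; p≢q = p≢q
    ; inner = λ w s n₁ n₂ → let (x , y) = inner w s n₁ n₂ in mono x , mono y
    ; endˡ = Data.Sum.map mono mono endˡ ; endʳ = Data.Sum.map mono mono endʳ }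
    where
    open Link l
    mono : ∀ {a w} → NbrIn c S a w → NbrIn c′ S a w
    mono (w′ , s , e) = w′ , s , le _ _ _ e

  miss-mono : ∀ {c c′ p a} → c ⊑ c′ → miss c′ p a → miss c p a
  miss-mono le m w e = m w (le _ _ _ e)

  noLink : ∀ {c a b p q} → miss c p a → miss c p b → ¬ Link c a b p q
  noLink ma mb l with Link.endˡ l
  ... | inj₁ (w , _ , e) = ma w e
  ... | inj₂ (w , _ , e) = mb w e

  noLinkʳ : ∀ {c a b p q} → miss c q a → miss c q b → ¬ Link c a b p q
  noLinkʳ ma mb l = noLink ma mb (Link-flip l)

  -- Peeling off the end vertex leaves a set of the same kind with the colours exchanged.
  oneEnd : ∀ {c} → Good c → ∀ {a b} p (S : Fin n → Set) → a ≢ b →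
           S p → NbrIn c S a p → ¬ NbrIn c S b p →
           (∀ w → S w → w ≢ p → NbrIn c S a w × NbrIn c S b w) → ⊥
  oneEnd {c} good p S a≢b p∈ nb ¬nb inner = go n [] p S a≢b p∈ nb ¬nb inner [] (λ ()) (ℕ.+-identityʳ n)
    where
    open Good good
    -- The peeled vertices are collected in `gone`. They are distinct, so after n steps the next end
    -- p would be one vertex too many.
    go : ∀ fuel (gone : List (Fin n)) {a b} p (S : Fin n → Set) → a ≢ b →
         S p → NbrIn c S a p → ¬ NbrIn c S b p →
         (∀ w → S w → w ≢ p → NbrIn c S a w × NbrIn c S b w) →
         Unique gone → (∀ {w} → w ∈ gone → ¬ S w) → fuel + length gone ≡ n → ⊥
    go zero gone p S _ p∈ _ _ _ u out eq =
      ℕ.1+n≰n (ℕ.≤-trans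
        (Unique-length {xs = p ∷ gone} {ys = allFin n}
          (All.tabulate (λ {z} z∈ e → out z∈ (subst S e p∈)) ∷ u) (λ {z} _ → ∈-allFin z))
        (ℕ.≤-reflexive (trans (Data.List.Properties.length-tabulate id) (sym eq))))
    go (suc fuel) gone {a} {b} p S a≢b p∈ (p′ , p′∈ , e) ¬nb inner u out eq =
      go fuel (p ∷ gone) p′ S′ (a≢b ∘ sym) (p′∈ , p′≢p) nb′ ¬nb′ inner′
        (All.tabulate (λ {z} z∈ e → out z∈ (subst S e p∈)) ∷ u)
        (λ { (here refl) (_ , ne) → ne refl ; (there w∈) (s , _) → out w∈ s })
        (trans (ℕ.+-suc fuel (length gone)) eq)
      where
      S′ : Fin n → Set
      S′ w = S w × w ≢ p
      p′≢p : p′ ≢ p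
      p′≢p = no-loop e ∘ sym
      nb′ : NbrIn c S′ b p′
      nb′ with proj₂ (inner p′ p′∈ p′≢p)
      ... | q , q∈ , f = q , (q∈ , λ { refl → a≢b (just-injective (trans (sym (flip e)) f)) }) , f
      ¬nb′ : ¬ NbrIn c S′ a p′
      ¬nb′ (q , (_ , q≢p) , f) = q≢p (proper f (flip e))
      inner′ : ∀ w → S′ w → w ≢ p′ → NbrIn c S′ b w × NbrIn c S′ a w
      inner′ w (w∈ , w≢p) w≢p′ with inner w w∈ w≢p
      ... | (x , x∈ , f) , (y , y∈ , g) =
        (y , (y∈ , λ { refl → ¬nb (w , w∈ , flip g) }) , g) ,
        (x , (x∈ , λ { refl → w≢p′ (proper (flip f) e) }) , f)

  -- A component of the (a,b)-subgraph has at most two end vertices.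
  uniqueEnd : ∀ {c} → Good c → ∀ {a b p q r} → Half c a b p → Half c a b q → Half c a b r →
              q ≢ r → Link c a b p q → Link c a b p r → ⊥
  uniqueEnd {c} good {a} {b} {p} {q} {r} hp hq hr q≢r l l′ = finish hp (Link.endˡ l) (Link.endˡ l′)
    where
    module A = Link l
    module B = Link l′
    open Good good
    -- In the intersection of the two paths, edges of one colour at a common vertex coincide by
    -- properness; q and r drop out because each could only be an inner vertex of the other path.
    -- This leaves p as a single end.
    T : Fin n → Set
    T w = A.S w × B.S w
    both⇒⊥ : ∀ {S w} → Half c a b w → NbrIn c S a w × NbrIn c S b w → ⊥
    both⇒⊥ (inj₁ m) ((w , _ , e) , _) = m w e
    both⇒⊥ (inj₂ m) (_ , (w , _ , e)) = m w e
    meet : ∀ {a w} → NbrIn c A.S a w → NbrIn c B.S a w → NbrIn c T a w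
    meet (x , x∈ , e) (y , y∈ , f) with proper e f
    ... | refl = x , (x∈ , y∈) , e
    inner : ∀ w → T w → w ≢ p → NbrIn c T a w × NbrIn c T b w
    inner w (s , t) w≢p with w ≟ q | w ≟ r
    ... | yes refl | _ = ⊥-elim (both⇒⊥ hq (B.inner w t w≢p q≢r))
    ... | no _ | yes refl = ⊥-elim (both⇒⊥ hr (A.inner w s w≢p (q≢r ∘ sym)))
    ... | no w≢q | no w≢r with A.inner w s w≢p w≢q | B.inner w t w≢p w≢r
    ... | x , y | x′ , y′ = meet x x′ , meet y y′
    finish : Half c a b p → NbrIn c A.S a p ⊎ NbrIn c A.S b p → NbrIn c B.S a p ⊎ NbrIn c B.S b p → ⊥
    finish (inj₁ m) (inj₁ (w , _ , e)) _ = m w e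
    finish (inj₁ m) (inj₂ _) (inj₁ (w , _ , e)) = m w e
    finish (inj₁ m) (inj₂ x) (inj₂ y) =
      oneEnd good p T (λ { refl → m _ (proj₂ (proj₂ x)) }) (A.p∈ , B.p∈) (meet x y)
        (λ { (w , _ , e) → m w e }) (λ w s ne → let (u , v) = inner w s ne in v , u)
    finish (inj₂ m) (inj₂ (w , _ , e)) _ = m w e
    finish (inj₂ m) (inj₁ _) (inj₂ (w , _ , e)) = m w e
    finish (inj₂ m) (inj₁ x) (inj₁ y) =
      oneEnd good p T (λ { refl → m _ (proj₂ (proj₂ x)) }) (A.p∈ , B.p∈) (meet x y)
        (λ { (w , _ , e) → m w e }) inner

  uniqueEndᴸ : ∀ {c} → Good c → ∀ {a b p q r} → Half c a b p → Half c a b q → Half c a b r →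
               q ≢ r → L c a b p q → L c a b p r → ⊥
  uniqueEndᴸ good hp hq hr ne l l′ = l λ x → l′ λ y → uniqueEnd good hp hq hr ne x y

  Good-⊑ : ∀ {c c′} → Good c → (∀ u v → c′ u v ≡ c′ v u) → c′ ⊑ c → Good c′
  Good-⊑ {c} {c′} good s le = record
    { symm = s
    ; loopless = λ v → nothing! v (c′ v v) refl
    ; proper = λ e f → proper (le _ _ _ e) (le _ _ _ f)
    ; acyclic = λ S ne cl → acyclic S ne λ w w∈ → let (x , y) = cl w w∈ in
        Nbr-mono le (λ _ s → s) x , Nbr-mono le (λ _ s → s) y }
    where
    open Good good
    nothing! : ∀ v r → c′ v v ≡ r → r ≡ nothing
    nothing! v nothing _ = refl
    nothing! v (just a) e = ⊥-elim (no-loop (le v v a e) refl)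

  -- Deleting vertices and replacing the edges at a vertex.

  opaque
    del : List (Fin n) → Colouring → Colouring
    del D c p q with p ∈ᶠ? D | q ∈ᶠ? D
    ... | no _  | no _  = c p q
    ... | no _  | yes _ = nothing
    ... | yes _ | _     = nothing

    del-just : ∀ {D c p q a} → del D c p q ≡ just a → p ∉ D × q ∉ D × c p q ≡ just a
    del-just {D} {c} {p} {q} e with p ∈ᶠ? D | q ∈ᶠ? D
    ... | no p∉ | no q∉ = p∉ , q∉ , e

    del-keep : ∀ {D c p q} → p ∉ D → q ∉ D → del D c p q ≡ c p q
    del-keep {D} {c} {p} {q} p∉ q∉ with p ∈ᶠ? D | q ∈ᶠ? D
    ... | no _  | no _  = refl
    ... | no _  | yes i = ⊥-elim (q∉ i)
    ... | yes i | _     = ⊥-elim (p∉ i)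

    del-symm : ∀ D {c} → (∀ u v → c u v ≡ c v u) → ∀ u v → del D c u v ≡ del D c v u
    del-symm D s u v with u ∈ᶠ? D | v ∈ᶠ? D
    ... | no _  | no _  = s u v
    ... | no _  | yes _ = refl
    ... | yes _ | no _  = refl
    ... | yes _ | yes _ = refl

  del-⊑ : ∀ D c → del D c ⊑ c
  del-⊑ D c p q a e = proj₂ (proj₂ (del-just {D} {c} e))

  Good-del : ∀ D {c} → Good c → Good (del D c)
  Good-del D {c} good = Good-⊑ good (del-symm D (Good.symm good)) (del-⊑ D c)

  off : Fin n → Colouring → Colouring
  off y = del (y ∷ [])

  off-just : ∀ {y c p q a} → off y c p q ≡ just a → p ≢ y × q ≢ y × c p q ≡ just a
  off-just {y} {c} e with del-just {y ∷ []} {c} e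
  ... | p∉ , q∉ , f = (λ { refl → p∉ (here refl) }) , (λ { refl → q∉ (here refl) }) , f

  off-keep : ∀ {y c p q} → p ≢ y → q ≢ y → off y c p q ≡ c p q
  off-keep p≢ q≢ = del-keep (λ { (here e) → p≢ e }) (λ { (here e) → q≢ e })

  opaque
    -- All edges at v are replaced at once, so that one lemma serves for attaching a vertex,
    -- recolouring an edge and exchanging two colours.
    setStar : Colouring → Fin n → (Fin n → Maybe (Fin k)) → Colouring
    setStar c v f p q with p ≟ v | q ≟ v
    ... | yes _ | _     = f q
    ... | no _  | yes _ = f p
    ... | no _  | no _  = c p q

    star-at : ∀ c v f q → setStar c v f v q ≡ f q
    star-at c v f q with v ≟ v
    ... | yes _ = refl
    ... | no ne = ⊥-elim (ne refl)

    star-to : ∀ c v f {p} → p ≢ v → setStar c v f p v ≡ f p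
    star-to c v f {p} ne with p ≟ v | v ≟ v
    ... | yes e | _     = ⊥-elim (ne e)
    ... | no _  | yes _ = refl
    ... | no _  | no e  = ⊥-elim (e refl)

    star-off : ∀ c v f {p q} → p ≢ v → q ≢ v → setStar c v f p q ≡ c p q
    star-off c v f {p} {q} np nq with p ≟ v | q ≟ v
    ... | yes e | _     = ⊥-elim (np e)
    ... | no _  | yes e = ⊥-elim (nq e)
    ... | no _  | no _  = refl

  module _ {c v} (good : Good c) (f : Fin n → Maybe (Fin k))
           (fv : f v ≡ nothing)
           (f-inj : ∀ {u u′ a} → f u ≡ just a → f u′ ≡ just a → u ≡ u′)
           (f-miss : ∀ {u a} → f u ≡ just a → miss (off v c) u a)
           (f-link : ∀ {u u′ a b} → u ≢ u′ → f u ≡ just a → f u′ ≡ just b → ¬ Link (off v c) a b u u′)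
           where
    private
      open module G = Good good using (flip)
      c′ = setStar c v f

      f-v : ∀ {u a} → f u ≡ just a → u ≢ v
      f-v e refl with trans (sym e) fv
      ... | ()

      old : ∀ {p q a} → p ≢ v → q ≢ v → c′ p q ≡ just a → off v c p q ≡ just a
      old np nq e = trans (off-keep np nq) (trans (sym (star-off c v f np nq)) e)

      symm′ : ∀ p q → c′ p q ≡ c′ q p
      symm′ p q with p ≟ v | q ≟ v
      ... | yes refl | yes refl = refl
      ... | yes refl | no nq = trans (star-at c v f q) (sym (star-to c v f nq))
      ... | no np | yes refl = trans (star-to c v f np) (sym (star-at c v f p))
      ... | no np | no nq = trans (star-off c v f np nq) (trans (G.symm p q) (sym (star-off c v f nq np)))

      proper′ : ∀ {u p q a} → c′ u p ≡ just a → c′ u q ≡ just a → p ≡ q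
      proper′ {u} {p} {q} {a} e g with u ≟ v
      ... | yes refl = f-inj (trans (sym (star-at c v f p)) e) (trans (sym (star-at c v f q)) g)
      ... | no u≢v with p ≟ v | q ≟ v
      ... | yes refl | yes refl = refl
      ... | yes refl | no q≢v = ⊥-elim (f-miss (trans (sym (star-to c v f u≢v)) e) q (old u≢v q≢v g))
      ... | no p≢v | yes refl = ⊥-elim (f-miss (trans (sym (star-to c v f u≢v)) g) p (old u≢v p≢v e))
      ... | no p≢v | no q≢v = G.proper (trans (sym (star-off c v f u≢v p≢v)) e) (trans (sym (star-off c v f u≢v q≢v)) g)

      acyclic′ : ∀ {a b} (S : Fin n → Set) → a ≢ b →
                 (∀ w → S w → NbrIn c′ S a w × NbrIn c′ S b w) → ∀ w → ¬ S w
      acyclic′ {a} {b} S a≢b cl w w∈ = ¬S-v S-v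
        where
        ¬S-v : ¬ S v
        ¬S-v v∈ with cl v v∈
        ... | (u , u∈ , e) , (u′ , u′∈ , e′) = f-link u≢u′ fu fu′ link
          where
          fu = trans (sym (star-at c v f u)) e
          fu′ = trans (sym (star-at c v f u′)) e′
          u≢u′ : u ≢ u′
          u≢u′ refl = a≢b (just-injective (trans (sym fu) fu′))
          T : Fin n → Set
          T x = S x × x ≢ v
          trim : ∀ {x y d} → x ≢ v → S y → y ≢ v → c′ x y ≡ just d → NbrIn (off v c) T d x
          trim nx y∈ ny g = _ , (y∈ , ny) , old nx ny g
          nbr : ∀ {x d} → S x → x ≢ v → f x ≢ just d → NbrIn c′ S d x → NbrIn (off v c) T d x
          nbr {x} x∈ nx nf (y , y∈ , g) =
            trim nx y∈ (λ { refl → nf (trans (sym (star-to c v f nx)) g) }) g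
          link : Link (off v c) a b u u′
          link = record { S = T ; p∈ = u∈ , f-v fu ; q∈ = u′∈ , f-v fu′ ; p≢q = u≢u′
            ; inner = λ { x (x∈ , nx) x≢u x≢u′ → let (α , β) = cl x x∈ in
                nbr x∈ nx (λ g → x≢u (f-inj g fu)) α , nbr x∈ nx (λ g → x≢u′ (f-inj g fu′)) β }
            ; endˡ = inj₂ (nbr u∈ (f-v fu) (λ g → a≢b (just-injective (trans (sym fu) g))) (proj₂ (cl u u∈)))
            ; endʳ = inj₁ (nbr u′∈ (f-v fu′) (λ g → a≢b (just-injective (trans (sym g) fu′))) (proj₁ (cl u′ u′∈))) }
        -- If v lies outside S, no edge inside S has changed, and S is already closed in c.
        S-v : S v
        S-v = ⊥-elim (G.acyclic S a≢b closed w w∈)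
          where
          ¬v : ∀ {x} → S x → x ≢ v
          ¬v x∈ refl = ¬S-v x∈
          shift : ∀ {x d} → S x → NbrIn c′ S d x → NbrIn c S d x
          shift x∈ (y , y∈ , g) = y , y∈ , trans (sym (star-off c v f (¬v x∈) (¬v y∈))) g
          closed : ∀ x → S x → NbrIn c S a x × NbrIn c S b x
          closed x x∈ = let (α , β) = cl x x∈ in shift x∈ α , shift x∈ β

    -- A new bichromatic cycle must pass through v; without v it becomes a bichromatic path between
    -- two neighbours of v, which `f-link` excludes.
    Good-setStar : Good (setStar c v f)
    Good-setStar = record { symm = symm′ ; loopless = loop ; proper = proper′ ; acyclic = acyclic′ }
      where
      loop : ∀ u → setStar c v f u u ≡ nothing
      loop u with u ≟ v
      ... | yes refl = trans (star-at c v f v) fv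
      ... | no ne = trans (star-off c v f ne ne) (G.loopless u)

  -- Carrying paths over to another colouring.

  _⊑off[_]_ : Colouring → List (Fin n) → Colouring → Set
  c ⊑off[ D ] K = ∀ {p q a} → p ∉ D → q ∉ D → c p q ≡ just a → K p q ≡ just a

  -- Inner vertices see both colours, so a vertex that misses one of them and is not an end lies off
  -- the path.
  dropMid : ∀ {c K} D → c ⊑off[ D ] K → ∀ {a b p q} →
            (∀ {d} → d ∈ D → d ≢ p × d ≢ q × Half c a b d) → Link c a b p q → Link K a b p q
  dropMid {c} {K} D le {a} {b} {p} {q} out l = record
    { S = S ; p∈ = p∈ ; q∈ = q∈ ; p≢q = p≢q
    ; inner = λ w s n₁ n₂ → let (x , y) = inner w s n₁ n₂ in keep s x , keep s y
    ; endˡ = Data.Sum.map (keep p∈) (keep p∈) endˡ ; endʳ = Data.Sum.map (keep q∈) (keep q∈) endʳ }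
    where
    open Link l
    away : ∀ {w} → S w → w ∉ D
    away {w} w∈ w∈D with out w∈D
    ... | ≢p , ≢q , inj₁ m = m _ (proj₂ (proj₂ (proj₁ (inner w w∈ ≢p ≢q))))
    ... | ≢p , ≢q , inj₂ m = m _ (proj₂ (proj₂ (proj₂ (inner w w∈ ≢p ≢q))))
    keep : ∀ {a w} → S w → NbrIn c S a w → NbrIn K S a w
    keep w∈ (y , y∈ , e) = y , y∈ , le (away w∈) (away y∈) e

  -- As y misses b, the path enters y through its a-edge ys; cutting off this edge makes s the new
  -- end.
  dropEnd : ∀ {c K} → Good c → ∀ {y} → c ⊑off[ y ∷ [] ] K → ∀ {a b p s} →
            c y s ≡ just a → miss c y b → p ≢ s → Link c a b p y → Link K a b p s
  dropEnd {c} {K} good {y} le {a} {b} {p} {s} ys yb p≢s l = record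
    { S = T ; p∈ = p∈ , p≢q ; q∈ = s∈ , s≢y ; p≢q = p≢s
    ; inner = λ { w (w∈ , w≢y) w≢p w≢s → let (α , β) = inner w w∈ w≢p w≢y in
        keep w∈ w≢y w≢s (inj₁ refl) α , keep w∈ w≢y w≢s (inj₂ refl) β }
    ; endˡ = Data.Sum.map (keep p∈ p≢q p≢s (inj₁ refl)) (keep p∈ p≢q p≢s (inj₂ refl)) endˡ
    ; endʳ = inj₂ endS }
    where
    open Link l
    open Good good
    T : Fin n → Set
    T w = S w × w ≢ y
    s∈ : S s
    s∈ with endʳ
    ... | inj₁ (w , w∈ , e) = subst S (proper e ys) w∈
    ... | inj₂ (w , _ , e) = ⊥-elim (yb w e)
    s≢y : s ≢ y
    s≢y = no-loop ys ∘ sym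
    one : ∀ {x} → x ≢ y → x ∉ y ∷ []
    one ne (here e) = ne e
    keep : ∀ {w d} → S w → w ≢ y → w ≢ s → (d ≡ a ⊎ d ≡ b) → NbrIn c S d w → NbrIn K T d w
    keep w∈ w≢y w≢s d≡ (x , x∈ , e) = x , (x∈ , x≢y d≡) , le (one w≢y) (one (x≢y d≡)) e
      where
      x≢y : _ → x ≢ y
      x≢y (inj₁ refl) refl = w≢s (proper (flip e) ys)
      x≢y (inj₂ refl) refl = yb _ (flip e)
    endS : NbrIn K T b s
    endS with proj₂ (inner s s∈ (p≢s ∘ sym) s≢y)
    ... | x , x∈ , e = x , (x∈ , x≢y) , le (one s≢y) (one x≢y) e
      where
      x≢y : x ≢ y
      x≢y refl = yb _ (flip e)

  -- Together with y such a path would close a bichromatic cycle through ys and ys′.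
  noLink-star : ∀ {c K} → Good c → ∀ {y} → K ⊑ off y c → ∀ {a b s s′} →
                c y s ≡ just a → c y s′ ≡ just b → s ≢ s′ → ¬ Link K a b s s′
  noLink-star {c} {K} good {y} le {a} {b} {s} {s′} e e′ s≢s′ l =
    acyclic T (λ { refl → s≢s′ (proper e e′) }) closed y (inj₂ refl)
    where
    open Link l
    open Good good
    T : Fin n → Set
    T w = S w ⊎ w ≡ y
    up : ∀ {d w} → NbrIn K S d w → NbrIn c T d w
    up = Nbr-mono (λ p q d g → proj₂ (proj₂ (off-just {y} {c} (le p q d g)))) (λ _ → inj₁)
    closed : ∀ w → T w → NbrIn c T a w × NbrIn c T b w
    closed w (inj₂ refl) = (s , inj₁ p∈ , e) , (s′ , inj₁ q∈ , e′)
    closed w (inj₁ w∈) with w ≟ s | w ≟ s′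
    ... | no n₁ | no n₂ = let (α , β) = inner w w∈ n₁ n₂ in up α , up β
    ... | yes refl | _ = (y , inj₂ refl , flip e) , bs endˡ
      where
      bs : _ → _
      bs (inj₂ β) = up β
      bs (inj₁ (x , _ , g)) with off-just {y} {c} (le _ _ _ g)
      ... | _ , x≢y , g′ = ⊥-elim (x≢y (proper g′ (flip e)))
    ... | no _ | yes refl = as endʳ , (y , inj₂ refl , flip e′)
      where
      as : _ → _
      as (inj₁ α) = up α
      as (inj₂ (x , _ , g)) with off-just {y} {c} (le _ _ _ g)
      ... | _ , x≢y , g′ = ⊥-elim (x≢y (proper g′ (flip e′)))

  -- Local recolourings

  opaque
    upd : (Fin n → Maybe (Fin k)) → Fin n → Fin k → Fin n → Maybe (Fin k)
    upd f s a r with r ≟ s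
    ... | yes _ = just a
    ... | no _  = f r

    upd-same : ∀ f s a → upd f s a s ≡ just a
    upd-same f s a with s ≟ s
    ... | yes _ = refl
    ... | no ne = ⊥-elim (ne refl)

    upd-other : ∀ f s a {r} → r ≢ s → upd f s a r ≡ f r
    upd-other f s a {r} ne with r ≟ s
    ... | yes e = ⊥-elim (ne e)
    ... | no _  = refl

    upd-just : ∀ f s a {r b} → upd f s a r ≡ just b → (r ≡ s × b ≡ a) ⊎ (r ≢ s × f r ≡ just b)
    upd-just f s a {r} e with r ≟ s
    ... | yes r≡s = inj₁ (r≡s , sym (just-injective e))
    ... | no r≢s  = inj₂ (r≢s , e)

  none : Fin n → Maybe (Fin k)
  none _ = nothing

  miss-off : ∀ {y c u a} → miss c u a → miss (off y c) u a
  miss-off {y} {c} = miss-mono {c = off y c} {c′ = c} (del-⊑ (y ∷ []) c)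

  ¬Link-off : ∀ {y c a b p q} → ¬ Link c a b p q → ¬ Link (off y c) a b p q
  ¬Link-off {y} {c} ¬l l = ¬l (Link-mono (del-⊑ (y ∷ []) c) l)

  miss-used : ∀ {c} → Good c → ∀ {y s j} → c y s ≡ just j → miss (off y c) s j
  miss-used {c} good {y} e w g with off-just {y = y} {c = c} g
  ... | _ , w≢y , g′ = w≢y (Good.proper good g′ (Good.flip good e))

  miss-star : ∀ {c v f u a} → u ≢ v → miss (off v c) u a → f u ≢ just a → miss (setStar c v f) u a
  miss-star {c} {v} {f} {u} u≢v m nf w e with w ≟ v
  ... | yes refl = nf (trans (sym (star-to c v f u≢v)) e)
  ... | no w≢v = m w (trans (off-keep {y = v} {c = c} u≢v w≢v) (trans (sym (star-off c v f u≢v w≢v)) e))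

  miss-center : ∀ {c v f a} → (∀ r → f r ≢ just a) → miss (setStar c v f) v a
  miss-center {c} {v} {f} nf w e = nf w (trans (sym (star-at c v f w)) e)

  star-⊑off : ∀ c v f → setStar c v f ⊑off[ v ∷ [] ] off v c
  star-⊑off c v f p∉ q∉ e =
    trans (off-keep {y = v} {c = c} np nq) (trans (sym (star-off c v f np nq)) e)
    where
    np = λ e → p∉ (here e)
    nq = λ e → q∉ (here e)

  self-⊑off : ∀ c v → c ⊑off[ v ∷ [] ] off v c
  self-⊑off c v p∉ q∉ e = trans (off-keep {y = v} {c = c} (λ e → p∉ (here e)) (λ e → q∉ (here e))) e

  recolour : Colouring → Fin n → Fin n → Fin k → Colouring
  recolour c y s β = setStar c y (upd (c y) s β)

  -- Only pairs that involve the new colour β can create a cycle; two unchanged edges at y are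
  -- covered by `noLink-star`.
  Good-recolour : ∀ {c} → Good c → ∀ {y s β} → y ≢ s → miss c y β → miss c s β →
    (∀ {r a} → r ≢ s → c y r ≡ just a → ¬ Link (off y c) β a s r) → Good (recolour c y s β)
  Good-recolour {c} good {y} {s} {β} y≢s yβ sβ nolink =
    Good-setStar good f (trans (upd-other (c y) s β y≢s) (loopless y)) inj mis lnk
    where
    open Good good
    f = upd (c y) s β
    inj : ∀ {u u′ a} → f u ≡ just a → f u′ ≡ just a → u ≡ u′
    inj e e′ with upd-just (c y) s β e | upd-just (c y) s β e′
    ... | inj₁ (refl , refl) | inj₁ (refl , _) = refl
    ... | inj₁ (refl , refl) | inj₂ (_ , g) = ⊥-elim (yβ _ g)
    ... | inj₂ (_ , g) | inj₁ (refl , refl) = ⊥-elim (yβ _ g)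
    ... | inj₂ (_ , g) | inj₂ (_ , g′) = proper g g′
    mis : ∀ {u a} → f u ≡ just a → miss (off y c) u a
    mis e with upd-just (c y) s β e
    ... | inj₁ (refl , refl) = miss-off sβ
    ... | inj₂ (_ , g) = miss-used good g
    lnk : ∀ {u u′ a b} → u ≢ u′ → f u ≡ just a → f u′ ≡ just b → ¬ Link (off y c) a b u u′
    lnk ne e e′ l with upd-just (c y) s β e | upd-just (c y) s β e′
    ... | inj₁ (refl , refl) | inj₁ (refl , _) = ne refl
    ... | inj₁ (refl , refl) | inj₂ (r≢s , g) = nolink r≢s g l
    ... | inj₂ (r≢s , g) | inj₁ (refl , refl) = nolink r≢s g (Link-recolour (Link-flip l))
    ... | inj₂ (_ , g) | inj₂ (_ , g′) = noLink-star good {y = y} (λ _ _ _ e → e) g g′ ne l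

  swapped : Colouring → Fin n → (s s′ : Fin n) (j j′ : Fin k) → Colouring
  swapped c y s s′ j j′ = setStar c y (upd (upd (c y) s′ j) s j′)

  module Swap {c} (good : Good c) {y s s′ j j′} (ys : c y s ≡ just j) (ys′ : c y s′ ≡ just j′)
              (s≢s′ : s ≢ s′) where
    open Good good
    f = upd (upd (c y) s′ j) s j′

    f-s : f s ≡ just j′
    f-s = upd-same _ s j′

    f-s′ : f s′ ≡ just j
    f-s′ = trans (upd-other _ s j′ (s≢s′ ∘ sym)) (upd-same _ s′ j)

    f-other : ∀ {r} → r ≢ s → r ≢ s′ → f r ≡ c y r
    f-other ns ns′ = trans (upd-other _ s j′ ns) (upd-other _ s′ j ns′)

    j≢j′ : j ≢ j′
    j≢j′ refl = s≢s′ (proper ys ys′)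

    data View (r : Fin n) (a : Fin k) : Set where
      is-s  : r ≡ s → a ≡ j′ → View r a
      is-s′ : r ≡ s′ → a ≡ j → View r a
      other : r ≢ s → r ≢ s′ → c y r ≡ just a → View r a

    view : ∀ {r a} → f r ≡ just a → View r a
    view e with upd-just _ s j′ e
    ... | inj₁ (p , q) = is-s p q
    ... | inj₂ (ns , e′) with upd-just _ s′ j e′
    ... | inj₁ (p , q) = is-s′ p q
    ... | inj₂ (ns′ , g) = other ns ns′ g

    f-has : ∀ {r a} → f r ≡ just a → has c y a
    f-has e with view e
    ... | is-s refl refl = s′ , ys′
    ... | is-s′ refl refl = s , ys
    ... | other _ _ g = _ , g

    -- The two exchanged edges do not endanger each other: once y is removed, s has neither j nor
    -- j′. What remains to exclude are paths from s or s′ to a third neighbour of y.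
    Good-swapped : miss c s j′ → miss c s′ j →
      (∀ {r a} → r ≢ s → r ≢ s′ → c y r ≡ just a → ¬ Link (off y c) j′ a s r × ¬ Link (off y c) j a s′ r) →
      Good (swapped c y s s′ j j′)
    Good-swapped sj′ s′j nolink =
      Good-setStar good f (trans (f-other (no-loop ys) (no-loop ys′)) (loopless y)) inj mis lnk
      where
      sj = miss-used good ys
      s′j′ = miss-used good ys′
      inj : ∀ {u u′ a} → f u ≡ just a → f u′ ≡ just a → u ≡ u′
      inj e e′ with view e | view e′
      ... | is-s refl refl | is-s refl _ = refl
      ... | is-s refl refl | is-s′ _ q = ⊥-elim (j≢j′ (sym q))
      ... | is-s refl refl | other _ ns′ g = ⊥-elim (ns′ (proper g ys′))
      ... | is-s′ refl refl | is-s _ q = ⊥-elim (j≢j′ q)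
      ... | is-s′ refl refl | is-s′ refl _ = refl
      ... | is-s′ refl refl | other ns _ g = ⊥-elim (ns (proper g ys))
      ... | other _ ns′ g | is-s refl refl = ⊥-elim (ns′ (proper g ys′))
      ... | other ns _ g | is-s′ refl refl = ⊥-elim (ns (proper g ys))
      ... | other _ _ g | other _ _ g′ = proper g g′
      mis : ∀ {u a} → f u ≡ just a → miss (off y c) u a
      mis e with view e
      ... | is-s refl refl = miss-off sj′
      ... | is-s′ refl refl = miss-off s′j
      ... | other _ _ g = miss-used good g
      lnk : ∀ {u u′ a b} → u ≢ u′ → f u ≡ just a → f u′ ≡ just b → ¬ Link (off y c) a b u u′
      lnk ne e e′ l with view e | view e′
      ... | is-s refl refl | is-s refl _ = ne refl
      ... | is-s refl refl | is-s′ refl refl = noLink (miss-off sj′) sj l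
      ... | is-s refl refl | other ns ns′ g = proj₁ (nolink ns ns′ g) l
      ... | is-s′ refl refl | is-s refl refl = noLinkʳ sj (miss-off sj′) l
      ... | is-s′ refl refl | is-s′ refl _ = ne refl
      ... | is-s′ refl refl | other ns ns′ g = proj₂ (nolink ns ns′ g) l
      ... | other ns ns′ g | is-s refl refl = proj₁ (nolink ns ns′ g) (Link-recolour (Link-flip l))
      ... | other ns ns′ g | is-s′ refl refl = proj₂ (nolink ns ns′ g) (Link-recolour (Link-flip l))
      ... | other _ _ g | other _ _ g′ = noLink-star good {y = y} (λ _ _ _ e → e) g g′ ne l

  -- Neighbours and degrees

  module Nbrs (G : Graph n) where

    Adj : Fin n → Fin n → Set
    Adj u v = adj G u v ≡ true

    Adj-sym : ∀ {u v} → Adj u v → Adj v u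
    Adj-sym {u} {v} e = trans (adj-sym G v u) e

    Adj-irrefl : ∀ {u v} → Adj u v → u ≢ v
    Adj-irrefl {u} e refl with trans (sym e) (adj-irrefl G u)
    ... | ()

    nbrs : Fin n → List (Fin n)
    nbrs v = filter (λ w → adj G v w Bool.≟ true) (allFin n)

    deg : Fin n → ℕ
    deg v = length (nbrs v)

    nbrs⁺ : ∀ {v w} → Adj v w → w ∈ nbrs v
    nbrs⁺ {v} {w} e = ∈-filter⁺ (λ w → adj G v w Bool.≟ true) (∈-allFin w) e

    nbrs⁻ : ∀ {v w} → w ∈ nbrs v → Adj v w
    nbrs⁻ {v} w∈ = proj₂ (∈-filter⁻ (λ w → adj G v w Bool.≟ true) {xs = allFin n} w∈)

    nbrs-unique : ∀ v → Unique (nbrs v)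
    nbrs-unique v = Unique.filter⁺ (λ w → adj G v w Bool.≟ true) (Unique.allFin⁺ n)

    deg-≥ : ∀ {v us} → Unique us → All (Adj v) us → length us ≤ deg v
    deg-≥ u as = Unique-length u λ z∈ → nbrs⁺ (All.lookup as z∈)

    all-nbrs : ∀ {v us} → Unique us → All (Adj v) us → deg v ≤ length us → ∀ {w} → Adj v w → w ∈ us
    all-nbrs {v} {us} u as le {w} vw with w ∈ᶠ? us
    ... | yes i = i
    ... | no w∉ = contradiction
      (deg-≥ {us = w ∷ us} (All.tabulate (λ z∈ e → w∉ (subst (_∈ us) (sym e) z∈)) ∷ u) (vw ∷ as)) (ℕ.<⇒≱ (s≤s le))

    Big : Fin n → Set
    Big v = 4 ≤ deg v

    big : Fin n → ℕ
    big v = length (filter (λ w → 4 ℕ.≤? deg w) (nbrs v))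

    big-≥ : ∀ {v us} → Unique us → All (λ w → Adj v w × Big w) us → length us ≤ big v
    big-≥ {v} u as = Unique-length u λ z∈ → let (vz , bz) = All.lookup as z∈ in
      ∈-filter⁺ (λ w → 4 ℕ.≤? deg w) (nbrs⁺ vz) bz

    record On (D : List (Fin n)) (c : Colouring) : Set where
      field
        covers : ∀ {u v} → Adj u v → u ∉ D → v ∉ D → ∃ λ a → c u v ≡ just a
        within : ∀ {u v a} → c u v ≡ just a → Adj u v × u ∉ D × v ∉ D

    opaque
      -- The edges to the deleted neighbours `zs` are uncoloured, so the colours at u together with
      -- the list `xs` do not fill the palette.
      avoid : ∀ {D} {c : Colouring} → On D c → ∀ {u} zs xs → Unique zs → All (λ z → Adj u z × z ∈ D) zs →
              length xs + deg u < k + length zs → ∃ λ a → a ∉ xs × miss c u a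
      avoid {D} {c} on {u} zs xs uz az lt with fresh (xs ++ mapMaybe (c u) rest) short
        where
        rest : List (Fin n)
        rest = filter (λ w → ¬? (w ∈ᶠ? zs)) (nbrs u)
        rest-length : length rest + length zs ≤ deg u
        rest-length = subst (_≤ deg u) (trans (length-++ zs) (ℕ.+-comm (length zs) (length rest)))
          (Unique-length {xs = zs ++ rest}
            (Unique.++⁺ uz (Unique.filter⁺ (λ w → ¬? (w ∈ᶠ? zs)) (nbrs-unique u))
              (λ { (i , j) → proj₂ (∈-filter⁻ (λ w → ¬? (w ∈ᶠ? zs)) {xs = nbrs u} j) i }))
            λ {z} z∈ → [ (λ i → nbrs⁺ (proj₁ (All.lookup az i)))
                       , (λ j → proj₁ (∈-filter⁻ (λ w → ¬? (w ∈ᶠ? zs)) {xs = nbrs u} j)) ]′ (∈-++⁻ zs z∈))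
        short : length (xs ++ mapMaybe (c u) rest) < k
        short = ℕ.+-cancelʳ-< (length zs) _ _ (begin-strict
          length (xs ++ mapMaybe (c u) rest) + length zs ≡⟨ cong (_+ length zs) (length-++ xs) ⟩
          length xs + length (mapMaybe (c u) rest) + length zs
            ≤⟨ ℕ.+-monoˡ-≤ (length zs) (ℕ.+-monoʳ-≤ (length xs) (length-mapMaybe (c u) rest)) ⟩
          length xs + length rest + length zs ≡⟨ ℕ.+-assoc (length xs) _ _ ⟩
          length xs + (length rest + length zs) ≤⟨ ℕ.+-monoʳ-≤ (length xs) rest-length ⟩
          length xs + deg u <⟨ lt ⟩
          k + length zs ∎)
          where open ℕ.≤-Reasoning
      ... | a , a∉ = a , (λ i → a∉ (∈-++⁺ˡ i)) , λ w e → a∉ (∈-++⁺ʳ xs (found (w∈ e) e))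
        where
        rest : List (Fin n)
        rest = filter (λ w → ¬? (w ∈ᶠ? zs)) (nbrs u)
        w∈ : ∀ {w a} → c u w ≡ just a → w ∈ rest
        w∈ e with On.within on e
        ... | uw , _ , w∉ = ∈-filter⁺ (λ w → ¬? (w ∈ᶠ? zs)) (nbrs⁺ uw) λ i → w∉ (proj₂ (All.lookup az i))
        found : ∀ {w a ys} → w ∈ ys → c u w ≡ just a → a ∈ mapMaybe (c u) ys
        found {ys = y ∷ ys} (here refl) e rewrite e = here refl
        found {ys = y ∷ ys} (there i) e with c u y
        ... | just _  = there (found i e)
        ... | nothing = found i e

    ends : ∀ {c : Colouring} {u} as → Unique as → All (has c u) as →
           ∃ λ ws → length ws ≡ length as × Unique ws × All (λ w → ∃ λ a → a ∈ as × c u w ≡ just a) ws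
    ends [] _ _ = [] , refl , [] , []
    ends {c} {u} (a ∷ as) (a∉ ∷ ua) ((w , e) ∷ hs) with ends {c} {u} as ua hs
    ... | ws , len , uw , al = w ∷ ws , cong suc len , All.map fresh′ al ∷ uw ,
          (a , here refl , e) ∷ All.map (λ (b , b∈ , g) → b , there b∈ , g) al
      where
      fresh′ : ∀ {w′} → (∃ λ b → b ∈ as × c u w′ ≡ just b) → w ≢ w′
      fresh′ (b , b∈ , g) refl = All.lookup a∉ b∈ (just-injective (trans (sym e) g))

    -- Differently coloured edges at u have different ends, and these lie outside D, hence apart
    -- from `zs`. This is how a vertex that sees many colours is shown to have large degree.
    deg-colours : ∀ {D} {c : Colouring} → On D c → ∀ {u} zs as → Unique zs → All (λ z → Adj u z × z ∈ D) zs →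
                  Unique as → All (has c u) as → length as + length zs ≤ deg u
    deg-colours {D} {c} on {u} zs as uz az ua ha with ends {c} {u} as ua ha
    ... | ws , len , uw , al = subst (_≤ deg u) (trans (length-++ ws) (cong (_+ length zs) len))
      (Unique-length {xs = ws ++ zs}
        (Unique.++⁺ uw uz (λ { (i , j) → let (_ , _ , e) = All.lookup al i in
            proj₂ (proj₂ (On.within on e)) (proj₂ (All.lookup az j)) }))
        λ z∈ → nbrs⁺ ([ (λ i → let (_ , _ , e) = All.lookup al i in proj₁ (On.within on e))
                      , (λ j → proj₁ (All.lookup az j)) ]′ (∈-++⁻ ws z∈)))

    On-del : ∀ {D D′} {c : Colouring} → On D c → On (D′ ++ D) (del D′ c)
    On-del {D} {D′} {c} on = record
      { covers = λ e u∉ v∉ → let (a , g) = On.covers on e (u∉ ∘ ∈-++⁺ʳ D′) (v∉ ∘ ∈-++⁺ʳ D′) in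
          a , trans (del-keep {D = D′} {c = c} (u∉ ∘ ∈-++⁺ˡ) (v∉ ∘ ∈-++⁺ˡ)) g
      ; within = λ e → let (u∉ , v∉ , g) = del-just {D = D′} {c = c} e ; (e′ , u∉′ , v∉′) = On.within on g in
          e′ , (λ i → [ u∉ , u∉′ ]′ (∈-++⁻ D′ i)) , (λ i → [ v∉ , v∉′ ]′ (∈-++⁻ D′ i)) }

    -- Only the behaviour of c away from v is used, so this covers both adding v to
    -- the coloured subgraph and recolouring the edges at v.
    On-setStar : ∀ {D v} {c : Colouring} {f} → v ∉ D →
      (∀ {u w} → u ≢ v → w ≢ v → Adj u w → u ∉ D → w ∉ D → ∃ λ a → c u w ≡ just a) →
      (∀ {u w a} → u ≢ v → w ≢ v → c u w ≡ just a → Adj u w × u ∉ D × w ∉ D) →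
      (∀ {u} → Adj v u → u ∉ D → ∃ λ a → f u ≡ just a) →
      (∀ {u a} → f u ≡ just a → Adj v u × u ∉ D) → On D (setStar c v f)
    On-setStar {D} {v} {c} {f} v∉D cov wit fcov fwit = record { covers = covers′ ; within = within′ }
      where
      covers′ : ∀ {u w} → Adj u w → u ∉ D → w ∉ D → ∃ λ a → setStar c v f u w ≡ just a
      covers′ {u} {w} e u∉ w∉ with u ≟ v | w ≟ v
      ... | yes refl | _ = let (a , g) = fcov e w∉ in a , trans (star-at c v f w) g
      ... | no u≢v | yes refl = let (a , g) = fcov (Adj-sym e) u∉ in a , trans (star-to c v f u≢v) g
      ... | no u≢v | no w≢v = let (a , g) = cov u≢v w≢v e u∉ w∉ in a , trans (star-off c v f u≢v w≢v) g
      within′ : ∀ {u w a} → setStar c v f u w ≡ just a → Adj u w × u ∉ D × w ∉ D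
      within′ {u} {w} e with u ≟ v | w ≟ v
      ... | yes refl | _ = let (g , w∉) = fwit (trans (sym (star-at c v f w)) e) in g , v∉D , w∉
      ... | no u≢v | yes refl = let (g , u∉) = fwit (trans (sym (star-to c v f u≢v)) e) in Adj-sym g , u∉ , v∉D
      ... | no u≢v | no w≢v = wit u≢v w≢v (trans (sym (star-off c v f u≢v w≢v)) e)

    On-recolour : ∀ {D y s j β} {c : Colouring} → On D c → c y s ≡ just j → On D (recolour c y s β)
    On-recolour {D} {y} {s} {j} {β} {c} on ys = On-setStar y∉
      (λ _ _ → On.covers on) (λ _ _ → On.within on) fc fw
      where
      y∉ = proj₁ (proj₂ (On.within on ys))
      fc : ∀ {u} → Adj y u → u ∉ D → ∃ λ a → upd (c y) s β u ≡ just a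
      fc {u} e u∉ with u ≟ s
      ... | yes refl = β , upd-same (c y) s β
      ... | no u≢s = let (a , g) = On.covers on e y∉ u∉ in a , trans (upd-other (c y) s β u≢s) g
      fw : ∀ {u a} → upd (c y) s β u ≡ just a → Adj y u × u ∉ D
      fw e with upd-just (c y) s β e
      ... | inj₁ (refl , _) = let (g , _ , u∉) = On.within on ys in g , u∉
      ... | inj₂ (_ , e′) = let (g , _ , u∉) = On.within on e′ in g , u∉

    On-swapped : ∀ {D y s s′ j j′} {c : Colouring} → On D c → c y s ≡ just j → c y s′ ≡ just j′ →
                 On D (swapped c y s s′ j j′)
    On-swapped {D} {y} {s} {s′} {j} {j′} {c} on ys ys′ = On-setStar y∉
      (λ _ _ → On.covers on) (λ _ _ → On.within on) fc fw
      where
      f = upd (upd (c y) s′ j) s j′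
      y∉ = proj₁ (proj₂ (On.within on ys))
      fc : ∀ {u} → Adj y u → u ∉ D → ∃ λ a → f u ≡ just a
      fc {u} e u∉ with u ≟ s
      ... | yes refl = j′ , upd-same _ s j′
      ... | no u≢s with u ≟ s′
      ... | yes refl = j , trans (upd-other _ s j′ u≢s) (upd-same (c y) s′ j)
      ... | no u≢s′ = let (a , g) = On.covers on e y∉ u∉ in
        a , trans (upd-other _ s j′ u≢s) (trans (upd-other (c y) s′ j u≢s′) g)
      fw : ∀ {u a} → f u ≡ just a → Adj y u × u ∉ D
      fw e with upd-just _ s j′ e
      ... | inj₁ (refl , _) = let (g , _ , u∉) = On.within on ys in g , u∉
      ... | inj₂ (_ , e′) with upd-just (c y) s′ j e′
      ... | inj₁ (refl , _) = let (g , _ , u∉) = On.within on ys′ in g , u∉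
      ... | inj₂ (_ , e″) = let (g , _ , u∉) = On.within on e″ in g , u∉

    deg≡degree : ∀ v → deg v ≡ degree G v
    deg≡degree v = begin
      length (nbrs v) ≡⟨ sym (ℕ.*-identityˡ _) ⟩
      1 * length (nbrs v) ≡⟨ sym (∑-const (nbrs v) 1) ⟩
      ∑ (nbrs v) (λ _ → 1) ≡⟨ ∑-filter (λ w → adj G v w Bool.≟ true) (allFin n) (λ _ → 1) ⟩
      ∑ (allFin n) (λ w → if does (adj G v w Bool.≟ true) then 1 else 0) ≡⟨ ∑-cong (allFin n) (λ w → same (adj G v w)) ⟩
      ∑ (allFin n) (bit ∘ adj G v) ≡⟨ sym (countTrue-map (adj G v) (allFin n)) ⟩
      degree G v ∎
      where
      open ≡-Reasoning
      same : ∀ b → (if does (b Bool.≟ true) then 1 else 0) ≡ bit b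
      same true = refl
      same false = refl

  link-has : ∀ {K a b p s} → miss K s a → Link K a b p s → has K s b
  link-has m l with Link.endʳ l
  ... | inj₁ (w , _ , e) = ⊥-elim (m w e)
  ... | inj₂ (w , _ , e) = w , e

  has-mono : ∀ {c c′ u a} → c ⊑ c′ → has c u a → has c′ u a
  has-mono le (w , e) = w , le _ _ _ e

  opaque
    -- Since presence of a colour is decidable, a doubly negated path still yields an actual edge at
    -- its end.
    has-stable : ∀ {c u a} → ¬ ¬ has c u a → has c u a
    has-stable {c} {u} {a} = decidable-stable (has? c u a)

  has≢miss : ∀ {c : Colouring} {y j β} → has c y j → miss c y β → j ≢ β
  has≢miss (w , e) m refl = m w e

  -- What remains of a colouring of G minus the edge xy when x is taken away: i and j are the
  -- colours that xu and xv had, and an (i,j)-path from u to v would have closed a cycle through x.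
  Start : Colouring → Fin n → Fin n → Set₁
  Start c u v = Σ (Fin k) λ i → Σ (Fin k) λ j → miss c u i × miss c v j × i ≢ j × ¬ Link c i j u v

  Start-swap : ∀ {c u v} → Start c u v → Start c v u
  Start-swap (i , j , ui , vj , ne , ¬l) = j , i , vj , ui , ne ∘ sym , λ l → ¬l (Link-recolour (Link-flip l))

  record Three (P : Fin k → Set) : Set where
    field
      {α β γ} : Fin k
      pα : P α
      pβ : P β
      pγ : P γ
      α≢β : α ≢ β
      α≢γ : α ≢ γ
      β≢γ : β ≢ γ

    unique : Unique (α ∷ β ∷ γ ∷ [])
    unique = (α≢β ∷ α≢γ ∷ []) ∷ (β≢γ ∷ []) ∷ [] ∷ []

  opaque
    three : ∀ {P : Fin k → Set} → (∀ xs → length xs < 3 → ∃ λ a → a ∉ xs × P a) → Three P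
    three pick with pick [] (s≤s z≤n)
    ... | a , _ , pa with pick (a ∷ []) (s≤s (s≤s z≤n))
    ... | b , b∉ , pb with pick (a ∷ b ∷ []) (s≤s (s≤s (s≤s z≤n)))
    ... | d , d∉ , pd = record { pα = pa ; pβ = pb ; pγ = pd
      ; α≢β = λ e → b∉ (here (sym e)) ; α≢γ = λ e → d∉ (here (sym e)) ; β≢γ = λ e → d∉ (there (here (sym e))) }

  -- Minimal counterexamples; vertices of degree one and two.

  module _ (G : Graph n) where
    open Nbrs G

    record Minus (x y : Fin n) (c : Colouring) : Set where
      field
        covers : ∀ {u v} → Adj u v → ¬ (u ≡ x × v ≡ y) → ¬ (u ≡ y × v ≡ x) → ∃ λ a → c u v ≡ just a
        within : ∀ {u v a} → c u v ≡ just a → Adj u v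

    -- Δ is only an upper bound for the degrees, so that it survives the removal of edges. `minimal`
    -- is doubly negated because smaller graphs are coloured only indirectly.
    record Critical : Set₁ where
      field
        Δ       : ℕ
        k≡      : k ≡ 2 + Δ
        deg≤    : ∀ v → deg v ≤ Δ
        noCol   : ∀ {c} → Good c → On [] c → ⊥
        minimal : ∀ {x y} → Adj x y → ¬ ¬ (Σ Colouring λ c → Good c × Minus x y c)

    record Nbr2 (x w y : Fin n) : Set where
      field
        xw   : Adj x w
        xy   : Adj x y
        w≢y  : w ≢ y
        only : ∀ {u} → Adj x u → u ≡ w ⊎ u ≡ y

    record Nbr3 (x y u v : Fin n) : Set where
      field
        xy   : Adj x y
        xu   : Adj x u
        xv   : Adj x v
        y≢u  : y ≢ u
        y≢v  : y ≢ v
        u≢v  : u ≢ v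
        only : ∀ {w} → Adj x w → w ≡ y ⊎ w ≡ u ⊎ w ≡ v

    Nbr3-swap : ∀ {x y u v} → Nbr3 x y u v → Nbr3 x y v u
    Nbr3-swap r = record { xy = xy ; xu = xv ; xv = xu ; y≢u = y≢v ; y≢v = y≢u ; u≢v = u≢v ∘ sym
      ; only = λ e → Data.Sum.map id swap⊎ (only e) }
      where open Nbr3 r

    Nbr3-rotate : ∀ {x y u v} → Nbr3 x y u v → Nbr3 x v u y
    Nbr3-rotate r = record { xy = xv ; xu = xu ; xv = xy ; y≢u = u≢v ∘ sym ; y≢v = y≢v ∘ sym ; u≢v = y≢u ∘ sym
      ; only = λ e → turn (only e) }
      where
      open Nbr3 r
      turn : ∀ {A B C : Set} → A ⊎ B ⊎ C → C ⊎ B ⊎ A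
      turn (inj₁ a) = inj₂ (inj₂ a)
      turn (inj₂ (inj₁ b)) = inj₂ (inj₁ b)
      turn (inj₂ (inj₂ c)) = inj₁ c

    nbr2 : ∀ {x y} → deg x ≡ 2 → Adj x y → ∃ λ w → Nbr2 x w y
    nbr2 {x} {y} d xy with nbrs x in eq | nbrs-unique x
    nbr2 {x} {y} d xy | p ∷ q ∷ [] | (p≢q ∷ []) ∷ _ = pick (subst (y ∈_) eq (nbrs⁺ xy))
      where
      Ap : Adj x p
      Ap = nbrs⁻ (subst (p ∈_) (sym eq) (here refl))
      Aq : Adj x q
      Aq = nbrs⁻ (subst (q ∈_) (sym eq) (there (here refl)))
      cases : ∀ {u} → Adj x u → u ≡ p ⊎ u ≡ q
      cases xu with subst (_ ∈_) eq (nbrs⁺ xu)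
      ... | here e = inj₁ e
      ... | there (here e) = inj₂ e
      pick : y ∈ p ∷ q ∷ [] → ∃ λ w → Nbr2 x w y
      pick (here refl) = q , record { xw = Aq ; xy = Ap ; w≢y = p≢q ∘ sym ; only = swap⊎ ∘ cases }
      pick (there (here refl)) = p , record { xw = Ap ; xy = Aq ; w≢y = p≢q ; only = cases }

    nbr3 : ∀ {x y} → deg x ≡ 3 → Adj x y → ∃ λ u → ∃ λ v → Nbr3 x y u v
    nbr3 {x} {y} d xy with nbrs x in eq | nbrs-unique x
    nbr3 {x} {y} d xy | p ∷ q ∷ r ∷ [] | (p≢q ∷ p≢r ∷ []) ∷ (q≢r ∷ []) ∷ _ = pick (subst (y ∈_) eq (nbrs⁺ xy))
      where
      A : ∀ {z} → z ∈ p ∷ q ∷ r ∷ [] → Adj x z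
      A z∈ = nbrs⁻ (subst (_ ∈_) (sym eq) z∈)
      cases : ∀ {u} → Adj x u → u ≡ p ⊎ u ≡ q ⊎ u ≡ r
      cases xu with subst (_ ∈_) eq (nbrs⁺ xu)
      ... | here e = inj₁ e
      ... | there (here e) = inj₂ (inj₁ e)
      ... | there (there (here e)) = inj₂ (inj₂ e)
      base : Nbr3 x p q r
      base = record { xy = A (here refl) ; xu = A (there (here refl)) ; xv = A (there (there (here refl)))
        ; y≢u = p≢q ; y≢v = p≢r ; u≢v = q≢r ; only = cases }
      pick : y ∈ p ∷ q ∷ r ∷ [] → ∃ λ u → ∃ λ v → Nbr3 x y u v
      pick (here refl) = q , r , base
      pick (there (here refl)) = r , p , Nbr3-rotate (Nbr3-swap base)
      pick (there (there (here refl))) = q , p , Nbr3-rotate base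

    attach2 : Colouring → (x w : Fin n) (ε : Fin k) (y : Fin n) (δ : Fin k) → Colouring
    attach2 c x w ε y δ = setStar c x (upd (upd none y δ) w ε)

    module Attach2 {c : Colouring} {D x w y} {ε δ : Fin k} (nb : Nbr2 x w y) (w≢ : w ∉ D) (y≢ : y ∉ D) where
      open Nbr2 nb
      f = upd (upd none y δ) w ε

      f-y : f y ≡ just δ
      f-y = trans (upd-other _ w ε (w≢y ∘ sym)) (upd-same none y δ)

      view : ∀ {r a} → f r ≡ just a → (r ≡ w × a ≡ ε) ⊎ (r ≡ y × a ≡ δ)
      view e with upd-just _ w ε e
      ... | inj₁ p = inj₁ p
      ... | inj₂ (_ , e′) with upd-just none y δ e′
      ... | inj₁ p = inj₂ p
      ... | inj₂ (_ , ())

      On-attach2 : On (x ∷ D) c → x ∉ D → On D (attach2 c x w ε y δ)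
      On-attach2 on x∉ = On-setStar x∉
        (λ u≢ v≢ e u∉ v∉ → On.covers on e (ext u≢ u∉) (ext v≢ v∉))
        (λ _ _ e → let (a , u∉ , v∉) = On.within on e in a , (u∉ ∘ there) , (v∉ ∘ there)) fc fw
        where
        ext : ∀ {u} → u ≢ x → u ∉ D → u ∉ x ∷ D
        ext n₁ n₂ (here e) = n₁ e
        ext n₁ n₂ (there i) = n₂ i
        fc : ∀ {u} → Adj x u → u ∉ D → ∃ λ a → f u ≡ just a
        fc xu _ with only xu
        ... | inj₁ refl = ε , upd-same _ w ε
        ... | inj₂ refl = δ , f-y
        fw : ∀ {u a} → f u ≡ just a → Adj x u × u ∉ D
        fw e with view e
        ... | inj₁ (refl , _) = xw , w≢
        ... | inj₂ (refl , _) = xy , y≢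

      Good-attach2 : Good c → miss c w ε → miss c y δ → ε ≢ δ → ¬ Link c ε δ w y → Good (attach2 c x w ε y δ)
      Good-attach2 good wε yδ ε≢δ ¬l = Good-setStar good f fx inj mis lnk
        where
        fx : f x ≡ nothing
        fx with f x in eq
        ... | nothing = refl
        ... | just a with view eq
        ... | inj₁ (refl , _) = ⊥-elim (Adj-irrefl xw refl)
        ... | inj₂ (refl , _) = ⊥-elim (Adj-irrefl xy refl)
        inj : ∀ {u u′ a} → f u ≡ just a → f u′ ≡ just a → u ≡ u′
        inj e e′ with view e | view e′
        ... | inj₁ (refl , refl) | inj₁ (refl , _) = refl
        ... | inj₁ (refl , refl) | inj₂ (_ , p) = ⊥-elim (ε≢δ p)
        ... | inj₂ (refl , refl) | inj₁ (_ , p) = ⊥-elim (ε≢δ (sym p))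
        ... | inj₂ (refl , refl) | inj₂ (refl , _) = refl
        mis : ∀ {u a} → f u ≡ just a → miss (off x c) u a
        mis e with view e
        ... | inj₁ (refl , refl) = miss-off wε
        ... | inj₂ (refl , refl) = miss-off yδ
        lnk : ∀ {u u′ a b} → u ≢ u′ → f u ≡ just a → f u′ ≡ just b → ¬ Link (off x c) a b u u′
        lnk ne e e′ l with view e | view e′
        ... | inj₁ (refl , refl) | inj₁ (refl , _) = ne refl
        ... | inj₁ (refl , refl) | inj₂ (refl , refl) = ¬Link-off ¬l l
        ... | inj₂ (refl , refl) | inj₁ (refl , refl) = ¬Link-off ¬l (Link-recolour (Link-flip l))
        ... | inj₂ (refl , refl) | inj₂ (refl , _) = ne refl

    module _ (crit : Critical) where
      open Critical crit

      opaque
        -- Of Δ + 2 colours every vertex misses two, and one more for each deleted neighbour.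
        avoidΔ : ∀ {D c} → On D c → ∀ {u} zs xs → Unique zs → All (λ z → Adj u z × z ∈ D) zs →
                 length xs < 2 + length zs → ∃ λ a → a ∉ xs × miss c u a
        avoidΔ on {u} zs xs uz az lt = avoid on zs xs uz az (begin-strict
          length xs + deg u ≤⟨ ℕ.+-monoʳ-≤ (length xs) (deg≤ u) ⟩
          length xs + Δ <⟨ ℕ.+-monoˡ-< Δ lt ⟩
          2 + length zs + Δ ≡⟨ cong (2 +_) (ℕ.+-comm (length zs) Δ) ⟩
          2 + Δ + length zs ≡⟨ cong (_+ length zs) (sym k≡) ⟩
          k + length zs ∎)
          where open ℕ.≤-Reasoning

      avoid1 : ∀ {D c} → On D c → ∀ {u z} → Adj u z → z ∈ D → ∀ xs → length xs < 3 →
               ∃ λ a → a ∉ xs × miss c u a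
      avoid1 on {u} {z} uz z∈ xs lt = avoidΔ on (z ∷ []) xs ([] ∷ []) ((uz , z∈) ∷ []) lt

      avoid2 : ∀ {D c} → On D c → ∀ {u z z′} → Adj u z → z ∈ D → Adj u z′ → z′ ∈ D → z ≢ z′ → ∀ xs → length xs < 4 →
               ∃ λ a → a ∉ xs × miss c u a
      avoid2 on {u} {z} {z′} uz z∈ uz′ z′∈ ne xs lt =
        avoidΔ on (z ∷ z′ ∷ []) xs ((ne ∷ []) ∷ [] ∷ []) ((uz , z∈) ∷ (uz′ , z′∈) ∷ []) lt

      del-On : ∀ {x y c} → Minus x y c → On (x ∷ []) (off x c)
      del-On {x} {y} {c} mi = record
        { covers = λ e u∉ v∉ → let (a , g) = Minus.covers mi e (λ { (refl , _) → u∉ (here refl) }) (λ { (_ , refl) → v∉ (here refl) })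
                               in a , trans (del-keep {D = x ∷ []} {c = c} u∉ v∉) g
        ; within = λ e → let (u∉ , v∉ , g) = del-just {D = x ∷ []} {c = c} e in Minus.within mi g , u∉ , v∉ }

      colour-off : ∀ {x y} → Adj x y → ¬ ¬ (Σ Colouring λ c → Good c × On (x ∷ []) c)
      colour-off {x} xy no! = minimal xy λ { (c , good , mi) → no! (off x c , Good-del (x ∷ []) good , del-On mi) }

      -- A pendant edge lies on no cycle, so any colour missing at y extends the colouring to a leaf
      -- x.
      noLeaf : ∀ {x y} → Adj x y → 2 ≤ deg x
      noLeaf {x} {y} xy = ℕ.≮⇒≥ λ lt → colour-off xy λ { (c , good , on) → contra lt good on }
        where
        contra : ∀ {c} → deg x < 2 → Good c → On (x ∷ []) c → ⊥
        contra {c} (s≤s le) good on with avoid1 on (Adj-sym xy) (here refl) [] (s≤s z≤n)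
        ... | α , _ , yα = noCol (Good-setStar good f fx inj mis lnk) (On-setStar (λ ())
                (λ u≢ v≢ e _ _ → On.covers on e (λ { (here e) → u≢ e }) (λ { (here e) → v≢ e }))
                (λ _ _ e → proj₁ (On.within on e) , (λ ()) , (λ ())) fc fw)
          where
          f = upd none y α
          view : ∀ {r a} → f r ≡ just a → r ≡ y × a ≡ α
          view e with upd-just none y α e
          ... | inj₁ p = p
          ... | inj₂ (_ , ())
          fx : f x ≡ nothing
          fx = upd-other none y α (Adj-irrefl xy)
          inj : ∀ {u u′ a} → f u ≡ just a → f u′ ≡ just a → u ≡ u′
          inj e e′ = trans (proj₁ (view e)) (sym (proj₁ (view e′)))
          mis : ∀ {u a} → f u ≡ just a → miss (off x c) u a
          mis e with view e
          ... | refl , refl = miss-off yα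
          lnk : ∀ {u u′ a b} → u ≢ u′ → f u ≡ just a → f u′ ≡ just b → ¬ Link (off x c) a b u u′
          lnk ne e e′ _ = ne (inj′ (view e) (view e′))
            where
            inj′ : ∀ {u u′ a b} → u ≡ y × a ≡ α → u′ ≡ y × b ≡ α → u ≡ u′
            inj′ (refl , _) (refl , _) = refl
          fc : ∀ {u} → Adj x u → u ∉ [] → ∃ λ a → f u ≡ just a
          fc xu _ with all-nbrs {us = y ∷ []} ([] ∷ []) (xy ∷ []) le xu
          ... | here refl = α , upd-same none y α
          fw : ∀ {u a} → f u ≡ just a → Adj x u × u ∉ []
          fw e with view e
          ... | refl , _ = xy , λ ()

      -- Suppose that a missing 2-vertex with neighbours w and y cannot be added using
      -- colours for its edge to y outside avoided.
      module Stuck {c D w y} (good : Good c) (on : On D c) (avoided : List (Fin k))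
                   (stuck : ∀ {ε δ} → miss c w ε → miss c y δ → δ ∉ avoided → ε ≢ δ → L c ε δ w y)
                   (w-rich : ∀ xs → length xs < 3 → ∃ λ a → a ∉ xs × miss c w a)
                   (y-rich : Three (λ a → miss c y a × a ∉ avoided)) where
        open Good good

        -- If w missed α too, then for a second missing colour γ of w a (γ,α)-path would have to
        -- start at w, where both colours are absent.
        disjoint : ∀ {α} → miss c y α → α ∉ avoided → has c w α
        disjoint {α} yα α∉ with has⊎miss c w α
        ... | inj₁ h = h
        ... | inj₂ wα with w-rich (α ∷ []) (s≤s (s≤s z≤n))
        ... | γ , γ∉ , wγ = ⊥-elim (stuck wγ yα α∉ (λ e → γ∉ (here e)) (noLink wγ wα))

        γ≢α : ∀ {γ α} → miss c w γ → miss c y α → α ∉ avoided → γ ≢ α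
        γ≢α wγ yα α∉ refl = let (s , e) = disjoint yα α∉ in wγ s e

        -- Otherwise y would miss both γ and an allowed colour and could not be the end of the path
        -- that blocks this pair.
        nbr-of : ∀ {γ} → miss c w γ → has c y γ
        nbr-of {γ} wγ with has⊎miss c y γ
        ... | inj₁ h = h
        ... | inj₂ yγ = let (yα , α∉) = Three.pα y-rich in ⊥-elim (stuck wγ yα α∉ (γ≢α wγ yα α∉) (noLinkʳ yγ yα))

        module _ {γ s} (wγ : miss c w γ) (ys : c y s ≡ just γ) where
          w≢s : w ≢ s
          w≢s refl = wγ y (flip ys)

          -- The blocking path reaches y through ys, the only edge at y in its two colours.
          link : ∀ {α} → miss c y α → α ∉ avoided → L (off y c) γ α w s
          link yα α∉ ¬l = stuck wγ yα α∉ (γ≢α wγ yα α∉) λ l →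
            ¬l (dropEnd good (self-⊑off c y) ys yα w≢s l)

          s-has : ∀ {α} → miss c y α → α ∉ avoided → has c s α
          s-has yα α∉ = has-stable {c} λ ¬h → link yα α∉ λ l →
            ¬h (has-mono {off y c} {c} (del-⊑ (y ∷ []) c) (link-has (miss-used good ys) l))

          -- Besides γ on sy, the vertex s has the last edge of a blocking path for each of three
          -- allowed colours.
          s-big : Big s
          s-big = deg-colours on [] (γ ∷ T.α ∷ T.β ∷ T.γ ∷ []) [] []
            ((ne T.pα ∷ ne T.pβ ∷ ne T.pγ ∷ []) ∷ T.unique)
            ((y , flip ys) ∷ ha T.pα ∷ ha T.pβ ∷ ha T.pγ ∷ [])
            where
            module T = Three y-rich
            ne : ∀ {α} → miss c y α × α ∉ avoided → γ ≢ α
            ne (m , ∉) = γ≢α wγ m ∉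
            ha : ∀ {α} → miss c y α × α ∉ avoided → has c s α
            ha (m , ∉) = s-has m ∉

      -- The three colours missing at w all occur at y, on three edges with big ends.
      three-big : ∀ {x w y} → Nbr2 x w y → 3 ≤ big y
      three-big {x} {w} {y} nb = ℕ.≮⇒≥ λ lt → colour-off xy λ { (c , good , on) → contra lt good on }
        where
        open Nbr2 nb
        contra : ∀ {c} → big y < 3 → Good c → On (x ∷ []) c → ⊥
        contra {c} lt good on = ℕ.<⇒≱ lt (count (three w-rich))
          where
          w-rich = avoid1 on (Adj-sym xw) (here refl)
          y-rich : Three (λ a → miss c y a × a ∉ [])
          y-rich = three λ xs lt → let (a , a∉ , m) = avoid1 on (Adj-sym xy) (here refl) xs lt in a , a∉ , m , λ ()
          stuck : ∀ {ε δ} → miss c w ε → miss c y δ → δ ∉ [] → ε ≢ δ → L c ε δ w y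
          stuck wε yδ _ ne ¬l = noCol (Good-attach2 good wε yδ ne ¬l) (On-attach2 on (λ ()))
            where open Attach2 {D = []} nb (λ ()) (λ ())
          open Stuck good on [] stuck w-rich y-rich
          dif : ∀ {γ γ′ s s′} → γ ≢ γ′ → c y s ≡ just γ → c y s′ ≡ just γ′ → s ≢ s′
          dif ne e e′ refl = ne (just-injective (trans (sym e) e′))
          count : Three (miss c w) → 3 ≤ big y
          count t = collect (nbr-of pα) (nbr-of pβ) (nbr-of pγ)
            where
            open Three t
            collect : has c y α → has c y β → has c y γ → 3 ≤ big y
            collect (s₁ , e₁) (s₂ , e₂) (s₃ , e₃) = big-≥ {us = s₁ ∷ s₂ ∷ s₃ ∷ []}
              ((dif α≢β e₁ e₂ ∷ dif α≢γ e₁ e₃ ∷ []) ∷ (dif β≢γ e₂ e₃ ∷ []) ∷ [] ∷ [])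
              ((proj₁ (On.within on e₁) , s-big pα e₁) ∷ (proj₁ (On.within on e₂) , s-big pβ e₂) ∷
               (proj₁ (On.within on e₃) , s-big pγ e₃) ∷ [])

  -- Vertices of degree three

  module _ (G : Graph n) (crit : Critical G) where
    open Nbrs G
    open Critical crit

    module Attach3 {x y u v} {α a b : Fin k} (nb : Nbr3 G x y u v) where
      open Nbr3 nb

      f : Fin n → Maybe (Fin k)
      f = upd (upd (upd none v b) u a) y α

      data View (r : Fin n) (d : Fin k) : Set where
        at-y : r ≡ y → d ≡ α → View r d
        at-u : r ≡ u → d ≡ a → View r d
        at-v : r ≡ v → d ≡ b → View r d

      view : ∀ {r d} → f r ≡ just d → View r d
      view e with upd-just _ y α e
      ... | inj₁ (p , q) = at-y p q
      ... | inj₂ (_ , e′) with upd-just _ u a e′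
      ... | inj₁ (p , q) = at-u p q
      ... | inj₂ (_ , e″) with upd-just none v b e″
      ... | inj₁ (p , q) = at-v p q
      ... | inj₂ (_ , ())

      On-attach3 : ∀ {c} → On (x ∷ []) c → On [] (setStar c x f)
      On-attach3 {c} on = On-setStar (λ ())
        (λ u≢ v≢ e _ _ → On.covers on e (λ { (here e) → u≢ e }) (λ { (here e) → v≢ e }))
        (λ _ _ e → proj₁ (On.within on e) , (λ ()) , (λ ())) fc fw
        where
        fc : ∀ {r} → Adj x r → r ∉ [] → ∃ λ d → f r ≡ just d
        fc xr _ with only xr
        ... | inj₁ refl = α , upd-same _ y α
        ... | inj₂ (inj₁ refl) = a , trans (upd-other _ y α (y≢u ∘ sym)) (upd-same _ u a)
        ... | inj₂ (inj₂ refl) = b ,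
          trans (upd-other _ y α (y≢v ∘ sym)) (trans (upd-other _ u a (u≢v ∘ sym)) (upd-same _ v b))
        fw : ∀ {r d} → f r ≡ just d → Adj x r × r ∉ []
        fw e with view e
        ... | at-y refl _ = xy , λ ()
        ... | at-u refl _ = xu , λ ()
        ... | at-v refl _ = xv , λ ()

      Good-attach3 : ∀ {c} → Good c → miss c y α → miss c u a → miss c v b → α ≢ a → α ≢ b → a ≢ b →
        ¬ Link c a b u v → ¬ Link c a α u y → ¬ Link c b α v y → Good (setStar c x f)
      Good-attach3 {c} good yα ua vb α≢a α≢b a≢b nuv nuy nvy = Good-setStar good f fx inj mis lnk
        where
        fx : f x ≡ nothing
        fx with f x in eq
        ... | nothing = refl
        ... | just d with view eq
        ... | at-y refl _ = ⊥-elim (Adj-irrefl xy refl)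
        ... | at-u refl _ = ⊥-elim (Adj-irrefl xu refl)
        ... | at-v refl _ = ⊥-elim (Adj-irrefl xv refl)
        inj : ∀ {r r′ d} → f r ≡ just d → f r′ ≡ just d → r ≡ r′
        inj e e′ with view e | view e′
        ... | at-y refl refl | at-y refl _ = refl
        ... | at-y refl refl | at-u _ q = ⊥-elim (α≢a q)
        ... | at-y refl refl | at-v _ q = ⊥-elim (α≢b q)
        ... | at-u refl refl | at-y _ q = ⊥-elim (α≢a (sym q))
        ... | at-u refl refl | at-u refl _ = refl
        ... | at-u refl refl | at-v _ q = ⊥-elim (a≢b q)
        ... | at-v refl refl | at-y _ q = ⊥-elim (α≢b (sym q))
        ... | at-v refl refl | at-u _ q = ⊥-elim (a≢b (sym q))
        ... | at-v refl refl | at-v refl _ = refl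
        mis : ∀ {r d} → f r ≡ just d → miss (off x c) r d
        mis e with view e
        ... | at-y refl refl = miss-off yα
        ... | at-u refl refl = miss-off ua
        ... | at-v refl refl = miss-off vb
        turn : ∀ {a b p q} → Link c a b p q → Link c b a q p
        turn l = Link-recolour (Link-flip l)
        lnk : ∀ {r r′ d d′} → r ≢ r′ → f r ≡ just d → f r′ ≡ just d′ → ¬ Link (off x c) d d′ r r′
        lnk ne e e′ l with view e | view e′ | Link-mono (del-⊑ (x ∷ []) c) l
        ... | at-y refl refl | at-y refl _ | _ = ne refl
        ... | at-y refl refl | at-u refl refl | l′ = nuy (turn l′)
        ... | at-y refl refl | at-v refl refl | l′ = nvy (turn l′)
        ... | at-u refl refl | at-y refl refl | l′ = nuy l′
        ... | at-u refl refl | at-u refl _ | _ = ne refl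
        ... | at-u refl refl | at-v refl refl | l′ = nuv l′
        ... | at-v refl refl | at-y refl refl | l′ = nvy l′
        ... | at-v refl refl | at-u refl refl | l′ = nuv (turn l′)
        ... | at-v refl refl | at-v refl _ | _ = ne refl

    -- Otherwise the colouring would extend to x: a new cycle uses two of the three edges at x, and
    -- each pair has its excluded path. Almost every argument at a vertex of degree 3 ends here.
    try3 : ∀ {x y u v c α a b} → Nbr3 G x y u v → Good c → On (x ∷ []) c →
      miss c y α → miss c u a → miss c v b → α ≢ a → α ≢ b → a ≢ b →
      ¬ Link c a b u v → ¬ Link c a α u y → ¬ Link c b α v y → ⊥
    try3 nb good on yα ua vb α≢a α≢b a≢b nuv nuy nvy =
      noCol (Good-attach3 good yα ua vb α≢a α≢b a≢b nuv nuy nvy) (On-attach3 on)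
      where open Attach3 nb

    start : ∀ {x y u v} → Nbr3 G x y u v → (∀ {c} → Good c → On (x ∷ []) c → Start c u v → ⊥) → ⊥
    start {x} {y} {u} {v} nb cont = minimal xy λ { (c , good , mi) → go good mi }
      where
      open Nbr3 nb
      go : ∀ {c} → Good c → Minus G x y c → ⊥
      go {c} good mi with Minus.covers mi xu (λ { (_ , e) → y≢u (sym e) }) (λ { (e , _) → Adj-irrefl xy e })
                        | Minus.covers mi xv (λ { (_ , e) → y≢v (sym e) }) (λ { (e , _) → Adj-irrefl xy e })
      ... | i , ei | j , ej = cont (Good-del (x ∷ []) good) (del-On G crit mi)
        (i , j , miss-used good ei , miss-used good ej ,
         (λ { refl → u≢v (Good.proper good ei ej) }) , noLink-star good (λ _ _ _ e → e) ei ej u≢v)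

    module Star3 {x y u v c} (nb : Nbr3 G x y u v) (good : Good c) (on : On (x ∷ []) c) where
      open Nbr3 nb
      open Good good

      y-rich = avoid1 G crit on (Adj-sym xy) (here refl)
      u-rich = avoid1 G crit on (Adj-sym xu) (here refl)
      v-rich = avoid1 G crit on (Adj-sym xv) (here refl)

      -- Put a, b and β on xu, xv and xy: since y misses b and β, no path blocks the pair at v and
      -- y, and only the (a,β)-path is left as an obstruction.
      step : ∀ {a b β} → miss c u a → miss c v b → miss c y b → miss c y β → a ≢ b → a ≢ β → b ≢ β →
             ¬ Link c a b u v → L c a β u y
      step ua vb yb yβ a≢b a≢β b≢β ¬uv ¬uy =
        try3 nb good on yβ ua vb (a≢β ∘ sym) (b≢β ∘ sym) a≢b ¬uv ¬uy (noLinkʳ yb yβ)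

      -- Type y: no free colour at y is usable when xu is coloured j.
      TypeY : Fin k → Set₁
      TypeY j = ∀ {β} → miss c y β → L c j β u y

      -- One blocking path suffices: if the (j,γ)-path from u ends in y it does not end in v, so γ
      -- fits on xv, and every other free colour β must be blocked between u and y.
      typeY : ∀ {j γ} → miss c u j → has c y j → miss c v γ → miss c y γ → L c j γ u y → TypeY j
      typeY {j} {γ} uj yj vγ yγ l {β} yβ with β ≟ γ
      ... | yes refl = l
      ... | no ne = step uj vγ yγ yβ (has≢miss yj yγ) (has≢miss yj yβ) (ne ∘ sym)
            λ l′ → l λ l″ → uniqueEnd good (inj₁ uj) (inj₂ vγ) (inj₂ yγ) (y≢v ∘ sym) l′ l″

      -- With j, i and γ on xu, xv and xy, u misses both i and j and v misses both i and γ; hence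
      -- the blocking path joins u and y.
      common⇒typeY : ∀ {i j γ} → miss c u i → miss c v i → has c y i → miss c u j → has c y j → j ≢ i →
                     miss c v γ → miss c y γ → TypeY j
      common⇒typeY ui vi yi uj yj j≢i vγ yγ = typeY uj yj vγ yγ λ ¬uy →
        try3 nb good on yγ uj vi (has≢miss yj yγ ∘ sym) (has≢miss yi yγ ∘ sym) j≢i
          (noLink uj ui) ¬uy (noLink vi vγ)

      -- With i, j and γ on xu, xv and xy, the pair at u and v is harmless by assumption and v
      -- misses both j and γ; hence the blocking path joins u and y.
      start⇒typeY : ∀ {i j γ} → miss c u i → has c y i → miss c v j → i ≢ j → ¬ Link c i j u v →
                    miss c v γ → miss c y γ → j ≢ γ → TypeY i
      start⇒typeY {i} {j} ui yi vj i≢j ¬uv vγ yγ j≢γ = typeY ui yi vγ yγ λ ¬uy →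
        try3 nb good on yγ ui vj (has≢miss yi yγ ∘ sym) (j≢γ ∘ sym) i≢j ¬uv ¬uy (noLink vj vγ)

      typeY-link : ∀ {j s} → miss c u j → c y s ≡ just j → ∀ {β} → miss c y β → L c j β u y → L (off y c) j β u s
      typeY-link uj ys yβ l ¬l = l λ l′ → ¬l (dropEnd good (self-⊑off c y) ys yβ (λ { refl → uj y (flip ys) }) l′)

      link⇒has : ∀ {j s} → miss c u j → c y s ≡ just j → ∀ {β} → miss c y β → L c j β u y → has c s β
      link⇒has {j} {s} uj ys yβ l = has-stable {c} λ ¬h → typeY-link uj ys yβ l λ l′ →
        ¬h (has-mono {off y c} {c} (del-⊑ (y ∷ []) c) (link-has (miss-used good ys) l′))

      three-colours : ∀ {p} → (∀ {a} → miss c p a → has c y a) →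
                      (∀ xs → length xs < 3 → ∃ λ a → a ∉ xs × miss c p a) → Three (λ a → miss c p a × has c y a)
      three-colours sub rich = three λ xs lt → let (a , a∉ , m) = rich xs lt in a , a∉ , m , sub m

      -- The uncoloured edge yx contributes the extra one.
      deg-y : ∀ {as} → Unique as → All (has c y) as → suc (length as) ≤ deg y
      deg-y {as} ua ha = subst (_≤ deg y) (ℕ.+-comm (length as) 1)
        (deg-colours on (x ∷ []) as ([] ∷ []) ((Adj-sym xy , here refl) ∷ []) ua ha)

      free? : ∀ p → (∃ λ a → miss c p a × miss c y a) ⊎ (∀ {a} → miss c p a → has c y a)
      free? p with any? (λ a → ¬? (has? c p a) ×-dec ¬? (has? c y a))
      ... | yes (a , np , ny) = inj₁ (a , (λ w e → np (w , e)) , λ w e → ny (w , e))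
      ... | no ¬f = inj₂ λ {a} m → ¬miss⇒has λ m′ → ¬f (a , (λ (w , e) → m w e) , λ (w , e) → m′ w e)

    -- The distinction is by which colours missing at u or at v are also free at y. Different ones
    -- for u and v lead to a contradiction or to a shared one, by means of the starting colours, so
    -- four situations survive: a single shared colour, none on either side, or one side only.
    cases : ∀ {x y u v c} → Nbr3 G x y u v → Good c → On (x ∷ []) c → Start c u v →
      (∀ {b} → miss c u b → miss c v b → miss c y b →
         (∀ {a} → miss c u a → a ≢ b → has c y a) → (∀ {a} → miss c v a → a ≢ b → has c y a) → ⊥) →
      ((∀ {a} → miss c u a → has c y a) → (∀ {a} → miss c v a → has c y a) → ⊥) →
      ((∀ {a} → miss c u a → has c y a) → ∀ {b} → miss c v b → miss c y b → ⊥) →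
      ((∀ {a} → miss c v a → has c y a) → ∀ {b} → miss c u b → miss c y b → ⊥) → ⊥
    cases {x} {y} {u} {v} {c} nb good on (i , j , ui , vj , i≢j , ¬ij) same neither onlyV onlyU =
      split (U.free? u) (U.free? v)
      where
      module U = Star3 nb good on
      module V = Star3 (Nbr3-swap G nb) good on
      open Nbr3 nb
      free-free : ∀ {a b} → miss c u a → miss c v b → miss c y a → miss c y b → a ≢ b → L c a b u v
      free-free {a} {b} ua vb ya yb a≢b ¬uv with U.y-rich (a ∷ b ∷ []) (s≤s (s≤s (s≤s z≤n)))
      ... | β , β∉ , yβ = try3 nb good on yβ ua vb (λ e → β∉ (here e)) (λ e → β∉ (there (here e))) a≢b
        ¬uv (noLinkʳ ya yβ) (noLinkʳ yb yβ)
      used-free : ∀ {i a b} → miss c u a → miss c y a → a ≢ b → miss c u i → has c y i → miss c v b → miss c y b → L c i b u v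
      used-free ua ya a≢b ui yi vb yb ¬uv =
        U.step ui vb yb ya (has≢miss yi yb) (has≢miss yi ya) (a≢b ∘ sym) ¬uv (noLink ui ua)
      free-used : ∀ {j a b} → miss c v b → miss c y b → a ≢ b → miss c v j → has c y j → miss c u a → miss c y a → L c a j u v
      free-used vb yb a≢b vj yj ua ya ¬uv =
        V.step vj ua ya yb (has≢miss yj ya) (has≢miss yj yb) a≢b (λ l → ¬uv (Link-recolour (Link-flip l))) (noLink vj vb)
      shared : ∀ {b} → miss c u b → miss c v b → miss c y b → ⊥
      shared {b} ub vb yb = same ub vb yb
        (λ {a} ua a≢b → ¬miss⇒has λ ya → free-free ua vb ya yb a≢b (noLink ua ub))
        (λ {a} va a≢b → ¬miss⇒has λ ya → free-free ub va yb ya (a≢b ∘ sym) (noLinkʳ vb va))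
      separate : ∀ {a b} → miss c u a → miss c y a → miss c v b → miss c y b → a ≢ b → ⊥
      separate {a} {b} ua ya vb yb a≢b = go (has⊎miss c y i) (has⊎miss c y j)
        where
        go : has c y i ⊎ miss c y i → has c y j ⊎ miss c y j → ⊥
        go (inj₂ yi) (inj₂ yj) = free-free ui vj yi yj i≢j ¬ij
        go (inj₂ yi) (inj₁ yj) with i ≟ b
        ... | yes refl = shared ui vb yi
        ... | no i≢b = free-used vb yb i≢b vj yj ui yi ¬ij
        go (inj₁ yi) (inj₂ yj) with a ≟ j
        ... | yes refl = shared ua vj yj
        ... | no a≢j = used-free ua ya a≢j ui yi vj yj ¬ij
        -- Trying a on xy shows that the (i,b)-path from u ends in v; hence it does not end in y,
        -- and b is usable on xy.
        go (inj₁ yi) (inj₁ yj) = try3 nb good on yb ui vj (has≢miss yi yb ∘ sym) (has≢miss yj yb ∘ sym) i≢j ¬ij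
          (λ l → used-free ua ya a≢b ui yi vb yb λ l′ →
            uniqueEnd good (inj₁ ui) (inj₂ vb) (inj₂ yb) (y≢v ∘ sym) l′ l)
          (noLink vj vb)
      split : (∃ λ a → miss c u a × miss c y a) ⊎ (∀ {a} → miss c u a → has c y a) →
              (∃ λ a → miss c v a × miss c y a) ⊎ (∀ {a} → miss c v a → has c y a) → ⊥
      split (inj₂ nu) (inj₂ nv) = neither nu nv
      split (inj₂ nu) (inj₁ (b , vb , yb)) = onlyV nu vb yb
      split (inj₁ (a , ua , ya)) (inj₂ nv) = onlyU nv ua ya
      split (inj₁ (a , ua , ya)) (inj₁ (b , vb , yb)) with a ≟ b
      ... | yes refl = shared ua vb ya
      ... | no a≢b = separate ua ya vb yb a≢b

    module Same {x y u v c b} (nb : Nbr3 G x y u v) (good : Good c) (on : On (x ∷ []) c)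
        (ub : miss c u b) (vb : miss c v b) (yb : miss c y b)
        (u⊆ : ∀ {a} → miss c u a → a ≢ b → has c y a) (v⊆ : ∀ {a} → miss c v a → a ≢ b → has c y a) where
      open Nbr3 nb
      module U = Star3 nb good on
      module V = Star3 (Nbr3-swap G nb) good on

      u-link : ∀ {m β} → miss c u m → m ≢ b → miss c y β → b ≢ β → L c m β u y
      u-link um m≢b yβ b≢β = U.step um vb yb yβ m≢b (has≢miss (u⊆ um m≢b) yβ) b≢β (noLink um ub)

      v-link : ∀ {m β} → miss c v m → m ≢ b → miss c y β → b ≢ β → L c m β v y
      v-link vm m≢b yβ b≢β = V.step vm ub yb yβ m≢b (has≢miss (v⊆ vm m≢b) yβ) b≢β (noLink vm vb)

      -- For a free colour β other than b the (m,β)-path from y would have to end both in u and in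
      -- v.
      no-common : ∀ {m} → miss c u m → miss c v m → m ≢ b → ⊥
      no-common {m} um vm m≢b with U.y-rich (b ∷ []) (s≤s (s≤s z≤n))
      ... | β , β∉ , yβ = uniqueEndᴸ good (inj₂ yβ) (inj₁ um) (inj₁ vm) u≢v
        (L-flip (u-link um m≢b yβ (λ e → β∉ (here (sym e))))) (L-flip (v-link vm m≢b yβ (λ e → β∉ (here (sym e)))))

      record Four : Set where
        field
          {a₁ a₂ e₁ e₂} : Fin k
          ua₁ : miss c u a₁
          ua₂ : miss c u a₂
          ve₁ : miss c v e₁
          ve₂ : miss c v e₂
          a₁≢b : a₁ ≢ b
          a₂≢b : a₂ ≢ b
          e₁≢b : e₁ ≢ b
          e₂≢b : e₂ ≢ b
          a₁≢a₂ : a₁ ≢ a₂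
          e₁≢e₂ : e₁ ≢ e₂

        a≢e : ∀ {a e} → miss c u a → a ≢ b → miss c v e → a ≢ e
        a≢e ua a≢b ve refl = no-common ua ve a≢b

        unique : Unique (a₁ ∷ a₂ ∷ e₁ ∷ e₂ ∷ [])
        unique = (a₁≢a₂ ∷ a≢e ua₁ a₁≢b ve₁ ∷ a≢e ua₁ a₁≢b ve₂ ∷ []) ∷
                 (a≢e ua₂ a₂≢b ve₁ ∷ a≢e ua₂ a₂≢b ve₂ ∷ []) ∷ (e₁≢e₂ ∷ []) ∷ [] ∷ []

        used : All (has c y) (a₁ ∷ a₂ ∷ e₁ ∷ e₂ ∷ [])
        used = u⊆ ua₁ a₁≢b ∷ u⊆ ua₂ a₂≢b ∷ v⊆ ve₁ e₁≢b ∷ v⊆ ve₂ e₂≢b ∷ []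

      opaque
        four : Four
        four with U.u-rich (b ∷ []) (s≤s (s≤s z≤n)) | U.v-rich (b ∷ []) (s≤s (s≤s z≤n))
        ... | a₁ , a₁∉ , ua₁ | e₁ , e₁∉ , ve₁
          with U.u-rich (b ∷ a₁ ∷ []) (s≤s (s≤s (s≤s z≤n))) | U.v-rich (b ∷ e₁ ∷ []) (s≤s (s≤s (s≤s z≤n)))
        ... | a₂ , a₂∉ , ua₂ | e₂ , e₂∉ , ve₂ = record { ua₁ = ua₁ ; ua₂ = ua₂ ; ve₁ = ve₁ ; ve₂ = ve₂
          ; a₁≢b = λ e → a₁∉ (here e) ; a₂≢b = λ e → a₂∉ (here e)
          ; e₁≢b = λ e → e₁∉ (here e) ; e₂≢b = λ e → e₂∉ (here e)
          ; a₁≢a₂ = λ e → a₂∉ (there (here (sym e))) ; e₁≢e₂ = λ e → e₂∉ (there (here (sym e))) }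

      -- Each of u and v misses two colours besides b; these four are distinct and used at y, and yx
      -- is a fifth edge.
      five-nbrs : 5 ≤ deg y
      five-nbrs = U.deg-y (Four.unique four) (Four.used four)

    -- Outside the shared case all missing colours of u or of v, at least three, are used at y; with
    -- yx this makes four edges.
    nbr-of-3 : ∀ {x y u v} → Nbr3 G x y u v → 4 ≤ deg y
    nbr-of-3 {y = y} {u} nb = ℕ.≮⇒≥ λ lt → start nb λ {c} good on st → contra lt good on st
      where
      contra : ∀ {c} → deg y < 4 → Good c → On (_ ∷ []) c → Start c _ _ → ⊥
      contra {c} lt good on st = cases nb good on st
        (λ ub vb yb u⊆ v⊆ → ℕ.<⇒≱ lt (ℕ.≤-trans (ℕ.n≤1+n 4) (Same.five-nbrs nb good on ub vb yb u⊆ v⊆)))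
        (λ u⊆ _ → many u⊆ U.u-rich) (λ u⊆ _ _ → many u⊆ U.u-rich) (λ v⊆ _ _ → many v⊆ U.v-rich)
        where
        module U = Star3 nb good on
        many : ∀ {p} → (∀ {a} → miss c p a → has c y a) →
               (∀ xs → length xs < 3 → ∃ λ a → a ∉ xs × miss c p a) → ⊥
        many sub rich = ℕ.<⇒≱ lt (U.deg-y (Three.unique t)
          (proj₂ (Three.pα t) ∷ proj₂ (Three.pβ t) ∷ proj₂ (Three.pγ t) ∷ []))
          where t = U.three-colours sub rich

  -- Degree-three vertices with a neighbour of degree four

  module _ (G : Graph n) (crit : Critical G) where
    open Nbrs G
    open Critical crit

    -- The setting for exchanging the colours of ys and ys′: neither end sees another colour of y,
    -- so after the exchange no dangerous path starts at s or s′.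
    module SwapCore {x y u v c} (nb : Nbr3 G x y u v) (good : Good c) (on : On (x ∷ []) c)
        {j j′ s s′} (ys : c y s ≡ just j) (ys′ : c y s′ ≡ just j′) (j≢j′ : j ≢ j′)
        (s-miss : ∀ {a} → has c y a → a ≢ j → miss c s a) (s′-miss : ∀ {a} → has c y a → a ≢ j′ → miss c s′ a) where
      open Nbr3 nb
      open Good good
      module U = Star3 G crit nb good on

      s≢s′ : s ≢ s′
      s≢s′ refl = j≢j′ (just-injective (trans (sym ys) ys′))

      hj : has c y j
      hj = s , ys

      open Swap good ys ys′ s≢s′ public using (f; f-s; f-s′; f-other; f-has; Good-swapped)

      c′ : Colouring
      c′ = swapped c y s s′ j j′

      good′ : Good c′
      good′ = Good-swapped (s-miss (s′ , ys′) (j≢j′ ∘ sym)) (s′-miss (s , ys) j≢j′)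
        λ {r} {a} r≢s r≢s′ yr →
          noLink (miss-off (s-miss (s′ , ys′) (j≢j′ ∘ sym))) (miss-off (s-miss (r , yr) λ { refl → r≢s (proper yr ys) })) ,
          noLink (miss-off (s′-miss (s , ys) j≢j′)) (miss-off (s′-miss (r , yr) λ { refl → r≢s′ (proper yr ys′) }))

      on′ : On (x ∷ []) c′
      on′ = On-swapped on ys ys′

      keep : ∀ {p a} → p ≢ y → p ≢ s → p ≢ s′ → miss c p a → miss c′ p a
      keep p≢y p≢s p≢s′ m = miss-star p≢y (miss-off m) λ e → m y (flip (trans (sym (f-other p≢s p≢s′)) e))

      keep-y : ∀ {a} → miss c y a → miss c′ y a
      keep-y m = miss-center λ r e → let (w , g) = f-has e in m w g

      keep-free : ∀ {p a} → p ≢ y → miss c p a → miss c y a → miss c′ p a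
      keep-free p≢y m my = miss-star p≢y (miss-off m) λ e → let (w , g) = f-has e in my w g

      u≢ : ∀ {i r} → miss c u i → c y r ≡ just i → u ≢ r
      u≢ m e refl = m y (flip e)

      -- The (j,β)-path from u ran to s; after the exchange the j-edge at y leads to s′, so a path
      -- to y would have to run from u to s′ instead.
      no-uy : ∀ {β} → miss c u j → miss c u j′ → miss c y β → L c j β u y → ¬ Link c′ j β u y
      no-uy uj uj′ yβ l l′ = U.typeY-link uj ys yβ l λ l₀ →
        uniqueEnd (Good-del (y ∷ []) good) (inj₁ (miss-off uj)) (inj₁ (miss-used good ys))
          (inj₁ (miss-off (s′-miss (s , ys) j≢j′))) s≢s′ l₀
          (dropEnd good′ (star-⊑off c y f) (trans (star-at c y f s′) f-s′) (keep-y yβ) (u≢ uj′ ys′) l′)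

    -- If the ends s and s′ of the edges at y coloured j and j′ see all colours missing
    -- at y, then they see no further colour of y, and j and j′ may be exchanged.
    module SwapY {x y u v c} (nb : Nbr3 G x y u v) (good : Good c) (on : On (x ∷ []) c)
        {j j′ j″ s s′} (ys : c y s ≡ just j) (ys′ : c y s′ ≡ just j′) (j≢j′ : j ≢ j′)
        (onlyQ : ∀ {a} → has c y a → a ∈ j ∷ j′ ∷ j″ ∷ [])
        (full : ∀ {β} → miss c y β → has c s β) (full′ : ∀ {β} → miss c y β → has c s′ β) where
      open Nbr3 nb
      open Good good

      -- Since r misses at least two colours, it misses one other than q. That colour is neither
      -- free at y nor, by the covering assumption, used at y.
      saturated : ∀ {r q} → (∀ {β} → miss c y β → has c r β) →
        (∀ {d} → has c y d → d ≡ q ⊎ has c r d) → ⊥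
      saturated {r} {q} fr cover with avoidΔ G crit on {r} [] (q ∷ []) [] [] (s≤s (s≤s z≤n))
      ... | d , d∉ , rd with has⊎miss c y d
      ... | inj₂ yd = let (w , e) = fr yd in rd w e
      ... | inj₁ yd with cover yd
      ... | inj₁ d≡q = d∉ (here d≡q)
      ... | inj₂ (w , e) = rd w e

      s-miss : ∀ {a} → has c y a → a ≢ j → miss c s a
      s-miss {a} ya a≢j w e with onlyQ ya
      ... | here a≡j = a≢j a≡j
      ... | there (here refl) = saturated {q = j″} full cover
        where
        cover : ∀ {d} → has c y d → d ≡ j″ ⊎ has c s d
        cover yd with onlyQ yd
        ... | here refl = inj₂ (y , flip ys)
        ... | there (here refl) = inj₂ (w , e)
        ... | there (there (here p)) = inj₁ p
      ... | there (there (here refl)) = saturated {q = j′} full cover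
        where
        cover : ∀ {d} → has c y d → d ≡ j′ ⊎ has c s d
        cover yd with onlyQ yd
        ... | here refl = inj₂ (y , flip ys)
        ... | there (here p) = inj₁ p
        ... | there (there (here refl)) = inj₂ (w , e)

      s′-miss : ∀ {a} → has c y a → a ≢ j′ → miss c s′ a
      s′-miss {a} ya a≢j′ w e with onlyQ ya
      ... | there (here a≡j′) = a≢j′ a≡j′
      ... | here refl = saturated {q = j″} full′ cover
        where
        cover : ∀ {d} → has c y d → d ≡ j″ ⊎ has c s′ d
        cover yd with onlyQ yd
        ... | here refl = inj₂ (w , e)
        ... | there (here refl) = inj₂ (y , flip ys′)
        ... | there (there (here p)) = inj₁ p
      ... | there (there (here refl)) = saturated {q = j} full′ cover
        where
        cover : ∀ {d} → has c y d → d ≡ j ⊎ has c s′ d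
        cover yd with onlyQ yd
        ... | here p = inj₁ p
        ... | there (here refl) = inj₂ (y , flip ys′)
        ... | there (there (here refl)) = inj₂ (w , e)

      open SwapCore nb good on ys ys′ j≢j′ s-miss s′-miss

      -- After the exchange put j, b and β on xu, xv and xy. A (j,b)-path from u to v would avoid y,
      -- hence exist before the exchange, where the path from u ends in s.
      swap-free : ∀ {b} → miss c u j → miss c u j′ → U.TypeY j → miss c v b → miss c y b → ⊥
      swap-free {b} uj uj′ ty vb yb with U.y-rich (b ∷ []) (s≤s (s≤s z≤n))
      ... | β , β∉ , yβ = try3 G crit nb good′ on′ (keep-y yβ)
        (keep (y≢u ∘ sym) (u≢ uj ys) (u≢ uj′ ys′) uj)
        (keep (y≢v ∘ sym) (v≢ full) (v≢ full′) vb)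
        (has≢miss hj yβ ∘ sym) (λ e → β∉ (here e)) (has≢miss hj yb)
        (λ l → U.typeY-link uj ys yb (ty yb) λ l₀ →
          uniqueEnd (Good-del (y ∷ []) good) (inj₁ (miss-off uj)) (inj₁ (miss-used good ys)) (inj₂ (miss-off vb))
            (v≢ full ∘ sym) l₀
            (dropMid (y ∷ []) (star-⊑off c y f) (λ { (here refl) → y≢u , y≢v , inj₂ (keep-y yb) }) l))
        (no-uy uj uj′ yβ (ty yβ))
        (noLinkʳ (keep-y yb) (keep-y yβ))
        where
        v≢ : ∀ {r} → (∀ {β} → miss c y β → has c r β) → v ≢ r
        v≢ fr refl = let (w , e) = fr yb in vb w e

      -- Here xv gets the third colour j″. A (j″,β)-path from v to y would end with the unchanged
      -- edge ys″, but from s″ that path leads to u.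
      swap-used : ∀ {s″ β} → c y s″ ≡ just j″ → j ≢ j″ → j′ ≢ j″ → miss c y β →
        (∀ {i} → has c y i → miss c u i) → (∀ {i} → has c y i → miss c v i) →
        (∀ {i} → has c y i → L c i β u y) → ⊥
      swap-used {s″} {β} ys″ j≢j″ j′≢j″ yβ mu mv al = try3 G crit nb good′ on′ (keep-y yβ)
        (keep-u (mu h)) (keep (y≢v ∘ sym) (v≢ ys) (v≢ ys′) (mv h″))
        (has≢miss h yβ ∘ sym) (has≢miss h″ yβ ∘ sym) j≢j″
        (noLink (keep-u (mu h)) (keep-u (mu h″)))
        (no-uy (mu h) (mu (s′ , ys′)) yβ (al h))
        (λ l → U.typeY-link (mu h″) ys″ yβ (al h″) λ l₀ →
          uniqueEnd (Good-del (y ∷ []) good) (inj₁ (miss-used good ys″)) (inj₁ (miss-off (mu h″))) (inj₁ (miss-off (mv h″)))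
            u≢v (Link-flip l₀)
            (Link-flip (dropEnd good′ (star-⊑off c y f) (trans (star-at c y f s″) (trans (f-other s″≢s s″≢s′) ys″))
              (keep-y yβ) (v≢ ys″) l)))
        where
        h = hj
        h″ : has c y j″
        h″ = s″ , ys″
        s″≢s : s″ ≢ s
        s″≢s refl = j≢j″ (just-injective (trans (sym ys) ys″))
        s″≢s′ : s″ ≢ s′
        s″≢s′ refl = j′≢j″ (just-injective (trans (sym ys′) ys″))
        v≢ : ∀ {i r} → c y r ≡ just i → v ≢ r
        v≢ e refl = mv (_ , e) y (flip e)
        keep-u : ∀ {a} → miss c u a → miss c′ u a
        keep-u = keep (y≢u ∘ sym) (u≢ (mu h) ys) (u≢ (mu (s′ , ys′)) ys′)

    module Deg4 {x y u v c} (nb : Nbr3 G x y u v) (good : Good c) (on : On (x ∷ []) c) (dy : deg y ≤ 4) where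
      open Nbr3 nb
      open Good good
      module U = Star3 G crit nb good on

      exactly : ∀ {j₁ j₂ j₃} → Unique (j₁ ∷ j₂ ∷ j₃ ∷ []) → All (has c y) (j₁ ∷ j₂ ∷ j₃ ∷ []) →
                ∀ {a} → has c y a → a ∈ j₁ ∷ j₂ ∷ j₃ ∷ []
      exactly {j₁} {j₂} {j₃} uq hs {a} ya with a ∈ᶠ? (j₁ ∷ j₂ ∷ j₃ ∷ [])
      ... | yes i = i
      ... | no a∉ = contradiction
        (U.deg-y {as = a ∷ j₁ ∷ j₂ ∷ j₃ ∷ []} (All.tabulate (λ z∈ e → a∉ (subst (_∈ _) (sym e) z∈)) ∷ uq) (ya ∷ hs))
        (ℕ.<⇒≱ (s≤s dy))

      -- Both being of type y, the ends of the edges coloured j and j′ see all colours free at y, so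
      -- the exchange applies.
      two-typeY : ∀ {j j′ j″ b} → j ≢ j′ → j ≢ j″ → j′ ≢ j″ → has c y j → has c y j′ → has c y j″ →
        miss c u j → miss c u j′ → U.TypeY j → U.TypeY j′ → miss c v b → miss c y b → ⊥
      two-typeY {j} {j′} {j″} n n′ n″ yj@(s , ys) yj′@(s′ , ys′) yj″ uj uj′ ty ty′ vb yb =
        SwapY.swap-free nb good on ys ys′ n (exactly ((n ∷ n′ ∷ []) ∷ (n″ ∷ []) ∷ [] ∷ []) (yj ∷ yj′ ∷ yj″ ∷ []))
          (λ yβ → U.link⇒has uj ys yβ (ty yβ)) (λ yβ → U.link⇒has uj′ ys′ yβ (ty′ yβ)) uj uj′ ty vb yb

    module Neither {x y u v c} (nb : Nbr3 G x y u v) (good : Good c) (on : On (x ∷ []) c) (dy : deg y ≤ 4)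
        (u⊆ : ∀ {a} → miss c u a → has c y a) (v⊆ : ∀ {a} → miss c v a → has c y a) where
      open Nbr3 nb
      module U = Star3 G crit nb good on
      module V = Star3 G crit (Nbr3-swap G nb) good on
      module D = Deg4 nb good on dy
      module T = Three (U.three-colours u⊆ U.u-rich)

      onlyQ : ∀ {a} → has c y a → a ∈ T.α ∷ T.β ∷ T.γ ∷ []
      onlyQ = D.exactly T.unique (proj₂ T.pα ∷ proj₂ T.pβ ∷ proj₂ T.pγ ∷ [])

      mu : ∀ {i} → has c y i → miss c u i
      mu yi with onlyQ yi
      ... | here refl = proj₁ T.pα
      ... | there (here refl) = proj₁ T.pβ
      ... | there (there (here refl)) = proj₁ T.pγ

      pick : ∀ {p q r} → (∀ {a} → has c y a → a ≡ p ⊎ a ∈ q ∷ r ∷ []) → miss c v p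
      pick {p} {q} {r} only with U.v-rich (q ∷ r ∷ []) (s≤s (s≤s (s≤s z≤n)))
      ... | m , m∉ , vm with only (v⊆ vm)
      ... | inj₁ refl = vm
      ... | inj₂ i = ⊥-elim (m∉ i)

      mv : ∀ {i} → has c y i → miss c v i
      mv yi with onlyQ yi
      ... | here refl = pick λ ya → c₁ (onlyQ ya)
        where
        c₁ : ∀ {a} → a ∈ T.α ∷ T.β ∷ T.γ ∷ [] → a ≡ T.α ⊎ a ∈ T.β ∷ T.γ ∷ []
        c₁ (here e) = inj₁ e
        c₁ (there i) = inj₂ i
      ... | there (here refl) = pick λ ya → c₂ (onlyQ ya)
        where
        c₂ : ∀ {a} → a ∈ T.α ∷ T.β ∷ T.γ ∷ [] → a ≡ T.β ⊎ a ∈ T.α ∷ T.γ ∷ []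
        c₂ (here e) = inj₂ (here e)
        c₂ (there (here e)) = inj₁ e
        c₂ (there (there i)) = inj₂ (there i)
      ... | there (there (here refl)) = pick λ ya → c₃ (onlyQ ya)
        where
        c₃ : ∀ {a} → a ∈ T.α ∷ T.β ∷ T.γ ∷ [] → a ≡ T.γ ⊎ a ∈ T.α ∷ T.β ∷ []
        c₃ (here e) = inj₂ (here e)
        c₃ (there (here e)) = inj₂ (there (here e))
        c₃ (there (there (here e))) = inj₁ e

      -- For each free colour β the three (j,β)-paths from y all end in u or all end in v.
      alternative : ∀ {β} → miss c y β → ((∀ {i} → has c y i → L c i β u y) → ⊥) →
                    ((∀ {i} → has c y i → L c i β v y) → ⊥) → ⊥
      alternative {β} yβ allU allV = ¬first first
        where
        j = T.α
        yj = proj₂ T.pα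
        block : ∀ {i i′} → has c y i → has c y i′ → i ≢ i′ → ¬ Link c i β u y → ¬ Link c i′ β v y → ⊥
        block yi yi′ ne nu nv = try3 G crit nb good on yβ (mu yi) (mv yi′) (has≢miss yi yβ ∘ sym)
          (has≢miss yi′ yβ ∘ sym) ne (noLink (mu yi) (mu yi′)) nu nv
        both : ∀ {i} → has c y i → Link c i β u y → Link c i β v y → ⊥
        both yi l l′ = uniqueEnd good (inj₂ yβ) (inj₁ (mu yi)) (inj₁ (mv yi)) u≢v (Link-flip l) (Link-flip l′)
        ¬first : ¬ Link c j β u y → ⊥
        ¬first ¬l = allV all
          where
          others : ∀ {i} → has c y i → i ≢ j → L c i β v y
          others yi ne ¬l′ = block yj yi (ne ∘ sym) ¬l ¬l′
          all : ∀ {i} → has c y i → L c i β v y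
          all {i} yi ¬l′ with i ≟ j
          ... | no ne = others yi ne ¬l′
          ... | yes refl = block (proj₂ T.pβ) yi (T.α≢β ∘ sym)
            (λ l → others (proj₂ T.pβ) (T.α≢β ∘ sym) (both (proj₂ T.pβ) l)) ¬l′
        first : ¬ Link c j β u y
        first l = allU all
          where
          all : ∀ {i} → has c y i → L c i β u y
          all {i} yi ¬l with i ≟ j
          ... | yes refl = ¬l l
          ... | no ne = block yi yj ne ¬l (both yj l)

      -- Wherever the (i,β)-path from y ends, in u or in v, its first edge is ys and its second
      -- gives s the colour β.
      full : ∀ {i s} → c y s ≡ just i → ∀ {β} → miss c y β → has c s β
      full {i} {s} ys yβ = has-stable {c} λ ¬h → alternative yβ
        (λ al → ¬h (U.link⇒has (mu (s , ys)) ys yβ (al (s , ys))))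
        (λ al → ¬h (V.link⇒has (mv (s , ys)) ys yβ (al (s , ys))))

      absurd : ⊥
      absurd with U.y-rich [] (s≤s z≤n)
      ... | β , _ , yβ = finish (proj₂ T.pα) (proj₂ T.pβ) (proj₂ T.pγ)
        where
        finish : has c y T.α → has c y T.β → has c y T.γ → ⊥
        finish (s , ys) (s′ , ys′) (s″ , ys″) = alternative yβ
          (SwapY.swap-used nb good on ys ys′ T.α≢β onlyQ (full ys) (full ys′) ys″ T.α≢γ T.β≢γ yβ mu mv)
          (SwapY.swap-used (Nbr3-swap G nb) good on ys ys′ T.α≢β onlyQ (full ys) (full ys′) ys″ T.α≢γ T.β≢γ yβ mv mu)

    -- Up to exchanging u and v, the one case that degree four at y leaves open. For j₃ the blocking
    -- paths join u and y, for j₁ and j₂ they join u and v.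
    record Config {x y u v} (nb : Nbr3 G x y u v) (c : Colouring) : Set₁ where
      field
        good : Good c
        on   : On (x ∷ []) c
        {j₁ j₂ j₃} : Fin k
        uj₁ : miss c u j₁
        uj₂ : miss c u j₂
        uj₃ : miss c u j₃
        j₁≢j₂ : j₁ ≢ j₂
        j₁≢j₃ : j₁ ≢ j₃
        j₂≢j₃ : j₂ ≢ j₃
        u⊆   : ∀ {a} → miss c u a → has c y a
        v⊆   : ∀ {a} → miss c v a → miss c y a
        onlyQ : ∀ {a} → has c y a → a ∈ j₁ ∷ j₂ ∷ j₃ ∷ []
        typeY₃ : ∀ {β} → miss c y β → L c j₃ β u y
        typeV₁ : ∀ {γ} → miss c v γ → L c j₁ γ u v
        typeV₂ : ∀ {γ} → miss c v γ → L c j₂ γ u v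

    config : ∀ {x y u v c} (nb : Nbr3 G x y u v) → Good c → On (x ∷ []) c → deg y ≤ 4 → Start c u v →
      (∀ {a} → miss c u a → has c y a) → ∀ {b} → miss c v b → miss c y b → Config nb c
    config {x} {y} {u} {v} {c} nb good on dy (i , i′ , ui , vi′ , i≢i′ , ¬ii′) u⊆ {b} vb yb = build
      where
      module U = Star3 G crit nb good on
      module D = Deg4 nb good on dy
      no-common : ∀ {a} → miss c u a → miss c v a → ⊥
      no-common {a} ua va with U.u-rich (a ∷ []) (s≤s (s≤s z≤n))
      ... | j , j∉ , uj with U.u-rich (a ∷ j ∷ []) (s≤s (s≤s (s≤s z≤n)))
      ... | j′ , j′∉ , uj′ = D.two-typeY (λ e → j′∉ (there (here (sym e)))) j≢a j′≢a (u⊆ uj) (u⊆ uj′) (u⊆ ua) uj uj′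
        (U.common⇒typeY ua va (u⊆ ua) uj (u⊆ uj) j≢a vb yb) (U.common⇒typeY ua va (u⊆ ua) uj′ (u⊆ uj′) j′≢a vb yb) vb yb
        where
        j≢a = λ e → j∉ (here e)
        j′≢a = λ e → j′∉ (here e)
      build : Config nb c
      build with U.u-rich (i ∷ []) (s≤s (s≤s z≤n))
      ... | j , j∉ , uj with U.u-rich (i ∷ j ∷ []) (s≤s (s≤s (s≤s z≤n)))
      ... | j′ , j′∉ , uj′ = record { good = good ; on = on ; uj₁ = uj ; uj₂ = uj′ ; uj₃ = ui
          ; j₁≢j₂ = j≢j′ ; j₁≢j₃ = j≢i ; j₂≢j₃ = j′≢i ; u⊆ = u⊆ ; v⊆ = v⊆ ; onlyQ = only
          ; typeY₃ = ty ; typeV₁ = tv uj j≢i uj′ j≢j′ (j′≢i ∘ sym) ; typeV₂ = tv uj′ j′≢i uj (j≢j′ ∘ sym) (j≢i ∘ sym) }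
        where
        j≢i = λ e → j∉ (here e)
        j′≢i = λ e → j′∉ (here e)
        j≢j′ = λ e → j′∉ (there (here (sym e)))
        only : ∀ {a} → has c y a → a ∈ j ∷ j′ ∷ i ∷ []
        only = D.exactly ((j≢j′ ∷ j≢i ∷ []) ∷ (j′≢i ∷ []) ∷ [] ∷ []) (u⊆ uj ∷ u⊆ uj′ ∷ u⊆ ui ∷ [])
        mu : ∀ {a} → has c y a → miss c u a
        mu ya with only ya
        ... | here refl = uj
        ... | there (here refl) = uj′
        ... | there (there (here refl)) = ui
        v⊆ : ∀ {a} → miss c v a → miss c y a
        v⊆ va w e = no-common (mu (w , e)) va
        ty : U.TypeY i
        ty with U.v-rich (i′ ∷ []) (s≤s (s≤s z≤n))
        ... | γ , γ∉ , vγ = U.start⇒typeY ui (u⊆ ui) vi′ i≢i′ ¬ii′ vγ (v⊆ vγ) (λ e → γ∉ (here (sym e)))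
        -- Without this path p and γ would be as good as the starting pair, and p would be a second
        -- colour of type y beside i.
        tv : ∀ {p q} → miss c u p → p ≢ i → miss c u q → p ≢ q → i ≢ q → ∀ {γ} → miss c v γ → L c p γ u v
        tv up p≢i uq p≢q i≢q {γ} vγ ¬l with U.v-rich (γ ∷ []) (s≤s (s≤s z≤n))
        ... | γ′ , γ′∉ , vγ′ = D.two-typeY p≢i p≢q i≢q (u⊆ up) (u⊆ ui) (u⊆ uq) up ui
          (U.start⇒typeY up (u⊆ up) vγ (has≢miss (u⊆ up) (v⊆ vγ)) ¬l vγ′ (v⊆ vγ′) (λ e → γ′∉ (here (sym e))))
          ty vb yb

  module _ (G : Graph n) where
    open Nbrs G

    -- What enables a vertex to send 1/2 in the discharging: in each case the degree plus the number
    -- of big neighbours is at least 8.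
    HalfOK : Fin n → Set
    HalfOK p = 5 ≤ deg p × 2 ≤ big p × (deg p ≡ 5 → 3 ≤ big p)

    HalfOK? : ∀ p → Dec (HalfOK p)
    HalfOK? p = 5 ℕ.≤? deg p ×-dec 2 ℕ.≤? big p ×-dec (deg p ℕ.≟ 5 →-dec 3 ℕ.≤? big p)

    extra-nbr : ∀ {v} us → length us < deg v → ∃ λ w → Adj v w × w ∉ us
    extra-nbr {v} us lt with any? (λ w → (adj G v w Bool.≟ true) ×-dec ¬? (w ∈ᶠ? us))
    ... | yes r = r
    ... | no ¬r = contradiction
      (Unique-length (nbrs-unique v) λ {z} z∈ → decidable-stable (z ∈ᶠ? us) λ z∉ → ¬r (z , nbrs⁻ z∈ , z∉))
      (ℕ.<⇒≱ lt)

  -- The other two neighbours when y has degree four.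

  module FromConfig (G : Graph n) (crit : Critical G) {x y u v c} (nb : Nbr3 G x y u v) (cfg : Config G crit nb c) where
    open Nbrs G
    open Critical crit
    open Nbr3 nb
    open Config cfg
    open Good good

    -- Rotating the star puts v in the place of y, so that the paths of j₁ and j₂ between u and v
    -- become paths of type y.
    module R = Star3 G crit (Nbr3-rotate G nb) good on
    module T = Three (three (λ xs lt → R.y-rich xs lt))

    K : Colouring
    K = off v c

    goodK : Good K
    goodK = Good-del (v ∷ []) good

    used≢free : ∀ {j γ} → miss c u j → miss c v γ → j ≢ γ
    used≢free uj vγ = has≢miss (u⊆ uj) (v⊆ vγ)

    TypeV : Fin k → Set₁
    TypeV j = ∀ {γ} → miss c v γ → L c j γ u v

    v-has : ∀ {j} → TypeV j → has c v j
    v-has tv = has-stable {c} λ ¬h → tv T.pα λ l → ¬h (link-has T.pα (Link-recolour l))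

    v-has₃ : has c v j₃
    v-has₃ = ¬miss⇒has λ m → let (w , e) = u⊆ uj₃ in v⊆ m w e

    end-has : ∀ {j s} → miss c u j → TypeV j → c v s ≡ just j → ∀ {γ} → miss c v γ → has c s γ
    end-has uj tv vs vγ = R.link⇒has uj vs vγ (tv vγ)

    end-big : ∀ {j s} → miss c u j → TypeV j → c v s ≡ just j → Big s
    end-big {j} {s} uj tv vs = deg-colours on [] (j ∷ T.α ∷ T.β ∷ T.γ ∷ []) [] []
      ((used≢free uj T.pα ∷ used≢free uj T.pβ ∷ used≢free uj T.pγ ∷ []) ∷ T.unique)
      ((v , flip vs) ∷ h T.pα ∷ h T.pβ ∷ h T.pγ ∷ [])
      where
      h : ∀ {γ} → miss c v γ → has c s γ
      h = end-has uj tv vs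

    ends≢ : ∀ {i j s t} → i ≢ j → c v s ≡ just i → c v t ≡ just j → s ≢ t
    ends≢ ne e e′ refl = ne (just-injective (trans (sym e) e′))

    big-v : 2 ≤ big v
    big-v = go (v-has typeV₁) (v-has typeV₂)
      where
      go : has c v j₁ → has c v j₂ → 2 ≤ big v
      go (s , e) (s′ , e′) = big-≥ {us = s ∷ s′ ∷ []} ((ends≢ j₁≢j₂ e e′ ∷ []) ∷ [] ∷ [])
        ((proj₁ (On.within on e) , end-big uj₁ typeV₁ e) ∷ (proj₁ (On.within on e′) , end-big uj₂ typeV₂ e′) ∷ [])

    -- If v also had degree four, the argument at y would apply at v.
    deg-v : 5 ≤ deg v
    deg-v = ℕ.≮⇒≥ λ { (s≤s le) → Deg4.two-typeY G crit (Nbr3-rotate G nb) good on le j₁≢j₂ j₁≢j₃ j₂≢j₃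
      (v-has typeV₁) (v-has typeV₂) v-has₃ uj₁ uj₂ typeV₁ typeV₂ (v⊆ T.pα) T.pα }

    -- By `deg-v` there are at least 7 colours, so a vertex u of degree at most 4 would miss four of
    -- them; but its missing colours are among the three of y.
    deg-u : 5 ≤ deg u
    deg-u = ℕ.≮⇒≥ λ { (s≤s le) → go le }
      where
      go : deg u ≤ 4 → ⊥
      go le with avoid on {u} (x ∷ []) (j₁ ∷ j₂ ∷ j₃ ∷ []) ([] ∷ []) ((Adj-sym xu , here refl) ∷ []) bound
        where
        bound : 3 + deg u < k + 1
        bound = ℕ.<-≤-trans (s≤s (ℕ.+-monoʳ-≤ 3 le))
          (ℕ.+-monoˡ-≤ 1 (subst (7 ≤_) (sym k≡) (s≤s (s≤s (ℕ.≤-trans deg-v (deg≤ v))))))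
      ... | m , m∉ , um = m∉ (onlyQ (u⊆ um))

    -- Each γ missing at v occurs at u, and its edge us starts three blocking paths, those of j₁ and
    -- j₂ to v and that of j₃ to y. So s sees γ, j₁, j₂ and j₃.
    big-u : 3 ≤ big u
    big-u = go (u-has T.pα) (u-has T.pβ) (u-has T.pγ)
      where
      u-has : ∀ {γ} → miss c v γ → has c u γ
      u-has vγ = ¬miss⇒has λ m → let (w , e) = u⊆ m in v⊆ vγ w e
      through : ∀ {j γ p s} → miss c u j → c u s ≡ just γ → miss c p γ → L c j γ u p → has c s j
      through {j} {γ} {p} {s} uj us pγ l = has-stable {c} λ ¬h → l λ l′ →
        ¬h (has-mono {off u c} {c} (del-⊑ (u ∷ []) c) (link-has (miss-used good us)
          (dropEnd good (self-⊑off c u) us uj (λ { refl → pγ u (flip us) }) (Link-recolour (Link-flip l′)))))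
      end : ∀ {γ s} → miss c v γ → c u s ≡ just γ → Adj u s × Big s
      end {γ} {s} vγ us = proj₁ (On.within on us) , deg-colours on [] (γ ∷ j₁ ∷ j₂ ∷ j₃ ∷ []) [] []
        (((used≢free uj₁ vγ ∘ sym) ∷ (used≢free uj₂ vγ ∘ sym) ∷ (used≢free uj₃ vγ ∘ sym) ∷ []) ∷
         (j₁≢j₂ ∷ j₁≢j₃ ∷ []) ∷ (j₂≢j₃ ∷ []) ∷ [] ∷ [])
        ((u , flip us) ∷ through uj₁ us vγ (typeV₁ vγ) ∷ through uj₂ us vγ (typeV₂ vγ) ∷
         through uj₃ us (v⊆ vγ) (typeY₃ (v⊆ vγ)) ∷ [])
      dif : ∀ {i j s t} → i ≢ j → c u s ≡ just i → c u t ≡ just j → s ≢ t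
      dif ne e e′ refl = ne (just-injective (trans (sym e) e′))
      go : has c u T.α → has c u T.β → has c u T.γ → 3 ≤ big u
      go (s₁ , e₁) (s₂ , e₂) (s₃ , e₃) = big-≥ {us = s₁ ∷ s₂ ∷ s₃ ∷ []}
        ((dif T.α≢β e₁ e₂ ∷ dif T.α≢γ e₁ e₃ ∷ []) ∷ (dif T.β≢γ e₂ e₃ ∷ []) ∷ [] ∷ [])
        (end T.pα e₁ ∷ end T.pβ e₂ ∷ end T.pγ e₃ ∷ [])

    -- Besides x and the three ends, r is the fifth neighbour of v. As v₁ and v₂ are big, v₃ and r
    -- have degree at most 3, and the few colours they can carry make the edges at v easy to
    -- recolour.
    module Five (dv : deg v ≡ 5) (few : big v < 3) {v₁ v₂ v₃}
        (e₁ : c v v₁ ≡ just j₁) (e₂ : c v v₂ ≡ just j₂) (e₃ : c v v₃ ≡ just j₃)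
        {r ρ} (eᵣ : c v r ≡ just ρ) (r∉ : r ∉ v₁ ∷ v₂ ∷ v₃ ∷ []) where

      adjᵥ : ∀ {s a} → c v s ≡ just a → Adj v s
      adjᵥ e = proj₁ (On.within on e)

      small : ∀ {s} → Adj v s → v₁ ≢ s → v₂ ≢ s → ¬ Big s
      small vs n₁ n₂ bs = ℕ.<⇒≱ few (big-≥ {us = v₁ ∷ v₂ ∷ _ ∷ []}
        ((ends≢ j₁≢j₂ e₁ e₂ ∷ n₁ ∷ []) ∷ (n₂ ∷ []) ∷ [] ∷ [])
        ((adjᵥ e₁ , end-big uj₁ typeV₁ e₁) ∷ (adjᵥ e₂ , end-big uj₂ typeV₂ e₂) ∷ (vs , bs) ∷ []))

      v₁≢r : v₁ ≢ r
      v₁≢r e = r∉ (here (sym e))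
      v₂≢r : v₂ ≢ r
      v₂≢r e = r∉ (there (here (sym e)))
      v₃≢r : v₃ ≢ r
      v₃≢r e = r∉ (there (there (here (sym e))))

      v₃-small : ¬ Big v₃
      v₃-small = small (adjᵥ e₃) (ends≢ j₁≢j₃ e₁ e₃) (ends≢ j₂≢j₃ e₂ e₃)

      r-small : ¬ Big r
      r-small = small (adjᵥ eᵣ) v₁≢r v₂≢r

      ρ≢ : ∀ {j s} → c v s ≡ just j → s ≢ r → j ≢ ρ
      ρ≢ e ne refl = ne (proper e eᵣ)

      onlyP : ∀ {a} → has c v a → a ∈ j₁ ∷ j₂ ∷ j₃ ∷ ρ ∷ []
      onlyP {a} va with a ∈ᶠ? (j₁ ∷ j₂ ∷ j₃ ∷ ρ ∷ [])
      ... | yes i = i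
      ... | no a∉ = contradiction (R.deg-y {as = a ∷ j₁ ∷ j₂ ∷ j₃ ∷ ρ ∷ []}
        (All.tabulate (λ z∈ e → a∉ (subst (_∈ _) (sym e) z∈)) ∷
         (j₁≢j₂ ∷ j₁≢j₃ ∷ ρ≢ e₁ v₁≢r ∷ []) ∷ (j₂≢j₃ ∷ ρ≢ e₂ v₂≢r ∷ []) ∷ (ρ≢ e₃ v₃≢r ∷ []) ∷ [] ∷ [])
        (va ∷ (v₁ , e₁) ∷ (v₂ , e₂) ∷ (v₃ , e₃) ∷ (r , eᵣ) ∷ []))
        (ℕ.<⇒≱ (s≤s (ℕ.≤-reflexive dv)))

      yρ : miss c y ρ
      yρ w e with onlyQ (w , e)
      ... | here p = ρ≢ e₁ v₁≢r (sym p)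
      ... | there (here p) = ρ≢ e₂ v₂≢r (sym p)
      ... | there (there (here p)) = ρ≢ e₃ v₃≢r (sym p)

      u≢end : ∀ {j s} → miss c u j → c v s ≡ just j → u ≢ s
      u≢end uj e refl = uj v (flip e)

      u≢r : u ≢ r
      u≢r refl = r-small (ℕ.≤-trans (ℕ.n≤1+n 4) deg-u)

      y≢small : ∀ {s} → ¬ Big s → y ≢ s
      y≢small ns refl = ns (nbr-of-3 G crit nb)

      y≢end : ∀ {j s} → miss c u j → TypeV j → c v s ≡ just j → y ≢ s
      y≢end uj tv e refl = let (w , g) = end-has uj tv e T.pα in v⊆ T.pα w g

      link : ∀ {j s γ} → miss c u j → TypeV j → c v s ≡ just j → miss c v γ → L K j γ u s
      link uj tv e vγ = R.typeY-link uj e vγ (tv vγ)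

      -- A path to y would avoid v, which misses γ, and so exist in `K`; but there the (j,γ)-path
      -- from u already ends in s.
      no-link-y : ∀ {c′ j s γ} → c′ ⊑off[ v ∷ [] ] K → miss c u j → TypeV j → c v s ≡ just j →
                  miss c v γ → miss c′ v γ → ¬ Link c′ j γ u y
      no-link-y le uj tv e vγ vγ′ l = link uj tv e vγ λ l₀ →
        uniqueEnd goodK (inj₁ (miss-off uj)) (inj₁ (miss-used good e)) (inj₂ (miss-off (v⊆ vγ)))
          (y≢end uj tv e ∘ sym) l₀
          (dropMid (v ∷ []) le (λ { (here refl) → u≢v ∘ sym , y≢v ∘ sym , inj₂ vγ′ }) l)

      module Rec {s i β} (e : c v s ≡ just i) (vβ : miss c v β) (sβ : miss c s β) (u≢s : u ≢ s) (y≢s : y ≢ s)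
                 (nolink : ∀ {q a} → q ≢ s → c v q ≡ just a → ¬ Link K β a s q) where
        f = upd (c v) s β

        c′ : Colouring
        c′ = recolour c v s β

        good′ : Good c′
        good′ = Good-recolour good (no-loop e) vβ sβ nolink

        on′ : On (x ∷ []) c′
        on′ = On-recolour on e

        keep : ∀ {p a} → p ≢ v → p ≢ s → miss c p a → miss c′ p a
        keep p≢v p≢s m = miss-star p≢v (miss-off m) λ g → m v (flip (trans (sym (upd-other (c v) s β p≢s)) g))

        keep-u : ∀ {a} → miss c u a → miss c′ u a
        keep-u = keep u≢v u≢s
        keep-y : ∀ {a} → miss c y a → miss c′ y a
        keep-y = keep y≢v y≢s

        keep-v : ∀ {a} → miss c v a → a ≢ β → miss c′ v a
        keep-v m a≢β = miss-center λ q g → [ (λ (_ , p) → a≢β p) , (λ (_ , g′) → m q g′) ]′ (upd-just (c v) s β g)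

        old : miss c′ v i
        old = miss-center λ q g → [ (λ { (_ , refl) → vβ s e }) , (λ (ne , g′) → ne (proper g′ e)) ]′ (upd-just (c v) s β g)

        le : c′ ⊑off[ v ∷ [] ] K
        le = star-⊑off c v f

      -- Recolouring vv₃ with γ frees j₃ for xv, with j₁ on xu and γ′ on xy. The (j,γ)-paths from v₁
      -- and v₂ end in u rather than v₃, so only r could obstruct the recolouring, and either
      -- alternative prevents that.
      free-j₃ : ∀ {γ} → miss c v γ → miss c v₃ γ → miss c v₃ ρ ⊎ miss c r γ → ⊥
      free-j₃ {γ} vγ v₃γ alt with R.y-rich (γ ∷ []) (s≤s (s≤s z≤n))
      ... | γ′ , γ′∉ , vγ′ = try3 G crit nb good′ on′ (keep-y (v⊆ vγ′)) (keep-u uj₁) old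
        (used≢free uj₁ vγ′ ∘ sym) (used≢free uj₃ vγ′ ∘ sym) j₁≢j₃ (noLink (keep-u uj₁) (keep-u uj₃))
        (no-link-y le uj₁ typeV₁ e₁ vγ′ (keep-v vγ′ λ e → γ′∉ (here e)))
        (noLink old (keep-v vγ′ λ e → γ′∉ (here e)))
        where
        via : ∀ {j s} → miss c u j → TypeV j → c v s ≡ just j → ¬ Link K γ j v₃ s
        via uj tv e l = link uj tv e vγ λ l₀ →
          uniqueEnd goodK (inj₁ (miss-used good e)) (inj₁ (miss-off uj)) (inj₂ (miss-off v₃γ)) (u≢end uj₃ e₃)
            (Link-flip l₀) (Link-flip (Link-recolour l))
        nolink : ∀ {q a} → q ≢ v₃ → c v q ≡ just a → ¬ Link K γ a v₃ q
        nolink {q} q≢ e with onlyP (q , e)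
        ... | here refl = via uj₁ typeV₁ e
        ... | there (here refl) = via uj₂ typeV₂ e
        ... | there (there (here refl)) = ⊥-elim (q≢ (proper e e₃))
        ... | there (there (there (here refl))) with proper e eᵣ
        ... | refl = [ (λ m → noLink (miss-off v₃γ) (miss-off m)) , (λ m → noLinkʳ (miss-off m) (miss-used good eᵣ)) ]′ alt
        open Rec e₃ vγ v₃γ (u≢end uj₃ e₃) (y≢small v₃-small) nolink

      v₃-ρ : ∀ {γ} → miss c v γ → miss c v₃ γ → has c v₃ ρ
      v₃-ρ vγ v₃γ = ¬miss⇒has λ m → free-j₃ vγ v₃γ (inj₁ m)

      r-γ : ∀ {γ} → miss c v γ → miss c v₃ γ → has c r γ
      r-γ vγ v₃γ = ¬miss⇒has λ m → free-j₃ vγ v₃γ (inj₂ m)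

      free≢ρ : ∀ {γ} → miss c v γ → γ ≢ ρ
      free≢ρ vγ refl = vγ r eᵣ

      -- With j₃, two free colours and either the third or, by `v₃-ρ`, the colour ρ, the vertex v₃
      -- would have degree 4.
      two-in-v₃ : ∀ {γ γ′ γ″} → miss c v γ → miss c v γ′ → miss c v γ″ → Unique (γ ∷ γ′ ∷ γ″ ∷ []) →
                  has c v₃ γ → has c v₃ γ′ → ⊥
      two-in-v₃ {γ} {γ′} {γ″} vγ vγ′ vγ″ uq@((γ≢γ′ ∷ γ≢γ″ ∷ []) ∷ (γ′≢γ″ ∷ []) ∷ _) h h′ with has⊎miss c v₃ γ″
      ... | inj₁ h″ = v₃-small (deg-colours on [] (j₃ ∷ γ ∷ γ′ ∷ γ″ ∷ []) [] []
        ((used≢free uj₃ vγ ∷ used≢free uj₃ vγ′ ∷ used≢free uj₃ vγ″ ∷ []) ∷ uq) ((v , flip e₃) ∷ h ∷ h′ ∷ h″ ∷ []))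
      ... | inj₂ m″ = v₃-small (deg-colours on [] (j₃ ∷ γ ∷ γ′ ∷ ρ ∷ []) [] []
        ((used≢free uj₃ vγ ∷ used≢free uj₃ vγ′ ∷ ρ≢ e₃ v₃≢r ∷ []) ∷ (γ≢γ′ ∷ free≢ρ vγ ∷ []) ∷ (free≢ρ vγ′ ∷ []) ∷ [] ∷ [])
        ((v , flip e₃) ∷ h ∷ h′ ∷ v₃-ρ vγ″ m″ ∷ []))

      module Two {γ γ′ γ″} (vγ : miss c v γ) (vγ′ : miss c v γ′) (vγ″ : miss c v γ″)
          (γ≢γ′ : γ ≢ γ′) (γ≢γ″ : γ ≢ γ″) (γ′≢γ″ : γ′ ≢ γ″) (v₃γ : miss c v₃ γ) (v₃γ′ : miss c v₃ γ′) where

        r-miss : ∀ {a} → a ≢ ρ → a ≢ γ → a ≢ γ′ → miss c r a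
        r-miss {a} n₁ n₂ n₃ w e = r-small (deg-colours on [] (a ∷ ρ ∷ γ ∷ γ′ ∷ []) [] []
          ((n₁ ∷ n₂ ∷ n₃ ∷ []) ∷ ((free≢ρ vγ ∘ sym) ∷ (free≢ρ vγ′ ∘ sym) ∷ []) ∷ (γ≢γ′ ∷ []) ∷ [] ∷ [])
          ((w , e) ∷ (v , flip eᵣ) ∷ r-γ vγ v₃γ ∷ r-γ vγ′ v₃γ′ ∷ []))

        r-missⱼ : ∀ {j s} → miss c u j → c v s ≡ just j → s ≢ r → miss c r j
        r-missⱼ uj e s≢r = r-miss (ρ≢ e s≢r) (used≢free uj vγ) (used≢free uj vγ′)

        -- By `r-miss` the edge vr may be recoloured with γ″. This frees ρ for xv, and only a
        -- (j,ρ)-path between u and s can then prevent the extension.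
        ρ-link : ∀ {j s} → miss c u j → TypeV j → c v s ≡ just j → s ≢ r → L K j ρ u s
        ρ-link {j} {s} uj tv e s≢r ¬l = try3 G crit nb good′ on′ (keep-y (v⊆ vγ)) (keep-u uj) old
          (used≢free uj vγ ∘ sym) (free≢ρ vγ) (ρ≢ e s≢r)
          (λ l → ¬l (dropEnd good′ le (trans (star-at c v f s) (trans (upd-other (c v) r γ″ s≢r) e)) old (u≢end uj e) l))
          (no-link-y le uj tv e vγ (keep-v vγ γ≢γ″))
          (noLinkʳ (keep-y yρ) (keep-y (v⊆ vγ)))
          where
          nolink : ∀ {q a} → q ≢ r → c v q ≡ just a → ¬ Link K γ″ a r q
          nolink {q} {a} q≢ g = noLink (miss-off rγ″) (miss-off (go (onlyP (q , g))))
            where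
            rγ″ = r-miss (free≢ρ vγ″) (γ≢γ″ ∘ sym) (γ′≢γ″ ∘ sym)
            go : a ∈ j₁ ∷ j₂ ∷ j₃ ∷ ρ ∷ [] → miss c r a
            go (here refl) = r-missⱼ uj₁ e₁ v₁≢r
            go (there (here refl)) = r-missⱼ uj₂ e₂ v₂≢r
            go (there (there (here refl))) = r-missⱼ uj₃ e₃ v₃≢r
            go (there (there (there (here refl)))) = ⊥-elim (q≢ (proper g eᵣ))
          open Rec eᵣ vγ″ (r-miss (free≢ρ vγ″) (γ≢γ″ ∘ sym) (γ′≢γ″ ∘ sym)) u≢r (y≢small r-small) nolink

        ρ-end : ∀ {j s} → miss c u j → TypeV j → c v s ≡ just j → s ≢ r → has c s ρ
        ρ-end uj tv e s≢r = has-stable {c} λ ¬h → ρ-link uj tv e s≢r λ l →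
          ¬h (has-mono {K} {c} (del-⊑ (v ∷ []) c) (link-has (miss-used good e) l))

        -- The vertex s sees all colours free at v and, by `ρ-end`, also ρ; so its missing colours,
        -- at least two, lie among j₁, j₂ and j₃.
        saturated : ∀ {j s q} → miss c u j → TypeV j → c v s ≡ just j → s ≢ r →
          (∀ {a} → a ∈ j₁ ∷ j₂ ∷ j₃ ∷ [] → a ≡ q ⊎ has c s a) → ⊥
        saturated {j} {s} {q} uj tv e s≢r cover with avoidΔ G crit on {s} [] (q ∷ []) [] [] (s≤s (s≤s z≤n))
        ... | d , d∉ , sd with has⊎miss c v d
        ... | inj₂ vd = let (w , g) = end-has uj tv e vd in sd w g
        ... | inj₁ vd = go (onlyP vd)
          where
          use : d ≡ q ⊎ has c s d → ⊥
          use (inj₁ p) = d∉ (here p)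
          use (inj₂ (w , g)) = sd w g
          go : d ∈ j₁ ∷ j₂ ∷ j₃ ∷ ρ ∷ [] → ⊥
          go (here p) = use (cover (here p))
          go (there (here p)) = use (cover (there (here p)))
          go (there (there (here p))) = use (cover (there (there (here p))))
          go (there (there (there (here refl)))) = let (w , g) = ρ-end uj tv e s≢r in sd w g

        v₁j₂ : miss c v₁ j₂
        v₁j₂ w e = saturated uj₁ typeV₁ e₁ v₁≢r λ
          { (here refl) → inj₂ (v , flip e₁) ; (there (here refl)) → inj₂ (w , e) ; (there (there (here p))) → inj₁ p }
        v₁j₃ : miss c v₁ j₃
        v₁j₃ w e = saturated uj₁ typeV₁ e₁ v₁≢r λ
          { (here refl) → inj₂ (v , flip e₁) ; (there (here p)) → inj₁ p ; (there (there (here refl))) → inj₂ (w , e) }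
        v₂j₁ : miss c v₂ j₁
        v₂j₁ w e = saturated uj₂ typeV₂ e₂ v₂≢r λ
          { (here refl) → inj₂ (w , e) ; (there (here refl)) → inj₂ (v , flip e₂) ; (there (there (here p))) → inj₁ p }
        v₂j₃ : miss c v₂ j₃
        v₂j₃ w e = saturated uj₂ typeV₂ e₂ v₂≢r λ
          { (here p) → inj₁ p ; (there (here refl)) → inj₂ (v , flip e₂) ; (there (there (here refl))) → inj₂ (w , e) }

        v₁≢v₂ : v₁ ≢ v₂
        v₁≢v₂ = ends≢ j₁≢j₂ e₁ e₂

        open Swap good e₁ e₂ v₁≢v₂ using (f; f-s′; f-other; f-has; Good-swapped)

        c″ : Colouring
        c″ = swapped c v v₁ v₂ j₁ j₂

        good″ : Good c″
        good″ = Good-swapped v₁j₂ v₂j₁ λ {q} {a} n₁ n₂ g → go n₁ n₂ g (onlyP (q , g))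
          where
          go : ∀ {q a} → q ≢ v₁ → q ≢ v₂ → c v q ≡ just a → a ∈ j₁ ∷ j₂ ∷ j₃ ∷ ρ ∷ [] →
               ¬ Link K j₂ a v₁ q × ¬ Link K j₁ a v₂ q
          go n₁ n₂ g (here refl) = ⊥-elim (n₁ (proper g e₁))
          go n₁ n₂ g (there (here refl)) = ⊥-elim (n₂ (proper g e₂))
          go n₁ n₂ g (there (there (here refl))) = noLink (miss-off v₁j₂) (miss-off v₁j₃) , noLink (miss-off v₂j₁) (miss-off v₂j₃)
          go n₁ n₂ g (there (there (there (here refl)))) with proper g eᵣ
          ... | refl = noLinkʳ (miss-off (r-missⱼ uj₂ e₂ v₂≢r)) (miss-used good eᵣ) ,
                       noLinkʳ (miss-off (r-missⱼ uj₁ e₁ v₁≢r)) (miss-used good eᵣ)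

        keep : ∀ {p a} → p ≢ v → p ≢ v₁ → p ≢ v₂ → miss c p a → miss c″ p a
        keep n₀ n₁ n₂ m = miss-star n₀ (miss-off m) λ e → m v (flip (trans (sym (f-other n₁ n₂)) e))

        keep-u : ∀ {a} → miss c u a → miss c″ u a
        keep-u = keep u≢v (u≢end uj₁ e₁) (u≢end uj₂ e₂)

        keep-y : ∀ {a} → miss c y a → miss c″ y a
        keep-y = keep y≢v (y≢end uj₁ typeV₁ e₁) (y≢end uj₂ typeV₂ e₂)

        keep-v : ∀ {a} → miss c v a → miss c″ v a
        keep-v m = miss-center λ q e → let (w , g) = f-has e in m w g

        -- After the exchange at v the j₁-edge leads to v₂, while the (j₁,γ)-path from u still runs
        -- to v₁; so j₁ on xu and γ on xv no longer conflict.
        absurd : ⊥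
        absurd = try3 G crit nb good″ (On-swapped on e₁ e₂) (keep-y (v⊆ vγ′)) (keep-u uj₁) (keep-v vγ)
          (used≢free uj₁ vγ′ ∘ sym) (γ≢γ′ ∘ sym) (used≢free uj₁ vγ)
          (λ l → link uj₁ typeV₁ e₁ vγ λ l₀ →
            uniqueEnd goodK (inj₁ (miss-off uj₁)) (inj₁ (miss-used good e₁)) (inj₁ (miss-off v₂j₁)) v₁≢v₂ l₀
              (dropEnd good″ (star-⊑off c v f) (trans (star-at c v f v₂) f-s′) (keep-v vγ) (u≢end uj₂ e₂) l))
          (no-link-y (star-⊑off c v f) uj₁ typeV₁ e₁ vγ′ (keep-v vγ′))
          (noLinkʳ (keep-y (v⊆ vγ)) (keep-y (v⊆ vγ′)))

      -- Of three colours free at v, the vertex v₃ either sees two or misses two.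
      absurd : ⊥
      absurd = go (has⊎miss c v₃ T.α) (has⊎miss c v₃ T.β) (has⊎miss c v₃ T.γ)
        where
        open T
        go : has c v₃ α ⊎ miss c v₃ α → has c v₃ β ⊎ miss c v₃ β → has c v₃ γ ⊎ miss c v₃ γ → ⊥
        go (inj₂ a) (inj₂ b) _ = Two.absurd pα pβ pγ α≢β α≢γ β≢γ a b
        go (inj₂ a) (inj₁ _) (inj₂ g) = Two.absurd pα pγ pβ α≢γ α≢β (β≢γ ∘ sym) a g
        go (inj₁ _) (inj₂ b) (inj₂ g) = Two.absurd pβ pγ pα β≢γ (α≢β ∘ sym) (α≢γ ∘ sym) b g
        go (inj₁ a) (inj₁ b) _ = two-in-v₃ pα pβ pγ unique a b
        go (inj₁ a) (inj₂ _) (inj₁ g) = two-in-v₃ pα pγ pβ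
          ((α≢γ ∷ α≢β ∷ []) ∷ ((β≢γ ∘ sym) ∷ []) ∷ [] ∷ []) a g
        go (inj₂ _) (inj₁ b) (inj₁ g) = two-in-v₃ pβ pγ pα
          ((β≢γ ∷ (α≢β ∘ sym) ∷ []) ∷ ((α≢γ ∘ sym) ∷ []) ∷ [] ∷ []) b g

    big-v-five : deg v ≡ 5 → 3 ≤ big v
    big-v-five dv = ℕ.≮⇒≥ λ few → go few (v-has typeV₁) (v-has typeV₂) v-has₃
      where
      go : big v < 3 → has c v j₁ → has c v j₂ → has c v j₃ → ⊥
      go few (v₁ , e₁) (v₂ , e₂) (v₃ , e₃) with extra-nbr G {v} (x ∷ v₁ ∷ v₂ ∷ v₃ ∷ []) (ℕ.≤-reflexive (sym dv))
      ... | r , vr , r∉ with On.covers on vr (λ { (here refl) → Adj-irrefl xv refl }) (λ { (here refl) → r∉ (here refl) })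
      ... | ρ , eᵣ = Five.absurd dv few e₁ e₂ e₃ eᵣ (r∉ ∘ there)

    halfOK-u : HalfOK G u
    halfOK-u = deg-u , ℕ.≤-trans (ℕ.n≤1+n 2) big-u , λ _ → big-u

    halfOK-v : HalfOK G v
    halfOK-v = deg-v , big-v , big-v-five

  half-nbr : (G : Graph n) → Critical G → ∀ {x y u v} → Nbr3 G x y u v → Nbrs.deg G y ≡ 4 → HalfOK G u
  half-nbr G crit {x} {y} {u} {v} nb dy = decidable-stable (HalfOK? G u) λ ¬ok → start G crit nb λ {c} → contra ¬ok {c}
    where
    open Nbrs G
    le = ℕ.≤-reflexive dy
    contra : ¬ HalfOK G u → ∀ {c} → Good c → On (x ∷ []) c → Start c u v → ⊥
    contra ¬ok {c} good on st = cases G crit nb good on st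
      (λ ub vb yb u⊆ v⊆ → contradiction (Same.five-nbrs G crit nb good on ub vb yb u⊆ v⊆) (ℕ.<⇒≱ (s≤s le)))
      (λ u⊆ v⊆ → Neither.absurd G crit nb good on le u⊆ v⊆)
      (λ u⊆ vb yb → ¬ok (FromConfig.halfOK-u G crit nb (config G crit nb good on le st u⊆ vb yb)))
      (λ v⊆ ub yb → ¬ok (FromConfig.halfOK-v G crit (Nbr3-swap G nb)
        (config G crit (Nbr3-swap G nb) good on le (Start-swap st) v⊆ ub yb)))

  -- Neighbours of degree five

  module Deg5 (G : Graph n) (crit : Critical G) {x y u v c} (nb : Nbr3 G x y u v) (good : Good c)
      (on : Nbrs.On G (x ∷ []) c) (dy : Nbrs.deg G y ≡ 5) (few : Nbrs.big G y < 2) where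
    open Nbrs G
    open Critical crit
    open Nbr3 nb
    open Good good
    module U = Star3 G crit nb good on
    module V = Star3 G crit (Nbr3-swap G nb) good on
    module B = Three (three (λ xs lt → U.y-rich xs lt))

    K : Colouring
    K = off y c

    goodK : Good K
    goodK = Good-del (y ∷ []) good

    dif : ∀ {i j s t} → i ≢ j → c y s ≡ just i → c y t ≡ just j → s ≢ t
    dif ne e e′ refl = ne (just-injective (trans (sym e) e′))

    not-both : ∀ {i j s t} → i ≢ j → c y s ≡ just i → c y t ≡ just j → Big s → Big t → ⊥
    not-both ne e e′ bs bt = ℕ.<⇒≱ few (big-≥ {us = _ ∷ _ ∷ []} ((dif ne e e′ ∷ []) ∷ [] ∷ [])
      ((proj₁ (On.within on e) , bs) ∷ (proj₁ (On.within on e′) , bt) ∷ []))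

    no-five : ∀ {a₁ a₂ a₃ a₄ a₅} → Unique (a₁ ∷ a₂ ∷ a₃ ∷ a₄ ∷ a₅ ∷ []) → All (has c y) (a₁ ∷ a₂ ∷ a₃ ∷ a₄ ∷ a₅ ∷ []) → ⊥
    no-five uq hs = ℕ.<⇒≱ (s≤s (ℕ.≤-reflexive dy)) (U.deg-y uq hs)

    full⇒big : ∀ {j s} → c y s ≡ just j → (∀ {β} → miss c y β → has c s β) → Big s
    full⇒big {j} {s} ys full = deg-colours on [] (j ∷ B.α ∷ B.β ∷ B.γ ∷ []) [] []
      ((ne B.pα ∷ ne B.pβ ∷ ne B.pγ ∷ []) ∷ B.unique) ((y , flip ys) ∷ full B.pα ∷ full B.pβ ∷ full B.pγ ∷ [])
      where
      ne : ∀ {β} → miss c y β → j ≢ β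
      ne m refl = m s ys

    typeY-big : ∀ {j s} → miss c u j → c y s ≡ just j → U.TypeY j → Big s
    typeY-big uj ys ty = full⇒big ys λ yβ → U.link⇒has uj ys yβ (ty yβ)

    small-miss : ∀ {s} → ¬ Big s → ∀ {p q r} → Unique (p ∷ q ∷ r ∷ []) → All (has c s) (p ∷ q ∷ r ∷ []) →
                 ∀ {a} → a ≢ p → a ≢ q → a ≢ r → miss c s a
    small-miss ns uq hs n₁ n₂ n₃ w e =
      ns (deg-colours on [] (_ ∷ _ ∷ _ ∷ _ ∷ []) [] [] ((n₁ ∷ n₂ ∷ n₃ ∷ []) ∷ uq) ((w , e) ∷ hs))

    two-typeY : ∀ {j j′} → j ≢ j′ → miss c u j → miss c u j′ → has c y j → has c y j′ → U.TypeY j → U.TypeY j′ → ⊥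
    two-typeY ne uj uj′ (s , ys) (s′ , ys′) ty ty′ = not-both ne ys ys′ (typeY-big uj ys ty) (typeY-big uj′ ys′ ty′)

    -- Each small end carries its own colour and two free ones, hence no other colour of y. So a₁
    -- and a₂ can be exchanged, and the path that blocked a₁ arrives at the wrong end.
    swap-small : ∀ {b a₁ a₂ s₁ s₂} → miss c u b → miss c v b → miss c y b →
      (∀ {m β} → miss c u m → m ≢ b → miss c y β → b ≢ β → L c m β u y) →
      miss c u a₁ → miss c u a₂ → a₁ ≢ b → a₂ ≢ b → a₁ ≢ a₂ → c y s₁ ≡ just a₁ → c y s₂ ≡ just a₂ →
      ¬ Big s₁ → ¬ Big s₂ → ⊥
    swap-small {b} {a₁} {a₂} {s₁} {s₂} ub vb yb u-link ua₁ ua₂ a₁≢b a₂≢b a₁≢a₂ e₁ e₂ n₁ n₂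
      with U.y-rich (b ∷ []) (s≤s (s≤s z≤n))
    ... | β , β∉ , yβ with U.y-rich (b ∷ β ∷ []) (s≤s (s≤s (s≤s z≤n)))
    ... | β′ , β′∉ , yβ′ = try3 G crit nb good′ on′ (keep-y yβ) (keep (y≢u ∘ sym) (u≢ ua₁ e₁) (u≢ ua₂ e₂) ua₁)
        (keep-free (y≢v ∘ sym) vb yb) (has≢miss hj yβ ∘ sym) (b≢β ∘ sym) a₁≢b
        (noLink (keep (y≢u ∘ sym) (u≢ ua₁ e₁) (u≢ ua₂ e₂) ua₁) (keep-free (y≢u ∘ sym) ub yb))
        (no-uy ua₁ ua₂ yβ (u-link ua₁ a₁≢b yβ b≢β))
        (noLinkʳ (keep-y yb) (keep-y yβ))
      where
      b≢β = λ e → β∉ (here (sym e))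
      b≢β′ = λ e → β′∉ (here (sym e))
      β≢β′ = λ e → β′∉ (there (here (sym e)))
      s-only : ∀ {a s} → miss c u a → a ≢ b → c y s ≡ just a → ¬ Big s → ∀ {d} → has c y d → d ≢ a → miss c s d
      s-only {a} {s} ua a≢b ys ns yd d≢a = small-miss ns
        ((has≢miss ya yβ ∷ has≢miss ya yβ′ ∷ []) ∷ (β≢β′ ∷ []) ∷ [] ∷ [])
        ((y , flip ys) ∷ U.link⇒has ua ys yβ (u-link ua a≢b yβ b≢β) ∷ U.link⇒has ua ys yβ′ (u-link ua a≢b yβ′ b≢β′) ∷ [])
        d≢a (has≢miss yd yβ) (has≢miss yd yβ′)
        where
        ya : has c y a
        ya = s , ys
      open SwapCore G crit nb good on e₁ e₂ a₁≢a₂ (s-only ua₁ a₁≢b e₁ n₁) (s-only ua₂ a₂≢b e₂ n₂)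

    -- Two colours free at both u and v: both their edges at y end in big vertices.
    two-common : ∀ {i j} → i ≢ j → miss c u i → miss c v i → miss c u j → miss c v j → has c y i → has c y j → ⊥
    two-common {i} {j} i≢j ui vi uj vj yi@(s , ys) yj@(t , yt) =
      not-both i≢j ys yt (full⇒big ys fs) (full⇒big yt ft)
      where
      module _ {β} (yβ : miss c y β) where
        block : ¬ Link c i β u y → ¬ Link c j β v y → ⊥
        block = try3 G crit nb good on yβ ui vj (has≢miss yi yβ ∘ sym) (has≢miss yj yβ ∘ sym) i≢j (noLink ui uj)
        block′ : ¬ Link c j β u y → ¬ Link c i β v y → ⊥
        block′ = try3 G crit nb good on yβ uj vi (has≢miss yj yβ ∘ sym) (has≢miss yi yβ ∘ sym) (i≢j ∘ sym) (noLink uj ui)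
        both : ∀ {d} → miss c u d → miss c v d → Link c d β u y → Link c d β v y → ⊥
        both ud vd l l′ = uniqueEnd good (inj₂ yβ) (inj₁ ud) (inj₁ vd) u≢v (Link-flip l) (Link-flip l′)
        alt : (L c i β u y → L c j β u y → ⊥) → (L c i β v y → L c j β v y → ⊥) → ⊥
        alt inU inV = ¬first λ l → inU (λ ¬l → ¬l l) (λ ¬l → block′ ¬l (both ui vi l))
          where
          ¬first : ¬ ¬ Link c i β u y
          ¬first ¬l = inV (λ ¬l′ → block′ (λ l → lj (both uj vj l)) ¬l′) lj
            where
            lj : L c j β v y
            lj = block ¬l
        fs : has c s β
        fs = has-stable {c} λ ¬h → alt (λ l _ → ¬h (U.link⇒has ui ys yβ l)) (λ l _ → ¬h (V.link⇒has vi ys yβ l))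
        ft : has c t β
        ft = has-stable {c} λ ¬h → alt (λ _ l → ¬h (U.link⇒has uj yt yβ l)) (λ _ l → ¬h (V.link⇒has vj yt yβ l))

    -- At most four colours are used at y, so three missing at u and three missing at v have two in
    -- common.
    neither : (∀ {a} → miss c u a → has c y a) → (∀ {a} → miss c v a → has c y a) → ⊥
    neither u⊆ v⊆ = go (M.α ∈ᶠ? es) (M.β ∈ᶠ? es) (M.γ ∈ᶠ? es)
      where
      module M = Three (U.three-colours u⊆ U.u-rich)
      module E = Three (U.three-colours v⊆ U.v-rich)
      es = E.α ∷ E.β ∷ E.γ ∷ []
      inV : ∀ {a} → a ∈ es → miss c v a
      inV (here refl) = proj₁ E.pα
      inV (there (here refl)) = proj₁ E.pβ
      inV (there (there (here refl))) = proj₁ E.pγ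
      common : ∀ {a a′} → a ≢ a′ → miss c u a × has c y a → miss c u a′ × has c y a′ → a ∈ es → a′ ∈ es → ⊥
      common ne (ua , ya) (ua′ , ya′) i i′ = two-common ne ua (inV i) ua′ (inV i′) ya ya′
      outside : ∀ {a a′} → a ≢ a′ → miss c u a × has c y a → miss c u a′ × has c y a′ → a ∉ es → a′ ∉ es → ⊥
      outside ne (_ , ya) (_ , ya′) i i′ = no-five ((ne ∷ All.tabulate (λ z∈ e → i (subst (_∈ es) (sym e) z∈))) ∷
        All.tabulate (λ z∈ e → i′ (subst (_∈ es) (sym e) z∈)) ∷ E.unique)
        (ya ∷ ya′ ∷ proj₂ E.pα ∷ proj₂ E.pβ ∷ proj₂ E.pγ ∷ [])
      go : Dec (M.α ∈ es) → Dec (M.β ∈ es) → Dec (M.γ ∈ es) → ⊥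
      go (yes a) (yes b) _ = common M.α≢β M.pα M.pβ a b
      go (no a) (no b) _ = outside M.α≢β M.pα M.pβ a b
      go (yes a) (no _) (yes g) = common M.α≢γ M.pα M.pγ a g
      go (no _) (yes b) (yes g) = common M.β≢γ M.pβ M.pγ b g
      go (yes _) (no b) (no g) = outside M.β≢γ M.pβ M.pγ b g
      go (no a) (yes _) (no g) = outside M.α≢γ M.pα M.pγ a g

    module OnlyV (st : Start c u v) (u⊆ : ∀ {a} → miss c u a → has c y a) {b} (vb : miss c v b) (yb : miss c y b) where

      no-common : ∀ {a} → miss c u a → miss c v a → ⊥
      no-common {a} ua va with U.u-rich (a ∷ []) (s≤s (s≤s z≤n))
      ... | j , j∉ , uj with U.u-rich (a ∷ j ∷ []) (s≤s (s≤s (s≤s z≤n)))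
      ... | j′ , j′∉ , uj′ = two-typeY (λ e → j′∉ (there (here (sym e)))) uj uj′ (u⊆ uj) (u⊆ uj′)
        (U.common⇒typeY ua va (u⊆ ua) uj (u⊆ uj) (λ e → j∉ (here e)) vb yb)
        (U.common⇒typeY ua va (u⊆ ua) uj′ (u⊆ uj′) (λ e → j′∉ (here e)) vb yb)

      module M = Three (U.three-colours u⊆ U.u-rich)

      -- By `no-common` these two differ from the three colours missing at u, and y would have five
      -- coloured edges.
      two-used : ∀ {e e′} → e ≢ e′ → miss c v e → miss c v e′ → has c y e → has c y e′ → ⊥
      two-used ne ve ve′ ye ye′ = no-five ((ne ∷ v≢u ve M.pα ∷ v≢u ve M.pβ ∷ v≢u ve M.pγ ∷ []) ∷
        (v≢u ve′ M.pα ∷ v≢u ve′ M.pβ ∷ v≢u ve′ M.pγ ∷ []) ∷ M.unique)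
        (ye ∷ ye′ ∷ proj₂ M.pα ∷ proj₂ M.pβ ∷ proj₂ M.pγ ∷ [])
        where
        v≢u : ∀ {e a} → miss c v e → miss c u a × has c y a → e ≢ a
        v≢u ve (ua , _) refl = no-common ua ve

      -- At most one of three colours missing at v is used at y, so two are free and one of them
      -- differs from d.
      free : ∀ d → ∃ λ γ → γ ≢ d × miss c v γ × miss c y γ
      free d with U.v-rich (d ∷ []) (s≤s (s≤s z≤n))
      ... | g , g∉ , vg with has⊎miss c y g
      ... | inj₂ yg = g , (λ e → g∉ (here e)) , vg , yg
      ... | inj₁ yg with U.v-rich (d ∷ g ∷ []) (s≤s (s≤s (s≤s z≤n)))
      ... | g′ , g′∉ , vg′ = g′ , (λ e → g′∉ (here e)) , vg′ ,
        λ w e → two-used (λ p → g′∉ (there (here (sym p)))) vg vg′ yg (w , e)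

      module Z {ζ z} (uζ : miss c u ζ) (yz : c y z ≡ just ζ) (ty : U.TypeY ζ) where
        yζ : has c y ζ
        yζ = z , yz

        u≢ : ∀ {j s} → miss c u j → c y s ≡ just j → u ≢ s
        u≢ uj ys refl = uj y (flip ys)

        z-link : ∀ {β} → miss c y β → L K ζ β u z
        z-link yβ = U.typeY-link uζ yz yβ (ty yβ)

        -- Recolouring the edge ys from j to β would free j for xy.
        blocked : ∀ {j s β} → miss c u j → j ≢ ζ → c y s ≡ just j → miss c y β → miss c s β →
          (∀ {r a} → r ≢ s → a ≢ ζ → c y r ≡ just a → ¬ Link K β a s r) → ⊥
        blocked {j} {s} {β} uj j≢ζ ys yβ sβ nolink with free β
        ... | γ , γ≢β , vγ , yγ = try3 G crit nb good′ (On-recolour on ys) yj′ (keep-u uζ) vγ′ j≢ζ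
            (has≢miss yj yγ) (has≢miss yζ yγ)
            (λ l → z-link yγ λ l₀ → uniqueEnd goodK (inj₁ (miss-off uζ)) (inj₁ (miss-used good yz)) (inj₂ (miss-off vγ))
              z≢v l₀ (dropMid (y ∷ []) (star-⊑off c y f) (λ { (here refl) → y≢u , y≢v , inj₂ yγ′ }) l))
            (noLink (keep-u uζ) (keep-u uj))
            (noLinkʳ yγ′ yj′)
          where
          f = upd (c y) s β
          yj : has c y j
          yj = s , ys
          z≢v : z ≢ v
          z≢v refl = let (w , e) = U.link⇒has uζ yz yγ (ty yγ) in vγ w e
          good′ : Good (recolour c y s β)
          good′ = Good-recolour good (no-loop ys) yβ sβ nl
            where
            nl : ∀ {r a} → r ≢ s → c y r ≡ just a → ¬ Link K β a s r
            nl {r} {a} r≢s yr l with a ≟ ζ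
            ... | no a≢ζ = nolink r≢s a≢ζ yr l
            ... | yes refl with Good.proper good yr yz
            -- The (ζ,β)-path from z already ends in u, so it does not end in s.
            ... | refl = z-link yβ λ l₀ → uniqueEnd goodK (inj₁ (miss-used good yz)) (inj₁ (miss-off uζ)) (inj₂ (miss-off sβ))
              (u≢ uj ys) (Link-flip l₀) (Link-flip (Link-recolour l))
          keep-u : ∀ {a} → miss c u a → miss (recolour c y s β) u a
          keep-u m = miss-star (y≢u ∘ sym) (miss-off m) λ e → m y (flip (trans (sym (upd-other (c y) s β (u≢ uj ys))) e))
          vγ′ : miss (recolour c y s β) v γ
          vγ′ = miss-star (y≢v ∘ sym) (miss-off vγ) λ e →
            [ (λ (_ , p) → γ≢β p) , (λ (_ , g) → yγ v g) ]′ (upd-just (c y) s β e)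
          yγ′ : miss (recolour c y s β) y γ
          yγ′ = miss-center λ r e → [ (λ (_ , p) → γ≢β p) , (λ (_ , g) → yγ r g) ]′ (upd-just (c y) s β e)
          yj′ : miss (recolour c y s β) y j
          yj′ = miss-center λ r e →
            [ (λ { (_ , refl) → yβ s ys }) , (λ (ne , g) → ne (proper g ys)) ]′ (upd-just (c y) s β e)

        module _ {a₁ a₂ s₁ s₂} (ua₁ : miss c u a₁) (ua₂ : miss c u a₂) (a₁≢ζ : a₁ ≢ ζ) (a₂≢ζ : a₂ ≢ ζ) (a₁≢a₂ : a₁ ≢ a₂)
            (e₁ : c y s₁ ≡ just a₁) (e₂ : c y s₂ ≡ just a₂) where

          not-small : ∀ {j s} → j ≢ ζ → c y s ≡ just j → ¬ Big s
          not-small ne e bs = not-both ne e yz bs (typeY-big uζ yz ty)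

          -- Both recolourings would be blocked by a (β,a)-path to the one remaining coloured
          -- neighbour r of y, and r would be the end of paths from both s₁ and s₂.
          covered : ∀ {β} → miss c y β → miss c s₁ β → miss c s₂ β → ⊥
          covered {β} yβ m₁ m₂ = blocked ua₁ a₁≢ζ e₁ yβ m₁ outer
            where
            outer : ∀ {r a} → r ≢ s₁ → a ≢ ζ → c y r ≡ just a → ¬ Link K β a s₁ r
            outer {r} {a} r≢s₁ a≢ζ yr l with r ≟ s₂
            ... | yes refl = noLinkʳ (miss-off m₂) (miss-used good yr) l
            ... | no r≢s₂ = blocked ua₂ a₂≢ζ e₂ yβ m₂ inner
              where
              inner : ∀ {r′ a′} → r′ ≢ s₂ → a′ ≢ ζ → c y r′ ≡ just a′ → ¬ Link K β a′ s₂ r′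
              inner {r′} {a′} r′≢s₂ a′≢ζ yr′ l′ with r′ ≟ s₁ | a′ ≟ a
              ... | yes refl | _ = noLinkʳ (miss-off m₁) (miss-used good yr′) l′
              ... | no _ | yes refl with proper yr yr′
              ... | refl = uniqueEnd goodK (inj₂ (miss-used good yr)) (inj₁ (miss-off m₁)) (inj₁ (miss-off m₂))
                (dif a₁≢a₂ e₁ e₂) (Link-flip l) (Link-flip l′)
              inner {r′} {a′} r′≢s₂ a′≢ζ yr′ l′ | no r′≢s₁ | no a′≢a = no-five
                ((a′≢a ∷ a′≢ζ ∷ ≢c r′≢s₁ yr′ e₁ ∷ ≢c r′≢s₂ yr′ e₂ ∷ []) ∷ (a≢ζ ∷ ≢c r≢s₁ yr e₁ ∷ ≢c r≢s₂ yr e₂ ∷ []) ∷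
                 ((a₁≢ζ ∘ sym) ∷ (a₂≢ζ ∘ sym) ∷ []) ∷ (a₁≢a₂ ∷ []) ∷ [] ∷ [])
                ((r′ , yr′) ∷ (r , yr) ∷ yζ ∷ (s₁ , e₁) ∷ (s₂ , e₂) ∷ [])
                where
                ≢c : ∀ {p q d d′} → p ≢ q → c y p ≡ just d → c y q ≡ just d′ → d ≢ d′
                ≢c p≢q e e′ refl = p≢q (proper e e′)

          -- The small vertex s then carries only j, β and β′, so no path from s blocks recolouring
          -- ys with β″.
          two-in : ∀ {j s} → miss c u j → j ≢ ζ → c y s ≡ just j → ∀ {β β′ β″} → miss c y β → miss c y β′ → miss c y β″ →
            β ≢ β′ → β ≢ β″ → β′ ≢ β″ → has c s β → has c s β′ → ⊥
          two-in {j} {s} uj j≢ζ ys {β} {β′} {β″} yβ yβ′ yβ″ n n′ n″ h h′ =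
            blocked uj j≢ζ ys yβ″ sβ″ λ {r} {a} r≢s _ yr →
              noLink (miss-off sβ″) (miss-off (s-only (λ { refl → r≢s (proper yr ys) })
                (has≢miss {c} (r , yr) yβ) (has≢miss {c} (r , yr) yβ′)))
            where
            yj : has c y j
            yj = s , ys
            s-only : ∀ {a} → a ≢ j → a ≢ β → a ≢ β′ → miss c s a
            s-only = small-miss (not-small j≢ζ ys)
              ((has≢miss yj yβ ∷ has≢miss yj yβ′ ∷ []) ∷ (n ∷ []) ∷ [] ∷ []) ((y , flip ys) ∷ h ∷ h′ ∷ [])
            sβ″ : miss c s β″
            sβ″ = s-only (has≢miss yj yβ″ ∘ sym) (n′ ∘ sym) (n″ ∘ sym)

          -- By `covered` each of three free colours is seen by s₁ or s₂, so one of them sees two.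
          contra : ⊥
          contra = go (has⊎miss c s₁ B.α) (has⊎miss c s₁ B.β) (has⊎miss c s₁ B.γ)
            where
            open B
            in₁ = two-in ua₁ a₁≢ζ e₁
            in₂ = two-in ua₂ a₂≢ζ e₂
            h₂ : ∀ {β} → miss c y β → miss c s₁ β → has c s₂ β
            h₂ yβ m = ¬miss⇒has λ m′ → covered yβ m m′
            go : has c s₁ α ⊎ miss c s₁ α → has c s₁ β ⊎ miss c s₁ β → has c s₁ γ ⊎ miss c s₁ γ → ⊥
            go (inj₁ a) (inj₁ b) _ = in₁ pα pβ pγ α≢β α≢γ β≢γ a b
            go (inj₂ a) (inj₂ b) _ = in₂ pα pβ pγ α≢β α≢γ β≢γ (h₂ pα a) (h₂ pβ b)
            go (inj₁ a) (inj₂ _) (inj₁ g) = in₁ pα pγ pβ α≢γ α≢β (β≢γ ∘ sym) a g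
            go (inj₂ a) (inj₁ _) (inj₂ g) = in₂ pα pγ pβ α≢γ α≢β (β≢γ ∘ sym) (h₂ pα a) (h₂ pγ g)
            go (inj₂ _) (inj₁ b) (inj₁ g) = in₁ pβ pγ pα β≢γ (α≢β ∘ sym) (α≢γ ∘ sym) b g
            go (inj₁ _) (inj₂ b) (inj₂ g) = in₂ pβ pγ pα β≢γ (α≢β ∘ sym) (α≢γ ∘ sym) (h₂ pβ b) (h₂ pγ g)

      onlyV : ⊥
      onlyV = go st
        where
        go : Start c u v → ⊥
        go (i , j , ui , vj , i≢j , ¬l) with free j | U.u-rich (i ∷ []) (s≤s (s≤s z≤n))
        ... | γ , γ≢j , vγ , yγ | a₁ , a₁∉ , ua₁ with U.u-rich (i ∷ a₁ ∷ []) (s≤s (s≤s (s≤s z≤n)))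
        ... | a₂ , a₂∉ , ua₂ = finish (u⊆ ui) (u⊆ ua₁) (u⊆ ua₂)
          where
          finish : has c y i → has c y a₁ → has c y a₂ → ⊥
          finish yi@(z , yz) (s₁ , e₁) (s₂ , e₂) =
            Z.contra ui yz (U.start⇒typeY ui yi vj i≢j ¬l vγ yγ (γ≢j ∘ sym)) ua₁ ua₂
              (λ e → a₁∉ (here e)) (λ e → a₂∉ (here e)) (λ e → a₂∉ (there (here (sym e)))) e₁ e₂

  five-nbr : (G : Graph n) → Critical G → ∀ {x y u v} → Nbr3 G x y u v → Nbrs.deg G y ≡ 5 → 2 ≤ Nbrs.big G y
  five-nbr G crit {x} {y} {u} {v} nb dy = ℕ.≮⇒≥ λ few → start G crit nb λ {c} → contra few {c}
    where
    open Nbrs G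
    contra : big y < 2 → ∀ {c} → Good c → On (x ∷ []) c → Start c u v → ⊥
    contra few {c} good on st = cases G crit nb good on st same P.neither
      (λ u⊆ vb yb → P.OnlyV.onlyV st u⊆ vb yb)
      (λ v⊆ ub yb → Q.OnlyV.onlyV (Start-swap st) v⊆ ub yb)
      where
      module P = Deg5 G crit nb good on dy few
      module Q = Deg5 G crit (Nbr3-swap G nb) good on dy few
      same : ∀ {b} → miss c u b → miss c v b → miss c y b → (∀ {a} → miss c u a → a ≢ b → has c y a) →
             (∀ {a} → miss c v a → a ≢ b → has c y a) → ⊥
      same ub vb yb u⊆ v⊆ = go (u⊆ ua₁ a₁≢b) (u⊆ ua₂ a₂≢b) (v⊆ ve₁ e₁≢b) (v⊆ ve₂ e₂≢b)
        where
        module S = Same G crit nb good on ub vb yb u⊆ v⊆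
        open S.Four S.four
        go : has c y a₁ → has c y a₂ → has c y e₁ → has c y e₂ → ⊥
        -- At most one of the four ends is big, so both ends belonging to u or both belonging to v
        -- are small.
        go (s₁ , g₁) (s₂ , g₂) (t₁ , h₁) (t₂ , h₂) with 4 ℕ.≤? deg s₁ | 4 ℕ.≤? deg s₂
        ... | no n₁ | no n₂ = P.swap-small ub vb yb S.u-link ua₁ ua₂ a₁≢b a₂≢b a₁≢a₂ g₁ g₂ n₁ n₂
        ... | yes b₁ | _ = Q.swap-small vb ub yb S.v-link ve₁ ve₂ e₁≢b e₂≢b e₁≢e₂ h₁ h₂
          (P.not-both (a≢e ua₁ a₁≢b ve₁) g₁ h₁ b₁) (P.not-both (a≢e ua₁ a₁≢b ve₂) g₁ h₂ b₁)
        ... | no _ | yes b₂ = Q.swap-small vb ub yb S.v-link ve₁ ve₂ e₁≢b e₂≢b e₁≢e₂ h₁ h₂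
          (P.not-both (a≢e ua₂ a₂≢b ve₁) g₂ h₁ b₂) (P.not-both (a≢e ua₂ a₂≢b ve₂) g₂ h₂ b₂)

  -- Vertices with a neighbour of degree two

  nbr-of-2 : (G : Graph n) → Critical G → ∀ {x y} → Nbrs.deg G x ≡ 2 → Nbrs.Adj G x y → Nbrs.Big G y
  nbr-of-2 G crit {x} {y} dx xy = ℕ.<-≤-trans (s≤s (three-big G crit (proj₂ (nbr2 G dx xy))))
    (filter-notAll (λ v → 4 ℕ.≤? deg v) (nbrs y) (lose (nbrs⁺ (Adj-sym xy))))
    where
    open Nbrs G
    lose : ∀ {ys} → x ∈ ys → Any (λ v → ¬ Big v) ys
    lose (here refl) = here λ B → ℕ.1+n≰n (ℕ.≤-trans (ℕ.n≤1+n 3) (subst (4 ≤_) dx B))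
    lose (there i) = there (lose i)

  -- A neighbour of a vertex of degree two with exactly three big neighbours.

  record Big3 (G : Graph n) (c : Colouring) (y b₁ b₂ b₃ : Fin n) (γ₁ γ₂ γ₃ : Fin k) : Set where
    open Nbrs G
    field
      yb₁ : Adj y b₁
      yb₂ : Adj y b₂
      yb₃ : Adj y b₃
      B₁ : Big b₁
      B₂ : Big b₂
      B₃ : Big b₃
      b₁≢b₂ : b₁ ≢ b₂
      b₁≢b₃ : b₁ ≢ b₃
      b₂≢b₃ : b₂ ≢ b₃
      bigs : ∀ {s} → Adj y s → Big s → s ∈ b₁ ∷ b₂ ∷ b₃ ∷ []
      y₁ : c y b₁ ≡ just γ₁
      y₂ : c y b₂ ≡ just γ₂
      y₃ : c y b₃ ≡ just γ₃

  Big3-swap₂₃ : ∀ {G c y b₁ b₂ b₃ γ₁ γ₂ γ₃} → Big3 G c y b₁ b₂ b₃ γ₁ γ₂ γ₃ → Big3 G c y b₁ b₃ b₂ γ₁ γ₃ γ₂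
  Big3-swap₂₃ t = record { yb₁ = yb₁ ; yb₂ = yb₃ ; yb₃ = yb₂ ; B₁ = B₁ ; B₂ = B₃ ; B₃ = B₂
    ; b₁≢b₂ = b₁≢b₃ ; b₁≢b₃ = b₁≢b₂ ; b₂≢b₃ = b₂≢b₃ ∘ sym
    ; bigs = λ a B → turn (bigs a B) ; y₁ = y₁ ; y₂ = y₃ ; y₃ = y₂ }
    where
    open Big3 t
    turn : ∀ {s p q r} → s ∈ p ∷ q ∷ r ∷ [] → s ∈ p ∷ r ∷ q ∷ []
    turn (here e) = here e
    turn (there (here e)) = there (there (here e))
    turn (there (there (here e))) = there (here e)

  Big3-rotate : ∀ {G c y b₁ b₂ b₃ γ₁ γ₂ γ₃} → Big3 G c y b₁ b₂ b₃ γ₁ γ₂ γ₃ → Big3 G c y b₂ b₃ b₁ γ₂ γ₃ γ₁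
  Big3-rotate t = record { yb₁ = yb₂ ; yb₂ = yb₃ ; yb₃ = yb₁ ; B₁ = B₂ ; B₂ = B₃ ; B₃ = B₁
    ; b₁≢b₂ = b₂≢b₃ ; b₁≢b₃ = b₁≢b₂ ∘ sym ; b₂≢b₃ = b₁≢b₃ ∘ sym
    ; bigs = λ a B → turn (bigs a B) ; y₁ = y₂ ; y₂ = y₃ ; y₃ = y₁ }
    where
    open Big3 t
    turn : ∀ {s p q r} → s ∈ p ∷ q ∷ r ∷ [] → s ∈ q ∷ r ∷ p ∷ []
    turn (here e) = there (there (here e))
    turn (there (here e)) = here e
    turn (there (there (here e))) = there (here e)

  module Pivot (G : Graph n) (crit : Critical G) {x w y} (nb : Nbr2 G x w y) (dx : Nbrs.deg G x ≡ 2)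
      {c} (good : Good c) (on : Nbrs.On G (x ∷ []) c)
      (t-unique : ∀ {t t′} → Nbrs.Adj G y t → Nbrs.Adj G y t′ → Nbrs.deg G t ≡ 3 → Nbrs.deg G t′ ≡ 3 → t ≡ t′)
      {b₁ b₂ b₃ γ₁ γ₂ γ₃} (trio : Big3 G c y b₁ b₂ b₃ γ₁ γ₂ γ₃) where
    open Nbrs G
    open Critical crit
    open Nbr2 nb
    open Good good
    open Big3 trio

    bs : List (Fin n)
    bs = b₁ ∷ b₂ ∷ b₃ ∷ []

    Z : List (Fin n)
    Z = filter (λ z → deg z ℕ.≟ 2) (nbrs y)

    Z⁻ : ∀ {z} → z ∈ Z → Adj y z × deg z ≡ 2
    Z⁻ z∈ = let (i , d) = ∈-filter⁻ (λ z → deg z ℕ.≟ 2) {xs = nbrs y} z∈ in nbrs⁻ i , d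

    Z⁺ : ∀ {z} → Adj y z → deg z ≡ 2 → z ∈ Z
    Z⁺ yz d = ∈-filter⁺ (λ z → deg z ℕ.≟ 2) (nbrs⁺ yz) d

    x∈Z : x ∈ Z
    x∈Z = Z⁺ (Adj-sym xy) dx

    y∉Z : y ∉ Z
    y∉Z y∈ = Adj-irrefl (proj₁ (Z⁻ y∈)) refl

    D₀ : List (Fin n)
    D₀ = y ∷ Z

    4≰2 : ¬ 4 ≤ 2
    4≰2 (s≤s (s≤s ()))

    big∉ : ∀ {b} → Adj y b → Big b → b ∉ D₀
    big∉ yb B (here refl) = Adj-irrefl yb refl
    big∉ yb B (there i) = 4≰2 (subst (4 ≤_) (proj₂ (Z⁻ i)) B)

    bs∉ : ∀ {b} → b ∈ bs → b ∉ D₀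
    bs∉ (here refl) = big∉ yb₁ B₁
    bs∉ (there (here refl)) = big∉ yb₂ B₂
    bs∉ (there (there (here refl))) = big∉ yb₃ B₃

    -- The part shared by all colourings below. Without y, a vertex of `Z` keeps at most one edge,
    -- so no blocking path runs through it and all of these paths live in `K`.
    K : Colouring
    K = del D₀ c

    goodK : Good K
    goodK = Good-del D₀ good

    kind : ∀ {s} → Adj y s → s ∈ bs ⊎ deg s ≡ 3 ⊎ s ∈ Z
    kind {s} ys with 4 ℕ.≤? deg s
    ... | yes B = inj₁ (bigs ys B)
    ... | no ¬B = inj₂ (small (noLeaf G crit (Adj-sym ys)) (ℕ.≰⇒> ¬B) refl)
      where
      small : ∀ {d} → 2 ≤ d → d < 4 → deg s ≡ d → deg s ≡ 3 ⊎ s ∈ Z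
      small {0} () _ _
      small {1} (s≤s ()) _ _
      small {2} _ _ e = inj₂ (Z⁺ ys e)
      small {3} _ _ e = inj₁ e
      small {suc (suc (suc (suc _)))} _ (s≤s (s≤s (s≤s (s≤s ())))) _

    far-deg : ∀ {z w′} → deg z ≡ 2 → Nbr2 G z w′ y → 4 ≤ deg w′
    far-deg dz nbz = nbr-of-2 G crit dz (Nbr2.xw nbz)

    far∉ : ∀ {z w′} → deg z ≡ 2 → Nbr2 G z w′ y → w′ ∉ D₀
    far∉ dz nbz (here e) = Nbr2.w≢y nbz e
    far∉ dz nbz (there i) = 4≰2 (subst (4 ≤_) (proj₂ (Z⁻ i)) (far-deg dz nbz))

    -- The colours at the three big neighbours are parameters because two of them will be exchanged.
    record Ext (g₁ g₂ g₃ : Fin k) (D : List (Fin n)) (c′ : Colouring) : Set₁ where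
      field
        good′ : Good c′
        on′   : On D c′
        agree : ∀ {p q} → p ∉ D₀ → q ∉ D₀ → c′ p q ≡ c p q
        e₁    : c′ y b₁ ≡ just g₁
        e₂    : c′ y b₂ ≡ just g₂
        e₃    : c′ y b₃ ≡ just g₃

      K⊑ : K ⊑ c′
      K⊑ p q a e = let (p∉ , q∉ , g) = del-just {D = D₀} {c = c} e in trans (agree p∉ q∉) g

      ⊑K : off y c′ ⊑off[ Z ] K
      ⊑K p∉ q∉ e = let
          (p≢ , q≢ , g) = off-just {y = y} {c = c′} e
          p∉′ = λ { (here e) → p≢ e ; (there i) → p∉ i }
          q∉′ = λ { (here e) → q≢ e ; (there i) → q∉ i }
        in trans (del-keep {D = D₀} {c = c} p∉′ q∉′) (trans (sym (agree p∉′ q∉′)) g)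

      half-Z : ∀ {a b d} → a ≢ b → d ∈ Z → Half (off y c′) a b d
      half-Z {a} {b} {d} a≢b d∈ = let (yd , dd) = Z⁻ d∈ in go (proj₂ (nbr2 G dd (Adj-sym yd)))
        where
        go : ∀ {w′} → Nbr2 G d w′ y → Half (off y c′) a b d
        go {w′} nbd = split (≡-decᵐ _≟_ (off y c′ d w′) (just a))
          where
          at : ∀ v {a} → off y c′ d v ≡ just a → off y c′ d w′ ≡ just a
          at v {a} g = let (_ , v≢y , g′) = off-just {y = y} {c = c′} g in
            [ (λ p → subst (λ v → off y c′ d v ≡ just a) p g) , (λ p → ⊥-elim (v≢y p)) ]′
              (Nbr2.only nbd (proj₁ (On.within on′ g′)))
          split : Dec (off y c′ d w′ ≡ just a) → Half (off y c′) a b d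
          split (yes e) = inj₂ λ v g → a≢b (just-injective (trans (sym e) (at v g)))
          split (no ne) = inj₁ λ v g → ne (at v g)

      toK : ∀ {γ δ w′ b} → γ ≢ δ → w′ ∉ D₀ → b ∈ bs → Link (off y c′) γ δ w′ b → Link K γ δ w′ b
      toK γ≢δ w′∉ b∈ l = dropMid Z ⊑K (λ {d} d∈ → (λ { refl → w′∉ (there d∈) }) ,
        (λ { refl → bs∉ b∈ (there d∈) }) , half-Z γ≢δ d∈) l

      colour : ∀ {b} → b ∈ bs → ∃ λ g → g ∈ g₁ ∷ g₂ ∷ g₃ ∷ [] × c′ y b ≡ just g
      colour (here refl) = g₁ , here refl , e₁
      colour (there (here refl)) = g₂ , there (here refl) , e₂
      colour (there (there (here refl))) = g₃ , there (there (here refl)) , e₃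

    module AtZ {g₁ g₂ g₃ D c′} (ext : Ext g₁ g₂ g₃ D c′) {z w′} (dz : deg z ≡ 2) (nbz : Nbr2 G z w′ y) (z∈D : z ∈ D)
        (avoided : List (Fin k))
        (stuck : ∀ {ε δ} → miss c′ w′ ε → miss c′ y δ → δ ∉ avoided → ε ≢ δ → L c′ ε δ w′ y)
        (y-rich : Three (λ a → miss c′ y a × a ∉ avoided)) where
      open Ext ext
      w-rich = avoid1 G crit on′ (Adj-sym (Nbr2.xw nbz)) z∈D
      module S = Stuck G crit good′ on′ avoided stuck w-rich y-rich

      -- By `nbr-of` and `s-big` the colour γ lies on an edge from y to a big neighbour, and there
      -- are only three of these.
      γ-in : ∀ {γ} → miss c′ w′ γ → γ ∈ g₁ ∷ g₂ ∷ g₃ ∷ []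
      γ-in {γ} wγ = go (S.nbr-of wγ)
        where
        go : has c′ y γ → γ ∈ g₁ ∷ g₂ ∷ g₃ ∷ []
        go (s , ys) = let (g , g∈ , ys′) = colour (bigs (proj₁ (On.within on′ ys)) (S.s-big wγ ys))
          in subst (_∈ g₁ ∷ g₂ ∷ g₃ ∷ []) (just-injective (trans (sym ys′) ys)) g∈

      -- At least three colours are missing at w′, and by `γ-in` there are only three candidates.
      pick : ∀ {p q r} → (∀ {γ} → γ ∈ g₁ ∷ g₂ ∷ g₃ ∷ [] → γ ≡ p ⊎ γ ∈ q ∷ r ∷ []) → miss c′ w′ p
      pick {p} {q} {r} cl = let (m , m∉ , wm) = w-rich (q ∷ r ∷ []) (s≤s (s≤s (s≤s z≤n))) in
        [ (λ e → subst (miss c′ w′) e wm) , (λ i → ⊥-elim (m∉ i)) ]′ (cl (γ-in wm))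

      w₁ : miss c′ w′ g₁
      w₁ = pick λ { (here e) → inj₁ e ; (there i) → inj₂ i }
      w₂ : miss c′ w′ g₂
      w₂ = pick λ { (here e) → inj₂ (here e) ; (there (here e)) → inj₁ e ; (there (there i)) → inj₂ (there i) }
      w₃ : miss c′ w′ g₃
      w₃ = pick λ { (here e) → inj₂ (here e) ; (there (here e)) → inj₂ (there (here e)) ; (there (there (here e))) → inj₁ e }

      link : ∀ {γ b δ} → miss c′ w′ γ → b ∈ bs → c′ y b ≡ just γ → miss c′ y δ → δ ∉ avoided → L K γ δ w′ b
      link wγ b∈ yb yδ δ∉ ¬l = S.link wγ yb yδ δ∉ λ l → ¬l (toK (S.γ≢α wγ yδ δ∉) (far∉ dz nbz) b∈ l)

      -- A second deleted neighbour would give w′ a fourth missing colour.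
      shared : ∀ {x′} → x′ ∈ D → Adj w′ x′ → x′ ≢ z → ⊥
      shared x′∈ wx x′≢z = let
          (m , m∉ , wm) = avoid2 G crit on′ (Adj-sym (Nbr2.xw nbz)) z∈D wx x′∈ (x′≢z ∘ sym) (g₁ ∷ g₂ ∷ g₃ ∷ [])
                            (s≤s (s≤s (s≤s (s≤s z≤n))))
        in m∉ (γ-in wm)

    module AtX {g₁ g₂ g₃ c′} (ext : Ext g₁ g₂ g₃ (x ∷ []) c′) where
      open Ext ext

      private
        stuck : ∀ {ε δ} → miss c′ w ε → miss c′ y δ → δ ∉ [] → ε ≢ δ → L c′ ε δ w y
        stuck wε yδ _ ne ¬l = noCol (Attach2.Good-attach2 G {D = []} nb (λ ()) (λ ()) good′ wε yδ ne ¬l)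
          (Attach2.On-attach2 G {D = []} nb (λ ()) (λ ()) on′ (λ ()))
        y-rich : Three (λ a → miss c′ y a × a ∉ [])
        y-rich = three λ xs lt → let (a , a∉ , m) = avoid1 G crit on′ (Adj-sym xy) (here refl) xs lt in a , a∉ , m , λ ()
        module Z′ = AtZ ext dx nb (here refl) [] stuck y-rich

      w-misses : miss c′ w g₁ × miss c′ w g₂ × miss c′ w g₃
      w-misses = Z′.w₁ , Z′.w₂ , Z′.w₃

      links : ∀ {δ} → miss c′ y δ → L K g₁ δ w b₁ × L K g₂ δ w b₂ × L K g₃ δ w b₃
      links yδ = Z′.link Z′.w₁ (here refl) e₁ yδ (λ ()) , Z′.link Z′.w₂ (there (here refl)) e₂ yδ (λ ()) ,
        Z′.link Z′.w₃ (there (there (here refl))) e₃ yδ (λ ())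

    base : Ext γ₁ γ₂ γ₃ (x ∷ []) c
    base = record { good′ = good ; on′ = on ; agree = λ _ _ → refl ; e₁ = y₁ ; e₂ = y₂ ; e₃ = y₃ }

    K-miss : ∀ {p a} → miss c p a → miss K p a
    K-miss = miss-mono {c = K} {c′ = c} (del-⊑ D₀ c)

    K-used : ∀ {s a} → c y s ≡ just a → miss K s a
    K-used ys v e = let (_ , v∉ , g) = del-just {D = D₀} {c = c} e in v∉ (here (proper g (flip ys)))

    wγ₁ : miss c w γ₁
    wγ₁ = proj₁ (AtX.w-misses base)
    wγ₂ : miss c w γ₂
    wγ₂ = proj₁ (proj₂ (AtX.w-misses base))
    wγ₃ : miss c w γ₃
    wγ₃ = proj₂ (proj₂ (AtX.w-misses base))

    -- The paths that block β at x. They exist at once for colours free at y; for a colour used at y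
    -- they are found by rearranging the edges at y until it is free, which leaves `K` unchanged.
    Known : Fin k → Set₁
    Known β = L K γ₁ β w b₁ × L K γ₂ β w b₂ × L K γ₃ β w b₃

    known-free : ∀ {β} → miss c y β → Known β
    known-free = AtX.links base

    Known-stable : ∀ {β} → ((Known β → ⊥) → ⊥) → Known β
    Known-stable nn = (λ ¬l → nn λ (k₁ , _ , _) → k₁ ¬l) , (λ ¬l → nn λ (_ , k₂ , _) → k₂ ¬l) ,
      (λ ¬l → nn λ (_ , _ , k₃) → k₃ ¬l)

    extend : ∀ {g₁ g₂ g₃ z w′ D c′ ε δ} → Ext g₁ g₂ g₃ (z ∷ D) c′ → z ∈ Z → Nbr2 G z w′ y → (∀ {d} → d ∈ D → d ∈ Z) → z ∉ D →
      miss c′ w′ ε → miss c′ y δ → ε ≢ δ → ¬ Link c′ ε δ w′ y → Ext g₁ g₂ g₃ D (attach2 G c′ z w′ ε y δ)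
    extend {z = z} {w′} {D} {c′} {ε} {δ} ext z∈ nbz D⊆ z∉ wε yδ ne ¬l = record
      { good′ = Good-attach2 good′ wε yδ ne ¬l ; on′ = On-attach2 on′ z∉
      ; agree = λ p∉ q∉ → trans (star-off c′ z f (λ { refl → p∉ (there z∈) }) (λ { refl → q∉ (there z∈) })) (agree p∉ q∉)
      ; e₁ = old (here refl) e₁ ; e₂ = old (there (here refl)) e₂ ; e₃ = old (there (there (here refl))) e₃ }
      where
      open Ext ext
      open Attach2 G {D = D} nbz (far∉ (proj₂ (Z⁻ z∈)) nbz ∘ there ∘ D⊆) (y∉Z ∘ D⊆)
      old : ∀ {b g} → b ∈ bs → c′ y b ≡ just g → attach2 G c′ z w′ ε y δ y b ≡ just g
      old b∈ e = trans (star-off c′ z f (λ { refl → y∉Z z∈ }) (λ { refl → bs∉ b∈ (there z∈) })) e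

    attach-miss : ∀ {z w′ c′ ε δ β} → Nbr2 G z w′ y → miss c′ y β → β ≢ δ → miss (attach2 G c′ z w′ ε y δ) y β
    attach-miss {z} {w′} {c′} {ε} {δ} nbz m ne = miss-star (Adj-irrefl (Nbr2.xy nbz) ∘ sym) (miss-off m)
      λ e → ne (just-injective (trans (sym e) (Attach2.f-y G {c = c′} {D = []} nbz (λ ()) (λ ()))))

    attach-miss⁻ : ∀ {z w′ D c′ ε δ β} → Nbr2 G z w′ y → On (z ∷ D) c′ →
      miss (attach2 G c′ z w′ ε y δ) y β → miss c′ y β
    attach-miss⁻ {z} {w′} {D} {c′} nbz on′ m v e = m v (trans (star-off c′ z _ (Adj-irrefl (Nbr2.xy nbz) ∘ sym)
      (λ { refl → proj₂ (proj₂ (On.within on′ e)) (here refl) })) e)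

    same-far : ∀ {w′ γ δ b} → L K γ δ w b → L K γ δ w′ b → miss K w γ → miss K w′ γ → miss K b γ → w ≢ w′ → ⊥
    same-far l l′ wγ w′γ bγ ne = uniqueEndᴸ goodK (inj₁ bγ) (inj₁ wγ) (inj₁ w′γ) ne (L-flip l) (L-flip l′)

    -- Uncolour z and reattach it with a colour other than β at y; then β is free. If this fails, a
    -- blocking path from the far neighbour w′ of z reaches b₁, where the path from w ends too; the
    -- case w′ = w is excluded by `shared`.
    known-Z : ∀ {z β} → z ∈ Z → z ≢ x → c y z ≡ just β → Known β
    known-Z {z} {β} z∈ z≢x yz = Known-stable λ ¬kn → contra ¬kn (nbr2 G (proj₂ (Z⁻ z∈)) (Adj-sym (proj₁ (Z⁻ z∈))))
      where
      c₂ = off z c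
      ext₂ : Ext γ₁ γ₂ γ₃ (z ∷ x ∷ []) c₂
      ext₂ = record { good′ = Good-del (z ∷ []) good ; on′ = On-del on
        ; agree = λ p∉ q∉ → off-keep (λ { refl → p∉ (there z∈) }) (λ { refl → q∉ (there z∈) })
        ; e₁ = old (here refl) y₁ ; e₂ = old (there (here refl)) y₂ ; e₃ = old (there (there (here refl))) y₃ }
        where
        old : ∀ {b g} → b ∈ bs → c y b ≡ just g → c₂ y b ≡ just g
        old b∈ e = trans (off-keep (λ { refl → y∉Z z∈ }) (λ { refl → bs∉ b∈ (there z∈) })) e
      c₂⇒c : ∀ {a} → miss c₂ y a → a ≢ β → miss c y a
      c₂⇒c m ne v e with v ≟ z
      ... | yes refl = ne (just-injective (trans (sym e) yz))
      ... | no v≢z = m v (trans (off-keep (λ { refl → y∉Z z∈ }) v≢z) e)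
      contra : (Known β → ⊥) → (∃ λ w′ → Nbr2 G z w′ y) → ⊥
      contra ¬kn (w′ , nbz) = finish (Three.pα y-rich)
        where
        open Ext ext₂
        stuck : ∀ {ε δ} → miss c₂ w′ ε → miss c₂ y δ → δ ∉ β ∷ [] → ε ≢ δ → L c₂ ε δ w′ y
        stuck wε yδ δ∉ ne ¬l = ¬kn (AtX.links
          (extend ext₂ z∈ nbz (λ { (here refl) → x∈Z }) (λ { (here e) → z≢x e }) wε yδ ne ¬l)
          (attach-miss nbz (miss-used good (flip yz)) (λ e → δ∉ (here (sym e)))))
        y-rich : Three (λ a → miss c₂ y a × a ∉ β ∷ [])
        y-rich = three λ xs lt → let
            (a , a∉ , m) = avoid2 G crit on′ (proj₁ (Z⁻ z∈)) (here refl) (Adj-sym xy) (there (here refl)) z≢x (β ∷ xs) (s≤s lt)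
          in a , (a∉ ∘ there) , m , λ { (here e) → a∉ (here e) }
        module A = AtZ ext₂ (proj₂ (Z⁻ z∈)) nbz (here refl) (β ∷ []) stuck y-rich
        finish : ∀ {δ} → miss c₂ y δ × δ ∉ β ∷ [] → ⊥
        finish (yδ , δ∉) with w ≟ w′
        ... | yes refl = A.shared (there (here refl)) (Adj-sym xw) (z≢x ∘ sym)
        ... | no ne = same-far (proj₁ (known-free (c₂⇒c yδ (δ∉ ∘ here)))) (A.link A.w₁ (here refl) e₁ yδ δ∉)
          (K-miss wγ₁) (miss-mono {c = K} {c′ = c₂} K⊑ A.w₁) (K-used y₁) ne

    others : List (Fin n)
    others = remove x Z

    -- Reattach the remaining vertices of degree two one at a time, never using β at y.
    greedy : ∀ {g₁ g₂ g₃ β b g} zs {c′} → Ext g₁ g₂ g₃ (zs ++ x ∷ []) c′ → Unique zs → (∀ {z} → z ∈ zs → z ∈ Z × z ≢ x) →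
      miss c′ y β → b ∈ bs → c′ y b ≡ just g → g ∈ g₁ ∷ g₂ ∷ g₃ ∷ [] → miss K w g → miss K b g →
      (∀ {δ} → miss c′ y δ → δ ≢ β → L K g δ w b) →
      (∀ {c″} → Ext g₁ g₂ g₃ (x ∷ []) c″ → miss c″ y β → ⊥) → ⊥
    greedy [] ext _ _ yβ _ _ _ _ _ _ done = done ext yβ
    greedy {g₁} {g₂} {g₃} {β} {b} {g} (z ∷ zs) {c′} ext (z∉zs ∷ uq) ⊆Z yβ b∈ yb g∈ wg bg known done =
      contra (nbr2 G dz (Adj-sym yz))
      where
      open Ext ext
      z∈ = proj₁ (⊆Z (here refl))
      z≢x = proj₂ (⊆Z (here refl))
      yz = proj₁ (Z⁻ z∈)
      dz = proj₂ (Z⁻ z∈)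
      D = zs ++ x ∷ []
      x∈D : x ∈ D
      x∈D = ∈-++⁺ʳ zs (here refl)
      D⊆ : ∀ {d} → d ∈ D → d ∈ Z
      D⊆ i = [ (λ j → proj₁ (⊆Z (there j))) , (λ { (here refl) → x∈Z }) ]′ (∈-++⁻ zs i)
      z∉D : z ∉ D
      z∉D i = [ (λ j → All.lookup z∉zs j refl) , (λ { (here e) → z≢x e }) ]′ (∈-++⁻ zs i)
      y-rich : Three (λ a → miss c′ y a × a ∉ β ∷ [])
      y-rich = three λ xs lt → let
          (a , a∉ , m) = avoid2 G crit on′ yz (here refl) (Adj-sym xy) (there x∈D) z≢x (β ∷ xs) (s≤s lt)
        in a , (a∉ ∘ there) , m , λ { (here e) → a∉ (here e) }
      b≢z : b ≢ z
      b≢z refl = bs∉ b∈ (there z∈)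
      y≢z : y ≢ z
      y≢z = Adj-irrefl yz
      contra : (∃ λ w′ → Nbr2 G z w′ y) → ⊥
      contra (w′ , nbz) = finish (Three.pα y-rich)
        where
        stuck : ∀ {ε δ} → miss c′ w′ ε → miss c′ y δ → δ ∉ β ∷ [] → ε ≢ δ → L c′ ε δ w′ y
        stuck wε yδ δ∉ ne ¬l = greedy zs (extend ext z∈ nbz D⊆ z∉D wε yδ ne ¬l) uq (⊆Z ∘ there)
          (attach-miss nbz yβ (λ e → δ∉ (here (sym e)))) b∈ (trans (star-off c′ z _ y≢z b≢z) yb) g∈ wg bg
          (λ m → known (attach-miss⁻ nbz on′ m)) done
        open AtZ ext dz nbz (here refl) (β ∷ []) stuck y-rich
        w′g : ∀ {g} → g ∈ g₁ ∷ g₂ ∷ g₃ ∷ [] → miss c′ w′ g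
        w′g (here refl) = w₁
        w′g (there (here refl)) = w₂
        w′g (there (there (here refl))) = w₃
        finish : ∀ {δ} → miss c′ y δ × δ ∉ β ∷ [] → ⊥
        finish (yδ , δ∉) with w ≟ w′
        ... | yes refl = shared (there x∈D) (Adj-sym xw) (z≢x ∘ sym)
        ... | no ne = same-far (known yδ (δ∉ ∘ here)) (link (w′g g∈) b∈ yb yδ δ∉) wg (miss-mono {c = K} {c′ = c′} K⊑ (w′g g∈)) bg ne

    cZ : Colouring
    cZ = del Z c

    cZ-y : ∀ {s} → s ∉ Z → cZ y s ≡ c y s
    cZ-y s∉ = del-keep y∉Z s∉

    order : ∀ {c′ : Colouring} → On Z c′ → On (others ++ x ∷ []) c′
    order on′ = record { covers = λ e u∉ v∉ → On.covers on′ e (u∉ ∘ to) (v∉ ∘ to)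
      ; within = λ e → let (a , u∉ , v∉) = On.within on′ e in a , u∉ ∘ from , v∉ ∘ from }
      where
      to : ∀ {d} → d ∈ Z → d ∈ others ++ x ∷ []
      to {d} i with d ≟ x
      ... | yes refl = ∈-++⁺ʳ others (here refl)
      ... | no ne = ∈-++⁺ˡ (∈-remove i ne)
      from : ∀ {d} → d ∈ others ++ x ∷ [] → d ∈ Z
      from i = [ (λ j → proj₁ (∈-filter⁻ (λ z → ¬? (z ≟ x)) {xs = Z} j)) , (λ { (here refl) → x∈Z }) ]′ (∈-++⁻ others i)

    others-unique : Unique others
    others-unique = Unique.filter⁺ (λ z → ¬? (z ≟ x)) (Unique.filter⁺ (λ z → deg z ℕ.≟ 2) (nbrs-unique y))

    others⊆ : ∀ {z} → z ∈ others → z ∈ Z × z ≢ x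
    others⊆ i = ∈-filter⁻ (λ z → ¬? (z ≟ x)) {xs = Z} i

    good-Z : Good cZ
    good-Z = Good-del Z good

    on-Z : On Z cZ
    on-Z = record { covers = λ e u∉ v∉ → let (a , g) = On.covers on e (λ { (here refl) → u∉ x∈Z }) (λ { (here refl) → v∉ x∈Z })
                      in a , trans (del-keep {D = Z} {c = c} u∉ v∉) g
      ; within = λ e → let (u∉ , v∉ , g) = del-just {D = Z} {c = c} e in proj₁ (On.within on g) , u∉ , v∉ }

    agree-Z : ∀ {p q} → p ∉ D₀ → q ∉ D₀ → cZ p q ≡ c p q
    agree-Z p∉ q∉ = del-keep (p∉ ∘ there) (q∉ ∘ there)

    off-Z : off y cZ ⊑ K
    off-Z p q a e = let
        (p≢ , q≢ , g) = off-just {y = y} {c = cZ} e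
        (p∉ , q∉ , g′) = del-just {D = Z} {c = c} g
      in trans (del-keep {D = D₀} {c = c} (λ { (here e) → p≢ e ; (there i) → p∉ i }) (λ { (here e) → q≢ e ; (there i) → q∉ i })) g′

    cZ-miss : ∀ {p a} → miss c p a → miss cZ p a
    cZ-miss = miss-mono {c = cZ} {c′ = c} (del-⊑ Z c)

    t∉Z : ∀ {t} → deg t ≡ 3 → t ∉ Z
    t∉Z dt i with trans (sym dt) (proj₂ (Z⁻ i))
    ... | ()

    t≢b : ∀ {t b} → deg t ≡ 3 → Big b → b ≢ t
    t≢b dt B refl = ℕ.1+n≰n (subst (4 ≤_) dt B)

    w≢t : ∀ {t} → deg t ≡ 3 → w ≢ t
    w≢t dt = t≢b dt (far-deg dx nb)

    -- Having degree 3, t misses one of three free colours α, and recolouring yt with α frees τ. The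
    -- vertices of degree 2 are taken out first and put back by `greedy` without using τ at y.
    known-t : ∀ {t τ} → deg t ≡ 3 → c y t ≡ just τ → Known τ
    known-t {t} {τ} dt yt = Known-stable λ ¬kn → contra ¬kn (choose (has⊎miss c t T.α) (has⊎miss c t T.β) (has⊎miss c t T.γ))
      where
      module T = Three (three (avoid1 G crit on (Adj-sym xy) (here refl)))
      yt-adj : Adj y t
      yt-adj = proj₁ (On.within on yt)
      ne : ∀ {a} → miss c y a → τ ≢ a
      ne m refl = m t yt
      choose : has c t T.α ⊎ miss c t T.α → has c t T.β ⊎ miss c t T.β → has c t T.γ ⊎ miss c t T.γ →
               ∃ λ α → miss c y α × miss c t α
      choose (inj₂ m) _ _ = T.α , T.pα , m
      choose _ (inj₂ m) _ = T.β , T.pβ , m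
      choose _ _ (inj₂ m) = T.γ , T.pγ , m
      choose (inj₁ h) (inj₁ h′) (inj₁ h″) = ⊥-elim (ℕ.1+n≰n (subst (4 ≤_) dt
        (deg-colours on [] (τ ∷ T.α ∷ T.β ∷ T.γ ∷ []) [] [] ((ne T.pα ∷ ne T.pβ ∷ ne T.pγ ∷ []) ∷ T.unique)
          ((y , flip yt) ∷ h ∷ h′ ∷ h″ ∷ []))))
      contra : (Known τ → ⊥) → (∃ λ α → miss c y α × miss c t α) → ⊥
      contra ¬kn (α , yα , tα) = greedy others ext others-unique others⊆ yτ (here refl) new₁ (here refl)
          (K-miss wγ₁) (K-used y₁) known done
        where
        f = upd (cZ y) t α
        c₁ = recolour cZ y t α
        ytZ : cZ y t ≡ just τ
        ytZ = trans (cZ-y (t∉Z dt)) yt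
        -- At a big neighbour the path in question already ends in w; there is no second vertex of
        -- degree 3, and those of degree 2 have been taken out.
        nolinkK : ∀ {r a} → r ≢ t → c y r ≡ just a → r ∉ Z → ¬ Link K α a t r
        nolinkK {r} {a} r≢t yr r∉ l = go (kind (proj₁ (On.within on yr)))
          where
          end : ∀ {b γ} → c y b ≡ just γ → r ≡ b → L K γ α w b → miss K w γ → ⊥
          end yb refl lk wγ with just-injective (trans (sym yr) yb)
          ... | refl = lk λ l₀ → uniqueEnd goodK (inj₁ (K-used yb)) (inj₁ wγ) (inj₂ (K-miss tα)) (w≢t dt)
            (Link-flip l₀) (Link-flip (Link-recolour l))
          kn = known-free yα
          go : r ∈ bs ⊎ deg r ≡ 3 ⊎ r ∈ Z → ⊥
          go (inj₁ (here e)) = end y₁ e (proj₁ kn) (K-miss wγ₁)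
          go (inj₁ (there (here e))) = end y₂ e (proj₁ (proj₂ kn)) (K-miss wγ₂)
          go (inj₁ (there (there (here e)))) = end y₃ e (proj₂ (proj₂ kn)) (K-miss wγ₃)
          go (inj₂ (inj₁ dr)) = r≢t (t-unique (proj₁ (On.within on yr)) yt-adj dr dt)
          go (inj₂ (inj₂ i)) = r∉ i
        good₁ : Good c₁
        good₁ = Good-recolour good-Z (no-loop yt) (cZ-miss yα) (cZ-miss tα) λ {r} {a} r≢t yr l →
          let (_ , r∉ , yr′) = del-just {D = Z} {c = c} yr in nolinkK r≢t yr′ r∉ (Link-mono off-Z l)
        new : ∀ {b g} → b ∈ bs → c y b ≡ just g → b ≢ t → c₁ y b ≡ just g
        new b∈ e b≢t = trans (star-at cZ y f _) (trans (upd-other (cZ y) t α b≢t) (trans (cZ-y (bs∉ b∈ ∘ there)) e))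
        new₁ = new (here refl) y₁ (t≢b dt B₁)
        ext : Ext γ₁ γ₂ γ₃ (others ++ x ∷ []) c₁
        ext = record { good′ = good₁ ; on′ = order (On-recolour on-Z ytZ)
          ; agree = λ p∉ q∉ → trans (star-off cZ y f (λ { refl → p∉ (here refl) }) (λ { refl → q∉ (here refl) })) (agree-Z p∉ q∉)
          ; e₁ = new₁ ; e₂ = new (there (here refl)) y₂ (t≢b dt B₂) ; e₃ = new (there (there (here refl))) y₃ (t≢b dt B₃) }
        yτ : miss c₁ y τ
        yτ = miss-center λ r e → [ (λ { (_ , refl) → yα t yt }) , (λ (r≢ , g) → r≢ (Good.proper good-Z g ytZ)) ]′ (upd-just (cZ y) t α e)
        known : ∀ {δ} → miss c₁ y δ → δ ≢ τ → L K γ₁ δ w b₁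
        known {δ} m δ≢τ = go (has⊎miss c y δ)
          where
          absent : ∀ {s} → c y s ≡ just δ → s ∉ Z → s ≢ t → ⊥
          absent ys s∉ s≢t = m _ (trans (star-at cZ y f _) (trans (upd-other (cZ y) t α s≢t) (trans (cZ-y s∉) ys)))
          go : has c y δ ⊎ miss c y δ → L K γ₁ δ w b₁
          go (inj₂ yδ) = proj₁ (known-free yδ)
          go (inj₁ (s , ys)) with s ∈ᶠ? Z | s ≟ t
          ... | yes s∈ | _ = proj₁ (known-Z s∈ (λ { refl → proj₂ (proj₂ (On.within on ys)) (here refl) }) ys)
          ... | no s∉ | no s≢t = ⊥-elim (absent ys s∉ s≢t)
          ... | no s∉ | yes refl = ⊥-elim (δ≢τ (just-injective (trans (sym ys) yt)))
        done : ∀ {c″} → Ext γ₁ γ₂ γ₃ (x ∷ []) c″ → miss c″ y τ → ⊥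
        done ext″ yτ″ = ¬kn (AtX.links ext″ yτ″)

    known-all : ∀ {β} → β ≢ γ₁ → β ≢ γ₂ → β ≢ γ₃ → Known β
    known-all {β} n₁ n₂ n₃ = go (has⊎miss c y β)
      where
      same : ∀ {s b γ} → c y s ≡ just β → c y b ≡ just γ → s ≡ b → β ≡ γ
      same e e′ refl = just-injective (trans (sym e) e′)
      go : has c y β ⊎ miss c y β → Known β
      go (inj₂ yβ) = known-free yβ
      go (inj₁ (s , ys)) with kind (proj₁ (On.within on ys))
      ... | inj₁ (here e) = ⊥-elim (n₁ (same ys y₁ e))
      ... | inj₁ (there (here e)) = ⊥-elim (n₂ (same ys y₂ e))
      ... | inj₁ (there (there (here e))) = ⊥-elim (n₃ (same ys y₃ e))
      ... | inj₂ (inj₁ ds) = known-t ds ys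
      ... | inj₂ (inj₂ s∈) = known-Z s∈ (λ { refl → proj₂ (proj₂ (On.within on ys)) (here refl) }) ys

    end-has : ∀ {b γ β} → c y b ≡ just γ → L K γ β w b → has c b β
    end-has yb l = has-stable {c} λ ¬h → l λ l′ → ¬h (has-mono {K} {c} (del-⊑ D₀ c) (link-has (K-used yb) l′))

    full₁ : ∀ {β} → β ≢ γ₁ → β ≢ γ₂ → β ≢ γ₃ → has c b₁ β
    full₁ n₁ n₂ n₃ = end-has y₁ (proj₁ (known-all n₁ n₂ n₃))
    full₂ : ∀ {β} → β ≢ γ₁ → β ≢ γ₂ → β ≢ γ₃ → has c b₂ β
    full₂ n₁ n₂ n₃ = end-has y₂ (proj₁ (proj₂ (known-all n₁ n₂ n₃)))
    -- At least two colours are missing at b, all among p, q and r, and p is present.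
    saturated : ∀ {b p q r} → (∀ {β} → β ≢ p → β ≢ q → β ≢ r → has c b β) → has c b p → miss c b q
    saturated {b} {p} {q} {r} full hp v e = go (avoidΔ G crit on {b} [] (r ∷ []) [] [] (s≤s (s≤s z≤n)))
      where
      go : (∃ λ d → d ∉ r ∷ [] × miss c b d) → ⊥
      go (d , d∉ , m) with d ≟ p | d ≟ q
      ... | yes refl | _ = let (s , g) = hp in m s g
      ... | no _ | yes refl = m v e
      ... | no n₁ | no n₂ = let (s , g) = full n₁ n₂ (d∉ ∘ here) in m s g

    b₁γ₂ : miss c b₁ γ₂
    b₁γ₂ = saturated full₁ (y , flip y₁)
    b₁γ₃ : miss c b₁ γ₃
    b₁γ₃ = saturated (λ n₁ n₃ n₂ → full₁ n₁ n₂ n₃) (y , flip y₁)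
    b₂γ₁ : miss c b₂ γ₁
    b₂γ₁ = saturated (λ n₂ n₁ n₃ → full₂ n₁ n₂ n₃) (y , flip y₂)
    b₂γ₃ : miss c b₂ γ₃
    b₂γ₃ = saturated (λ n₂ n₃ n₁ → full₂ n₁ n₂ n₃) (y , flip y₂)
    -- After exchanging γ₁ and γ₂ the path that blocked x ends at the wrong vertex.
    swap₁₂ : (∀ {t τ} → deg t ≡ 3 → c y t ≡ just τ → ¬ Link K γ₂ τ b₁ t × ¬ Link K γ₁ τ b₂ t) → ⊥
    swap₁₂ nolink-t = run (avoid1 G crit on (Adj-sym xy) (here refl) [] (s≤s z≤n))
      where
      c₁ = swapped cZ y b₁ b₂ γ₁ γ₂
      z₁ : cZ y b₁ ≡ just γ₁
      z₁ = trans (cZ-y (bs∉ (here refl) ∘ there)) y₁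
      z₂ : cZ y b₂ ≡ just γ₂
      z₂ = trans (cZ-y (bs∉ (there (here refl)) ∘ there)) y₂
      z₃ : cZ y b₃ ≡ just γ₃
      z₃ = trans (cZ-y (bs∉ (there (there (here refl))) ∘ there)) y₃
      open Swap good-Z z₁ z₂ b₁≢b₂ using (f; f-s; f-s′; f-other; f-has; Good-swapped)
      nolink : ∀ {r a} → r ≢ b₁ → r ≢ b₂ → cZ y r ≡ just a → ¬ Link (off y cZ) γ₂ a b₁ r × ¬ Link (off y cZ) γ₁ a b₂ r
      nolink {r} {a} n₁ n₂ e = go (kind (proj₁ (On.within on-Z e)))
        where
        e′ : r ∉ Z × c y r ≡ just a
        e′ = proj₂ (del-just {D = Z} {c = c} e)
        go : r ∈ bs ⊎ deg r ≡ 3 ⊎ r ∈ Z → ¬ Link (off y cZ) γ₂ a b₁ r × ¬ Link (off y cZ) γ₁ a b₂ r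
        go (inj₁ (here p)) = ⊥-elim (n₁ p)
        go (inj₁ (there (here p))) = ⊥-elim (n₂ p)
        go (inj₁ (there (there (here refl)))) with just-injective (trans (sym e) z₃)
        ... | refl = noLink (miss-off (cZ-miss b₁γ₂)) (miss-off (cZ-miss b₁γ₃)) ,
                     noLink (miss-off (cZ-miss b₂γ₁)) (miss-off (cZ-miss b₂γ₃))
        go (inj₂ (inj₁ dr)) = let (l₁ , l₂) = nolink-t dr (proj₂ e′) in l₁ ∘ Link-mono off-Z , l₂ ∘ Link-mono off-Z
        go (inj₂ (inj₂ r∈)) = ⊥-elim (proj₁ e′ r∈)
      at-b₃ : c₁ y b₃ ≡ just γ₃
      at-b₃ = trans (star-at cZ y f b₃) (trans (f-other (b₁≢b₃ ∘ sym) (b₂≢b₃ ∘ sym)) z₃)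
      ext : Ext γ₂ γ₁ γ₃ (others ++ x ∷ []) c₁
      ext = record { good′ = Good-swapped (cZ-miss b₁γ₂) (cZ-miss b₂γ₁) nolink ; on′ = order (On-swapped on-Z z₁ z₂)
        ; agree = λ p∉ q∉ → trans (star-off cZ y f (λ { refl → p∉ (here refl) }) (λ { refl → q∉ (here refl) })) (agree-Z p∉ q∉)
        ; e₁ = trans (star-at cZ y f b₁) f-s ; e₂ = trans (star-at cZ y f b₂) f-s′ ; e₃ = at-b₃ }
      used : ∀ {b g δ} → c₁ y b ≡ just g → miss c₁ y δ → δ ≢ g
      used e m refl = m _ e
      run : (∃ λ β → β ∉ [] × miss c y β) → ⊥
      -- The colour γ₃ takes no part in the exchange, so its paths from w to b₃ remain available for
      -- putting the vertices of degree 2 back.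
      run (β , _ , yβ) = greedy others ext others-unique others⊆
        (miss-center λ r e → let (v , g) = f-has e in cZ-miss yβ v g)
        (there (there (here refl))) at-b₃ (there (there (here refl))) (K-miss wγ₃) (K-used y₃)
        (λ m _ → proj₂ (proj₂ (known-all (used (Ext.e₂ ext) m) (used (Ext.e₁ ext) m) (used at-b₃ m))))
        done
        where
        done : ∀ {c″} → Ext γ₂ γ₁ γ₃ (x ∷ []) c″ → miss c″ y β → ⊥
        done ext″ yβ″ = uniqueEndᴸ goodK (inj₁ (K-miss wγ₁)) (inj₁ (K-used y₁)) (inj₁ (K-miss b₂γ₁)) b₁≢b₂
          (proj₁ (known-free yβ)) (proj₁ (proj₂ (AtX.links ext″ yβ″)))

  module PivotEnd (G : Graph n) (crit : Critical G) {x w y} (nb : Nbr2 G x w y) (dx : Nbrs.deg G x ≡ 2)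
      {c} (good : Good c) (on : Nbrs.On G (x ∷ []) c)
      (t-unique : ∀ {t t′} → Nbrs.Adj G y t → Nbrs.Adj G y t′ → Nbrs.deg G t ≡ 3 → Nbrs.deg G t′ ≡ 3 → t ≡ t′) where
    open Nbrs G

    K : Colouring
    K = del (y ∷ filter (λ z → deg z ℕ.≟ 2) (nbrs y)) c

    goodK : Good K
    goodK = Good-del _ good

    K-miss : ∀ {p a} → miss c p a → miss K p a
    K-miss = miss-mono {c = K} {c′ = c} (del-⊑ _ c)

    K-used : ∀ {s a} → c y s ≡ just a → miss K s a
    K-used ys v e = let (_ , v∉ , g) = del-just {c = c} e in v∉ (here (Good.proper good g (Good.flip good ys)))

    swap₁₂ : ∀ {b₁ b₂ b₃ γ₁ γ₂ γ₃} → Big3 G c y b₁ b₂ b₃ γ₁ γ₂ γ₃ →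
      (∀ {t τ} → deg t ≡ 3 → c y t ≡ just τ → ¬ Link K γ₂ τ b₁ t × ¬ Link K γ₁ τ b₂ t) → ⊥
    swap₁₂ = Pivot.swap₁₂ G crit nb dx good on t-unique

    saturated : ∀ {b₁ b₂ b₃ γ₁ γ₂ γ₃} → Big3 G c y b₁ b₂ b₃ γ₁ γ₂ γ₃ → miss K b₁ γ₂
    saturated trio = K-miss (Pivot.b₁γ₂ G crit nb dx good on t-unique trio)

    -- An exchange of γ₃ with γ₁ or γ₂ can fail only through a path from b₃ to t, because t misses
    -- γ₃. If the exchange of γ₁ and γ₂ failed as well, t would be joined to b₃ and to b₁ or b₂ in
    -- the same two colours.
    with-t : ∀ {b₁ b₂ b₃ γ₁ γ₂ γ₃ t τ} → Big3 G c y b₁ b₂ b₃ γ₁ γ₂ γ₃ → deg t ≡ 3 → c y t ≡ just τ → miss c t γ₃ → ⊥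
    with-t {b₁} {b₂} {b₃} {γ₁} {γ₂} {γ₃} {t} {τ} trio dt yt tγ₃ =
      swap₁₂ trio λ dt′ yt′ → at-t dt′ yt′
        (λ l → link₂ λ l′ → uniqueEnd goodK tτ (inj₁ (saturated trio)) (inj₁ (saturated (Big3-swap₂₃ (Big3-rotate (Big3-rotate trio))))) b₁≢b₃ (Link-flip l) (Link-flip l′))
        (λ l → link₁ λ l′ → uniqueEnd goodK tτ (inj₁ (saturated (Big3-swap₂₃ (Big3-rotate trio)))) (inj₁ (saturated (Big3-rotate (Big3-rotate trio)))) b₂≢b₃ (Link-flip l) (Link-flip l′))
      where
      open Big3 trio
      tτ : ∀ {γ} → Half K γ τ t
      tτ = inj₂ (K-used yt)
      at-t : ∀ {t′ τ′ γ γ′ b b′} → deg t′ ≡ 3 → c y t′ ≡ just τ′ → ¬ Link K γ τ b t → ¬ Link K γ′ τ b′ t →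
             ¬ Link K γ τ′ b t′ × ¬ Link K γ′ τ′ b′ t′
      at-t dt′ yt′ l l′ with t-unique (proj₁ (On.within on yt′)) (proj₁ (On.within on yt)) dt′ dt
      ... | refl with just-injective (trans (sym yt′) yt)
      ... | refl = l , l′
      link₁ : L K γ₁ τ b₃ t
      link₁ ¬l = swap₁₂ (Big3-swap₂₃ trio) λ dt′ yt′ → at-t dt′ yt′ (noLinkʳ (K-miss tγ₃) (K-used yt)) ¬l
      link₂ : L K γ₂ τ b₃ t
      link₂ ¬l = swap₁₂ (Big3-rotate trio) λ dt′ yt′ → at-t dt′ yt′ (noLinkʳ (K-miss tγ₃) (K-used yt)) ¬l

    -- A vertex t of degree 3 that carries τ misses one of γ₁, γ₂, γ₃, and renumbering makes it γ₃.
    absurd : ∀ {b₁ b₂ b₃ γ₁ γ₂ γ₃} → Big3 G c y b₁ b₂ b₃ γ₁ γ₂ γ₃ → ⊥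
    absurd {b₁} {b₂} {b₃} {γ₁} {γ₂} {γ₃} trio = go (any? λ t → (adj G y t Bool.≟ true) ×-dec (deg t ℕ.≟ 3))
      where
      open Big3 trio
      go : Dec (∃ λ t → Adj y t × deg t ≡ 3) → ⊥
      go (no ¬t) = swap₁₂ trio λ {t} dt yt → ⊥-elim (¬t (t , proj₁ (On.within on yt) , dt))
      go (yes (t , yt-adj , dt)) = coloured (On.covers on yt-adj (λ { (here refl) → Adj-irrefl (Nbr2.xy nb) refl })
          (λ { (here refl) → case trans (sym dt) dx of λ () }))
        where
        coloured : (∃ λ τ → c y t ≡ just τ) → ⊥
        coloured (τ , yt) = pick (has⊎miss c t γ₁) (has⊎miss c t γ₂) (has⊎miss c t γ₃)
          where
          dif : ∀ {p q i j} → p ≢ q → c y p ≡ just i → c y q ≡ just j → i ≢ j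
          dif p≢q e e′ refl = p≢q (Good.proper good e e′)
          t≢ : ∀ {b} → Big b → t ≢ b
          t≢ B refl = ℕ.1+n≰n (subst (4 ≤_) dt B)
          pick : has c t γ₁ ⊎ miss c t γ₁ → has c t γ₂ ⊎ miss c t γ₂ → has c t γ₃ ⊎ miss c t γ₃ → ⊥
          pick _ _ (inj₂ m) = with-t trio dt yt m
          pick _ (inj₂ m) _ = with-t (Big3-swap₂₃ trio) dt yt m
          pick (inj₂ m) _ _ = with-t (Big3-rotate trio) dt yt m
          pick (inj₁ h₁) (inj₁ h₂) (inj₁ h₃) = ℕ.1+n≰n (subst (4 ≤_) dt
            (deg-colours on [] (τ ∷ γ₁ ∷ γ₂ ∷ γ₃ ∷ []) [] []
              ((dif (t≢ B₁) yt y₁ ∷ dif (t≢ B₂) yt y₂ ∷ dif (t≢ B₃) yt y₃ ∷ []) ∷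
               (dif b₁≢b₂ y₁ y₂ ∷ dif b₁≢b₃ y₁ y₃ ∷ []) ∷ (dif b₂≢b₃ y₂ y₃ ∷ []) ∷ [] ∷ [])
              ((y , Good.flip good yt) ∷ h₁ ∷ h₂ ∷ h₃ ∷ [])))

  module _ (G : Graph n) where
    open Nbrs G

    threes : Fin n → ℕ
    threes v = length (filter (λ w → deg w ℕ.≟ 3) (nbrs v))

    pivot : Critical G → ∀ {x w y} → Nbr2 G x w y → deg x ≡ 2 → big y ≤ 3 → 2 ≤ threes y
    pivot crit {x} {w} {y} nb dx le = ℕ.≮⇒≥ λ lt → colour-off G crit (Nbr2.xy nb) λ { (c , good , on) → contra lt good on }
      where
      module _ (lt : threes y < 2) {c} (good : Good c) (on : On (x ∷ []) c) where
        t-unique : ∀ {t t′} → Adj y t → Adj y t′ → deg t ≡ 3 → deg t′ ≡ 3 → t ≡ t′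
        t-unique {t} {t′} yt yt′ dt dt′ with t ≟ t′
        ... | yes e = e
        ... | no ne = contradiction (Unique-length {xs = t ∷ t′ ∷ []} ((ne ∷ []) ∷ [] ∷ []) (λ
            { (here refl) → ∈-filter⁺ (λ w → deg w ℕ.≟ 3) (nbrs⁺ yt) dt
            ; (there (here refl)) → ∈-filter⁺ (λ w → deg w ℕ.≟ 3) (nbrs⁺ yt′) dt′ })) (ℕ.<⇒≱ lt)
        contra : ⊥
        contra = go (filter (λ w → 4 ℕ.≤? deg w) (nbrs y)) refl (Unique.filter⁺ (λ w → 4 ℕ.≤? deg w) (nbrs-unique y))
                   (ℕ.≤-antisym le (three-big G crit nb))
          where
          go : ∀ bs → filter (λ w → 4 ℕ.≤? deg w) (nbrs y) ≡ bs → Unique bs → length (filter (λ w → 4 ℕ.≤? deg w) (nbrs y)) ≡ 3 → ⊥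
          go [] eq _ len with trans (sym (cong length eq)) len
          ... | ()
          go (_ ∷ []) eq _ len with trans (sym (cong length eq)) len
          ... | ()
          go (_ ∷ _ ∷ []) eq _ len with trans (sym (cong length eq)) len
          ... | ()
          go (_ ∷ _ ∷ _ ∷ _ ∷ _) eq _ len with trans (sym (cong length eq)) len
          ... | ()
          go (b₁ ∷ b₂ ∷ b₃ ∷ []) eq ((n₁₂ ∷ n₁₃ ∷ []) ∷ (n₂₃ ∷ []) ∷ _) _ =
            PivotEnd.absurd G crit nb dx good on t-unique trio
            where
            info : ∀ {b} → b ∈ b₁ ∷ b₂ ∷ b₃ ∷ [] → Adj y b × Big b
            info b∈ = let (i , B) = ∈-filter⁻ (λ w → 4 ℕ.≤? deg w) {xs = nbrs y} (subst (_ ∈_) (sym eq) b∈) in nbrs⁻ i , B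
            colour : ∀ {b} → b ∈ b₁ ∷ b₂ ∷ b₃ ∷ [] → ∃ λ g → c y b ≡ just g
            colour b∈ = On.covers on (proj₁ (info b∈)) (λ { (here refl) → Adj-irrefl (Nbr2.xy nb) refl })
              (λ { (here refl) → 4≰2 (subst (4 ≤_) dx (proj₂ (info b∈))) })
              where
              4≰2 : ¬ 4 ≤ 2
              4≰2 (s≤s (s≤s ()))
            i₁ : b₁ ∈ b₁ ∷ b₂ ∷ b₃ ∷ []
            i₁ = here refl
            i₂ : b₂ ∈ b₁ ∷ b₂ ∷ b₃ ∷ []
            i₂ = there (here refl)
            i₃ : b₃ ∈ b₁ ∷ b₂ ∷ b₃ ∷ []
            i₃ = there (there (here refl))
            trio : Big3 G c y b₁ b₂ b₃ (proj₁ (colour i₁)) (proj₁ (colour i₂)) (proj₁ (colour i₃))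
            trio = record { yb₁ = proj₁ (info i₁) ; yb₂ = proj₁ (info i₂) ; yb₃ = proj₁ (info i₃)
              ; B₁ = proj₂ (info i₁) ; B₂ = proj₂ (info i₂) ; B₃ = proj₂ (info i₃)
              ; b₁≢b₂ = n₁₂ ; b₁≢b₃ = n₁₃ ; b₂≢b₃ = n₂₃
              ; bigs = λ ys B → subst (_ ∈_) eq (∈-filter⁺ (λ w → 4 ℕ.≤? deg w) (nbrs⁺ ys) B)
              ; y₁ = proj₂ (colour i₁) ; y₂ = proj₂ (colour i₂) ; y₃ = proj₂ (colour i₃) }

  -- Discharging

  -- Charges are scaled by 6: pay d e h is what a vertex of degree e sends to a neighbour
  -- of degree d, where h records whether that neighbour has a neighbour of degree four.
  pay : ℕ → ℕ → Bool → ℕ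
  pay 2 _ _ = 6
  pay 3 (suc (suc (suc (suc (suc _))))) h = if h then 3 else 2
  pay _ _ _ = 0

  pay-big : ∀ {d} e h → 4 ≤ d → pay d e h ≡ 0
  pay-big {suc (suc (suc (suc _)))} e h _ = refl
  pay-big {0} e h ()
  pay-big {1} e h (s≤s ())
  pay-big {2} e h (s≤s (s≤s ()))
  pay-big {3} e h (s≤s (s≤s (s≤s ())))

  pay-four : ∀ {d} h → d ≢ 2 → pay d 4 h ≡ 0
  pay-four {0} h _ = refl
  pay-four {1} h _ = refl
  pay-four {2} h ne = ⊥-elim (ne refl)
  pay-four {3} h _ = refl
  pay-four {suc (suc (suc (suc _)))} h _ = refl

  pay-half : ∀ {e} → 5 ≤ e → pay 3 e true ≡ 3
  pay-half (s≤s (s≤s (s≤s (s≤s (s≤s _))))) = refl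

  pay-third : ∀ {e} → 5 ≤ e → pay 3 e false ≡ 2
  pay-third (s≤s (s≤s (s≤s (s≤s (s≤s _))))) = refl

  pay-≤3 : ∀ e h → pay 3 e h ≤ 3
  pay-≤3 (suc (suc (suc (suc (suc e))))) true = ℕ.≤-refl
  pay-≤3 (suc (suc (suc (suc (suc e))))) false = ℕ.n≤1+n 2
  pay-≤3 0 h = z≤n
  pay-≤3 1 h = z≤n
  pay-≤3 2 h = z≤n
  pay-≤3 3 h = z≤n
  pay-≤3 4 h = z≤n

  pay-≤2 : ∀ e → pay 3 e false ≤ 2
  pay-≤2 (suc (suc (suc (suc (suc e))))) = ℕ.≤-refl
  pay-≤2 0 = z≤n
  pay-≤2 1 = z≤n
  pay-≤2 2 = z≤n
  pay-≤2 3 = z≤n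
  pay-≤2 4 = z≤n

  module Discharge (G : Graph n) (crit : Critical G) where
    open Nbrs G

    half? : ∀ x → Dec (∃ λ y → Adj x y × deg y ≡ 4)
    half? x = any? λ y → (adj G x y Bool.≟ true) ×-dec (deg y ℕ.≟ 4)

    send : Fin n → Fin n → ℕ
    send v x = pay (deg x) (deg v) (does (half? x))

    send-≤3 : ∀ v x → deg x ≡ 3 → send v x ≤ 3
    send-≤3 v x dx = subst (λ d → pay d (deg v) (does (half? x)) ≤ 3) (sym dx) (pay-≤3 (deg v) (does (half? x)))

    twos : Fin n → ℕ
    twos v = length (filter (λ w → deg w ℕ.≟ 2) (nbrs v))

    module _ (v : Fin n) (q : ℕ) where
      private
        bigL threeL twoL : List (Fin n) → ℕ
        bigL xs = length (filter (λ w → 4 ℕ.≤? deg w) xs)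
        threeL xs = length (filter (λ w → deg w ℕ.≟ 3) xs)
        twoL xs = length (filter (λ w → deg w ℕ.≟ 2) xs)

      partition : ∀ xs → (∀ {x} → x ∈ xs → 2 ≤ deg x) → (∀ {x} → x ∈ xs → deg x ≡ 3 → send v x ≤ q) →
        length xs ≡ bigL xs + threeL xs + twoL xs × ∑ xs (send v) ≤ 6 * twoL xs + q * threeL xs
      partition [] _ _ = refl , z≤n
      partition (x ∷ xs) ge le with partition xs (ge ∘ there) (le ∘ there) | ge (here refl) | le {x} (here refl)
      ... | len , bound | gex | lex = go (deg x) refl
        where
        open ℕ.≤-Reasoning
        go : ∀ d → deg x ≡ d → length (x ∷ xs) ≡ bigL (x ∷ xs) + threeL (x ∷ xs) + twoL (x ∷ xs) ×
                               ∑ (x ∷ xs) (send v) ≤ 6 * twoL (x ∷ xs) + q * threeL (x ∷ xs)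
        go 0 e = ⊥-elim (ℕ.n≮0 (subst (2 ≤_) e gex))
        go 1 e = ⊥-elim (ℕ.1+n≰n (subst (2 ≤_) e gex))
        go 2 e rewrite e = trans (cong suc len) (sym (ℕ.+-suc _ _)) , (begin
          6 + ∑ xs (send v) ≤⟨ ℕ.+-monoʳ-≤ 6 bound ⟩
          6 + (6 * twoL xs + q * threeL xs) ≡⟨ sym (ℕ.+-assoc 6 (6 * twoL xs) _) ⟩
          6 + 6 * twoL xs + q * threeL xs ≡⟨ cong (_+ q * threeL xs) (sym (ℕ.*-suc 6 (twoL xs))) ⟩
          6 * suc (twoL xs) + q * threeL xs ∎)
        go 3 e with lex e
        ... | l rewrite e = trans (cong suc len) (cong (_+ twoL xs) (sym (ℕ.+-suc (bigL xs) (threeL xs)))) , (begin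
          pay 3 (deg v) (does (half? x)) + ∑ xs (send v) ≤⟨ ℕ.+-mono-≤ l bound ⟩
          q + (6 * twoL xs + q * threeL xs) ≡⟨ solve 3 (λ a b c → a :+ (b :+ c) := b :+ (a :+ c)) refl q (6 * twoL xs) _ ⟩
          6 * twoL xs + (q + q * threeL xs) ≡⟨ cong (6 * twoL xs +_) (sym (ℕ.*-suc q (threeL xs))) ⟩
          6 * twoL xs + q * suc (threeL xs) ∎)
          where open +-*-Solver
        go (suc (suc (suc (suc d)))) e rewrite e = cong suc len , bound

    deg-nbr : ∀ {v x} → Adj v x → 2 ≤ deg x
    deg-nbr vx = noLeaf G crit (Adj-sym vx)

    counts : ∀ v → deg v ≡ big v + threes G v + twos v
    counts v = proj₁ (partition v 3 (nbrs v) (λ i → deg-nbr (nbrs⁻ i)) λ {x} _ → send-≤3 v x)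

    out in′ : Fin n → ℕ
    out v = ∑ (nbrs v) (send v)
    in′ v = ∑ (nbrs v) (λ x → send x v)

    out-≤ : ∀ v q → (∀ {x} → Adj v x → deg x ≡ 3 → send v x ≤ q) → out v ≤ 6 * twos v + q * threes G v
    out-≤ v q le = proj₂ (partition v q (nbrs v) (λ i → deg-nbr (nbrs⁻ i)) (λ i → le (nbrs⁻ i)))

    out-≤3 : ∀ v → out v ≤ 6 * twos v + 3 * threes G v
    out-≤3 v = out-≤ v 3 λ {x} _ → send-≤3 v x

    out-0 : ∀ v → (∀ {x} → Adj v x → send v x ≡ 0) → out v ≡ 0
    out-0 v h = ℕ.n≤0⇒n≡0 (ℕ.≤-trans (∑-mono (nbrs v) λ i → ℕ.≤-reflexive (h (nbrs⁻ i))) (ℕ.≤-reflexive (∑-0 (nbrs v))))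

    has-two : ∀ {v x} → Adj v x → deg x ≡ 2 → 8 ≤ 2 * big v + threes G v
    has-two {v} {x} vx dx with 4 ℕ.≤? big v
    ... | yes le = ℕ.≤-trans (ℕ.*-monoʳ-≤ 2 le) (ℕ.m≤m+n _ _)
    ... | no gt = ℕ.+-mono-≤ (ℕ.*-monoʳ-≤ 2 (three-big G crit nb)) (pivot G crit nb dx (ℕ.≤-pred (ℕ.≰⇒> gt)))
      where nb = proj₂ (nbr2 G dx (Adj-sym vx))

    half-sender : ∀ {v x} → 5 ≤ deg v → Adj v x → deg x ≡ 3 → (∃ λ y → Adj x y × deg y ≡ 4) → HalfOK G v
    half-sender {v} {x} dv vx dx (y , xy , dy) with nbr3 G dx xy
    ... | u , u′ , nb with Nbr3.only nb (Adj-sym vx)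
    ... | inj₁ refl = ⊥-elim (ℕ.1+n≰n (subst (5 ≤_) dy dv))
    ... | inj₂ (inj₁ refl) = half-nbr G crit nb dy
    ... | inj₂ (inj₂ refl) = half-nbr G crit (Nbr3-swap G nb) dy

    balance-2 : ∀ {v} → deg v ≡ 2 → 24 + out v ≤ 6 * deg v + in′ v
    balance-2 {v} dv = begin
      24 + out v ≡⟨ cong (24 +_) (out-0 v λ vx → pay-big (deg v) _ (nbr-of-2 G crit dv vx)) ⟩
      6 * 2 + 6 * 2 ≡⟨ cong₂ (λ a b → 6 * a + 6 * b) (sym dv) (sym dv) ⟩
      6 * deg v + 6 * deg v ≡⟨ cong (6 * deg v +_) (sym (∑-const (nbrs v) 6)) ⟩
      6 * deg v + ∑ (nbrs v) (λ _ → 6) ≤⟨ ℕ.+-monoʳ-≤ (6 * deg v) (∑-mono (nbrs v) λ {x} _ →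
         ℕ.≤-reflexive (cong (λ d → pay d (deg x) (does (half? v))) (sym dv))) ⟩
      6 * deg v + in′ v ∎
      where open ℕ.≤-Reasoning

    -- Either one neighbour has degree 4 and the two others give 3 each, or all three have degree at
    -- least 5 and give 2 each.
    in-3 : ∀ {v} → deg v ≡ 3 → 6 ≤ in′ v
    in-3 {v} dv = go (half? v) refl
      where
      sent : ∀ x {h} → does (half? v) ≡ h → pay 3 (deg x) h ≡ send x v
      sent x e = cong₂ (λ d h → pay d (deg x) h) (sym dv) (sym e)
      go : (h : Dec (∃ λ y → Adj v y × deg y ≡ 4)) → half? v ≡ h → 6 ≤ in′ v
      go (yes (y , vy , dy)) e with nbr3 G dv vy
      ... | u , u′ , nb = ℕ.≤-trans (ℕ.≤-reflexive (cong₂ _+_ (to u (proj₁ (half-nbr G crit nb dy)))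
          (to u′ (proj₁ (half-nbr G crit (Nbr3-swap G nb) dy)))))
          (∑-two {f = λ x → send x v} (nbrs⁺ (Nbr3.xu nb)) (nbrs⁺ (Nbr3.xv nb)) (Nbr3.u≢v nb))
        where
        to : ∀ x → 5 ≤ deg x → 3 ≡ send x v
        to x le = trans (sym (pay-half le)) (sent x (cong does e))
      go (no ¬y) e = ℕ.≤-trans (ℕ.≤-reflexive (trans (cong (2 *_) (sym dv)) (sym (∑-const (nbrs v) 2))))
        (∑-mono (nbrs v) λ {x} i → ℕ.≤-reflexive (trans (sym (pay-third (five (nbrs⁻ i)))) (sent x (cong does e))))
        where
        five : ∀ {x} → Adj v x → 5 ≤ deg x
        five {x} vx = ℕ.≤∧≢⇒< (nbr-of-3 G crit (proj₂ (proj₂ (nbr3 G dv vx)))) λ d → ¬y (x , vx , sym d)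

    balance-3 : ∀ {v} → deg v ≡ 3 → 24 + out v ≤ 6 * deg v + in′ v
    balance-3 {v} dv = begin
      24 + out v ≡⟨ cong (24 +_) (out-0 v λ vx → pay-big (deg v) _ (nbr-of-3 G crit (proj₂ (proj₂ (nbr3 G dv vx))))) ⟩
      6 * 3 + 6 ≡⟨ cong (λ a → 6 * a + 6) (sym dv) ⟩
      6 * deg v + 6 ≤⟨ ℕ.+-monoʳ-≤ (6 * deg v) (in-3 dv) ⟩
      6 * deg v + in′ v ∎
      where open ℕ.≤-Reasoning

    balance-4 : ∀ {v} → deg v ≡ 4 → 24 + out v ≤ 6 * deg v + in′ v
    balance-4 {v} dv = begin
      24 + out v ≡⟨ cong (24 +_) (out-0 v λ {x} vx → subst (λ d → pay (deg x) d (does (half? x)) ≡ 0) (sym dv)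
                                   (pay-four _ (no-two vx))) ⟩
      6 * 4 ≡⟨ cong (6 *_) (sym dv) ⟩
      6 * deg v ≤⟨ ℕ.m≤m+n _ _ ⟩
      6 * deg v + in′ v ∎
      where
      open ℕ.≤-Reasoning
      no-two : ∀ {x} → Adj v x → deg x ≢ 2
      -- A neighbour of degree 2 would give 8 ≤ 2b + t ≤ 2(b + t), although b + t is at most 3.
      no-two {x} vx dx = ℕ.<⇒≱ (s≤s (ℕ.≤-refl {8})) (begin
        9 ≤⟨ s≤s (has-two vx dx) ⟩
        1 + (2 * big v + threes G v) ≤⟨ s≤s (ℕ.+-monoʳ-≤ (2 * big v) (ℕ.m≤m+n (threes G v) (threes G v + 0))) ⟩
        1 + (2 * big v + 2 * threes G v) ≤⟨ ℕ.n≤1+n _ ⟩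
        2 + (2 * big v + 2 * threes G v) ≤⟨ ℕ.+-monoˡ-≤ (2 * big v + 2 * threes G v) (ℕ.*-monoʳ-≤ 2 one) ⟩
        2 * twos v + (2 * big v + 2 * threes G v) ≡⟨ solve 3 (λ t b h → con 2 :* t :+ (con 2 :* b :+ con 2 :* h) := con 2 :* (b :+ h :+ t)) refl (twos v) (big v) (threes G v) ⟩
        2 * (big v + threes G v + twos v) ≡⟨ cong (2 *_) (trans (sym (counts v)) dv) ⟩
        8 ∎)
        where
        open +-*-Solver
        one : 1 ≤ twos v
        one = Unique-length {xs = x ∷ []} ([] ∷ []) λ { (here refl) → ∈-filter⁺ (λ w → deg w ℕ.≟ 2) (nbrs⁺ vx) dx }

    balance-5 : ∀ {v} → 5 ≤ deg v → 24 + out v ≤ 6 * deg v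
    balance-5 {v} dv with any? (λ x → (adj G v x Bool.≟ true) ×-dec (deg x ℕ.≟ 2))
    -- Three times the inequality 8 ≤ 2b + t pays for the constant 24.
    ... | yes (x , vx , dx) = begin
      24 + out v ≤⟨ ℕ.+-mono-≤ (ℕ.*-monoʳ-≤ 3 (has-two vx dx)) (out-≤3 v) ⟩
      3 * (2 * big v + threes G v) + (6 * twos v + 3 * threes G v)
        ≡⟨ solve 3 (λ b h t → con 3 :* (con 2 :* b :+ h) :+ (con 6 :* t :+ con 3 :* h) := con 6 :* (b :+ h :+ t)) refl (big v) (threes G v) (twos v) ⟩
      6 * (big v + threes G v + twos v) ≡⟨ cong (6 *_) (sym (counts v)) ⟩
      6 * deg v ∎
      where
      open ℕ.≤-Reasoning
      open +-*-Solver
    ... | no ¬two = rest (any? (λ x → (adj G v x Bool.≟ true) ×-dec (deg x ℕ.≟ 3) ×-dec half? x))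
      where
      open ℕ.≤-Reasoning
      open +-*-Solver
      b = big v
      t = threes G v
      no-twos : twos v ≡ 0
      no-twos with filter (λ w → deg w ℕ.≟ 2) (nbrs v) in eq
      ... | [] = refl
      ... | x ∷ xs = let (i , dx) = ∈-filter⁻ (λ w → deg w ℕ.≟ 2) {xs = nbrs v} (subst (x ∈_) (sym eq) (here refl))
                     in ⊥-elim (¬two (x , nbrs⁻ i , dx))
      deg-bt : deg v ≡ b + t
      deg-bt = trans (counts v) (trans (cong (b + t +_) no-twos) (ℕ.+-identityʳ _))
      pays : ∀ q → (∀ {x} → Adj v x → deg x ≡ 3 → send v x ≤ q) → out v ≤ q * t
      pays q le = ℕ.≤-trans (out-≤ v q le) (ℕ.≤-reflexive (cong (λ m → 6 * m + q * t) no-twos))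
      by-deg : ∀ {q} → out v ≤ q * t → 24 + q * t ≤ 6 * (b + t) → 24 + out v ≤ 6 * deg v
      by-deg {q} le le′ = begin
        24 + out v ≤⟨ ℕ.+-monoʳ-≤ 24 le ⟩
        24 + q * t ≤⟨ le′ ⟩
        6 * (b + t) ≡⟨ cong (6 *_) (sym deg-bt) ⟩
        6 * deg v ∎
      rest : Dec (∃ λ x → Adj v x × deg x ≡ 3 × (∃ λ y → Adj x y × deg y ≡ 4)) → 24 + out v ≤ 6 * deg v
      rest (yes (x , vx , dx , h)) = by-deg {3} (pays 3 λ {x} _ → send-≤3 v x)
          (count (half-sender dv vx dx h))
        where
        -- 24 + 3t ≤ 6(b + t) iff 8 ≤ 2b + t = b + deg v.
        enough : 8 ≤ b + deg v → 24 + 3 * t ≤ 6 * (b + t)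
        enough le = begin
          24 + 3 * t ≤⟨ ℕ.+-monoˡ-≤ (3 * t) (ℕ.*-monoʳ-≤ 3 le) ⟩
          3 * (b + deg v) + 3 * t ≡⟨ cong (λ d → 3 * (b + d) + 3 * t) deg-bt ⟩
          3 * (b + (b + t)) + 3 * t ≡⟨ solve 2 (λ b t → con 3 :* (b :+ (b :+ t)) :+ con 3 :* t := con 6 :* (b :+ t)) refl b t ⟩
          6 * (b + t) ∎
        count : HalfOK G v → 24 + 3 * t ≤ 6 * (b + t)
        count (_ , b≥2 , five) = split (deg v ℕ.≟ 5)
          where
          split : Dec (deg v ≡ 5) → 24 + 3 * t ≤ 6 * (b + t)
          split (yes e) = enough (ℕ.+-mono-≤ (five e) dv)
          split (no ne) = enough (ℕ.+-mono-≤ b≥2 (ℕ.≤∧≢⇒< dv (ne ∘ sym)))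
      rest (no ¬half) = by-deg {2} (pays 2 third)
          (count (deg v ℕ.≟ 5) (any? λ x → (adj G v x Bool.≟ true) ×-dec (deg x ℕ.≟ 3)))
        where
        third : ∀ {x} → Adj v x → deg x ≡ 3 → send v x ≤ 2
        third {x} vx dx with half? x
        ... | yes h = ⊥-elim (¬half (x , vx , dx , h))
        ... | no _ = subst (λ d → pay d (deg v) false ≤ 2) (sym dx) (pay-≤2 (deg v))
        -- 24 + 2t ≤ 6(b + t) iff 12 ≤ 3b + 2t = b + 2 deg v.
        enough : 12 ≤ b + 2 * deg v → 24 + 2 * t ≤ 6 * (b + t)
        enough le = begin
          24 + 2 * t ≤⟨ ℕ.+-monoˡ-≤ (2 * t) (ℕ.*-monoʳ-≤ 2 le) ⟩
          2 * (b + 2 * deg v) + 2 * t ≡⟨ cong (λ d → 2 * (b + 2 * d) + 2 * t) deg-bt ⟩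
          2 * (b + 2 * (b + t)) + 2 * t ≡⟨ solve 2 (λ b t → con 2 :* (b :+ con 2 :* (b :+ t)) :+ con 2 :* t := con 6 :* (b :+ t)) refl b t ⟩
          6 * (b + t) ∎
        no-threes : ¬ (∃ λ x → Adj v x × deg x ≡ 3) → t ≡ 0
        no-threes ¬three with filter (λ w → deg w ℕ.≟ 3) (nbrs v) in eq
        ... | [] = refl
        ... | x ∷ xs = let (i , dx) = ∈-filter⁻ (λ w → deg w ℕ.≟ 3) {xs = nbrs v} (subst (x ∈_) (sym eq) (here refl))
                       in ⊥-elim (¬three (x , nbrs⁻ i , dx))
        count : Dec (deg v ≡ 5) → Dec (∃ λ x → Adj v x × deg x ≡ 3) → 24 + 2 * t ≤ 6 * (b + t)
        count (no ne) _ = enough (ℕ.≤-trans (ℕ.*-monoʳ-≤ 2 (ℕ.≤∧≢⇒< dv (ne ∘ sym))) (ℕ.m≤n+m _ b))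
        count (yes e) (yes (x , vx , dx)) = enough (ℕ.+-mono-≤ (five-nbr G crit (proj₂ (proj₂ (nbr3 G dx (Adj-sym vx)))) e) (ℕ.*-monoʳ-≤ 2 dv))
        -- Without neighbours of degree 3 all five are big, so b = 5 more than covers the 2 that is
        -- wanted.
        count (yes e) (no ¬three) = enough (ℕ.≤-trans (ℕ.+-mono-≤ {2} {5} (s≤s (s≤s z≤n)) (ℕ.*-monoʳ-≤ 2 dv))
          (ℕ.+-monoˡ-≤ (2 * deg v) (ℕ.≤-reflexive
            (trans (sym e) (trans deg-bt (trans (cong (b +_) (no-threes ¬three)) (ℕ.+-identityʳ b)))))))

    -- Isolated vertices have no charge and would lower the average, so they are left out of the
    -- dense subgraph.
    active : Fin n → Bool
    active v = not (does (deg v ℕ.≟ 0))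

    balance : ∀ v → 24 * bit (active v) + out v ≤ 6 * deg v + in′ v
    balance v = go (deg v) refl
      where
      activated : ∀ {d} → deg v ≡ suc d → 24 + out v ≤ 6 * deg v + in′ v → 24 * bit (active v) + out v ≤ 6 * deg v + in′ v
      activated e le = subst (λ b → 24 * bit b + out v ≤ 6 * deg v + in′ v) (sym (cong (λ d → not (does (d ℕ.≟ 0))) e)) le
      go : ∀ d → deg v ≡ d → 24 * bit (active v) + out v ≤ 6 * deg v + in′ v
      go 0 e = isolated (nbrs v) e
        where
        isolated : ∀ xs → length xs ≡ 0 → 24 * bit (not (does (length xs ℕ.≟ 0))) + ∑ xs (send v) ≤ 6 * length xs + ∑ xs (λ x → send x v)
        isolated [] _ = z≤n
      go 1 e = ⊥-elim (lonely (nbrs v) refl e)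
        where
        lonely : ∀ xs → nbrs v ≡ xs → length xs ≡ 1 → ⊥
        lonely (x ∷ []) eq _ = ℕ.1+n≰n (subst (2 ≤_) e (noLeaf G crit (nbrs⁻ {v} {x} (subst (x ∈_) (sym eq) (here refl)))))
      go 2 e = activated e (balance-2 e)
      go 3 e = activated e (balance-3 e)
      go 4 e = activated e (balance-4 e)
      go (suc (suc (suc (suc (suc d))))) e = activated e
          (ℕ.≤-trans (balance-5 (subst (5 ≤_) (sym e) (s≤s (s≤s (s≤s (s≤s (s≤s z≤n))))))) (ℕ.m≤m+n _ _))

    V : List (Fin n)
    V = allFin n

    out≡in : ∑ V out ≡ ∑ V in′
    out≡in = begin
      ∑ V out ≡⟨ ∑-cong V (λ v → ∑-filter (λ w → adj G v w Bool.≟ true) V (send v)) ⟩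
      ∑ V (λ v → ∑ V (λ x → if does (adj G v x Bool.≟ true) then send v x else 0)) ≡⟨ ∑-swap V V _ ⟩
      ∑ V (λ x → ∑ V (λ v → if does (adj G v x Bool.≟ true) then send v x else 0))
        ≡⟨ ∑-cong V (λ x → ∑-cong V λ v → cong (λ b → if does (b Bool.≟ true) then send v x else 0) (adj-sym G v x)) ⟩
      ∑ V (λ x → ∑ V (λ v → if does (adj G x v Bool.≟ true) then send v x else 0))
        ≡⟨ ∑-cong V (λ x → sym (∑-filter (λ w → adj G x w Bool.≟ true) V (λ v → send v x))) ⟩
      ∑ V in′ ∎
      where open ≡-Reasoning

    total : 24 * ∑ V (bit ∘ active) ≤ 6 * ∑ V deg
    total = ℕ.+-cancelʳ-≤ (∑ V out) _ _ (begin
      24 * ∑ V (bit ∘ active) + ∑ V out ≡⟨ cong (_+ ∑ V out) (sym (∑-* V 24 (bit ∘ active))) ⟩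
      ∑ V (λ v → 24 * bit (active v)) + ∑ V out ≡⟨ sym (∑-+ V _ out) ⟩
      ∑ V (λ v → 24 * bit (active v) + out v) ≤⟨ ∑-mono V (λ {v} _ → balance v) ⟩
      ∑ V (λ v → 6 * deg v + in′ v) ≡⟨ ∑-+ V _ in′ ⟩
      ∑ V (λ v → 6 * deg v) + ∑ V in′ ≡⟨ cong₂ _+_ (∑-* V 6 deg) (sym out≡in) ⟩
      6 * ∑ V deg + ∑ V out ∎)
      where open ℕ.≤-Reasoning

    active-end : ∀ {u v} → Adj u v → active u ≡ true
    active-end {u} {v} uv = go (deg u) (deg-≥ {us = v ∷ []} ([] ∷ []) (uv ∷ []))
      where
      go : ∀ d → 1 ≤ d → not (does (d ℕ.≟ 0)) ≡ true
      go (suc d) _ = refl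

    H : Subgraph G
    H = record { S = tabulate active ; F = adj G ; F-sym = adj-sym G ; F-sub = λ _ _ e → e
      ; F-inside = λ u v e → inside e , inside (Adj-sym e) }
      where
      inside : ∀ {u v} → Adj u v → u Subset.∈ tabulate active
      inside {u} e = lookup⇒[]= u (tabulate active) (trans (lookup∘tabulate active u) (active-end e))

    not-sparse : madLessThan4 G → ∀ {u v} → Adj u v → ⊥
    not-sparse mad {u} {v} uv = ℕ.<⇒≱ (mad H nonempty) (ℕ.*-cancelˡ-≤ 6 (begin
      6 * (4 * ∣ tabulate active ∣) ≡⟨ cong (λ s → 6 * (4 * s)) (∣tabulate∣ active) ⟩
      6 * (4 * ∑ V (bit ∘ active)) ≡⟨ sym (ℕ.*-assoc 6 4 (∑ V (bit ∘ active))) ⟩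
      24 * ∑ V (bit ∘ active) ≤⟨ total ⟩
      6 * ∑ V deg ≡⟨ cong (6 *_) (trans (∑-cong V deg≡degree) (degree-sum G)) ⟩
      6 * (2 * edgeCount (adj G)) ∎))
      where
      open ℕ.≤-Reasoning
      nonempty : 1 ≤ ∣ tabulate active ∣
      nonempty = begin
        1 ≤⟨ s≤s z≤n ⟩
        1 + 1 ≡⟨ cong₂ (λ a b → bit a + bit b) (sym (active-end uv)) (sym (active-end (Adj-sym uv))) ⟩
        bit (active u) + bit (active v) ≤⟨ ∑-two {f = bit ∘ active} (∈-allFin u) (∈-allFin v) (Adj-irrefl uv) ⟩
        ∑ V (bit ∘ active) ≡⟨ sym (∣tabulate∣ active) ⟩
        ∣ tabulate active ∣ ∎

  -- Minimal counterexamples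

  module _ (G : Graph n) (x y : Fin n) where
    opaque
      edge? : ∀ u v → Dec ((u ≡ x × v ≡ y) ⊎ (u ≡ y × v ≡ x))
      edge? u v = (u ≟ x ×-dec v ≟ y) ⊎-dec (u ≟ y ×-dec v ≟ x)

    minus : Graph n
    minus = record
      { adj = λ u v → adj G u v ∧ not (does (edge? u v))
      ; sym = λ u v → cong₂ (λ a b → a ∧ not b) (adj-sym G u v) (does-sym (edge? u v) (edge? v u))
      ; irrefl = λ v → cong (_∧ not (does (edge? v v))) (adj-irrefl G v) }
      where
      turn : ∀ {u v} → (u ≡ x × v ≡ y) ⊎ (u ≡ y × v ≡ x) → (v ≡ x × u ≡ y) ⊎ (v ≡ y × u ≡ x)
      turn (inj₁ (p , q)) = inj₂ (q , p)
      turn (inj₂ (p , q)) = inj₁ (q , p)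
      does-sym : ∀ {u v} (d : Dec ((u ≡ x × v ≡ y) ⊎ (u ≡ y × v ≡ x))) (d′ : Dec ((v ≡ x × u ≡ y) ⊎ (v ≡ y × u ≡ x))) → does d ≡ does d′
      does-sym (yes _) (yes _) = refl
      does-sym (no _) (no _) = refl
      does-sym (yes p) (no q) = ⊥-elim (q (turn p))
      does-sym (no p) (yes q) = ⊥-elim (p (turn q))

    minus⇒adj : ∀ {u v} → adj minus u v ≡ true → adj G u v ≡ true
    minus⇒adj {u} {v} e with adj G u v
    ... | true = refl

    minus⇒≢ : ∀ {u v} → adj minus u v ≡ true → ¬ ((u ≡ x × v ≡ y) ⊎ (u ≡ y × v ≡ x))
    minus⇒≢ {u} {v} e p with adj G u v | edge? u v
    minus⇒≢ () p | true | yes _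
    ... | true | no ¬p = ¬p p

    adj⇒minus : ∀ {u v} → adj G u v ≡ true → ¬ ((u ≡ x × v ≡ y) ⊎ (u ≡ y × v ≡ x)) → adj minus u v ≡ true
    adj⇒minus {u} {v} e ¬p with edge? u v
    ... | yes p = ⊥-elim (¬p p)
    ... | no _ = cong (_∧ true) e

  ∑-strict : ∀ {xs : List (Fin n)} {f g : Fin n → ℕ} {a} → (∀ x → f x ≤ g x) → a ∈ xs → f a < g a → ∑ xs f < ∑ xs g
  ∑-strict {x ∷ xs} le (here refl) lt = ℕ.+-mono-<-≤ lt (∑-mono xs λ {x} _ → le x)
  ∑-strict {x ∷ xs} le (there i) lt = ℕ.+-mono-≤-< (le x) (∑-strict le i lt)

  empty : Colouring
  empty _ _ = nothing

  Good-empty : Good empty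
  Good-empty = record { symm = λ _ _ → refl ; loopless = λ _ → refl ; proper = λ ()
    ; acyclic = λ S _ cl w w∈ → case proj₂ (proj₂ (proj₁ (cl w w∈))) of λ () }

  -- Induction on the sum of the degrees. If no colouring existed, G would be critical; discharging
  -- rules this out when there is an edge, and otherwise `empty` is a colouring.
  colourable : ∀ m (G : Graph n) {Δ} → k ≡ 2 + Δ → (∀ v → Nbrs.deg G v ≤ Δ) → madLessThan4 G →
    ∑ (allFin n) (Nbrs.deg G) < m → ¬ ¬ (Σ Colouring λ c → Good c × Nbrs.On G [] c)
  colourable zero G _ _ _ () _
  colourable (suc m) G {Δ} k≡ deg≤ mad (s≤s size) none! =
    case any? (λ u → any? λ v → adj G u v Bool.≟ true) of λ
      { (yes (u , v , uv)) → Discharge.not-sparse G crit mad uv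
      ; (no ¬e) → none! (empty , Good-empty , record { covers = λ {u} {v} e _ _ → ⊥-elim (¬e (u , v , e)) ; within = λ () }) }
    where
    open Nbrs G
    module _ {x y : Fin n} (xy : Adj x y) where
      G′ : Graph n
      G′ = minus G x y
      module N = Nbrs G′
      deg-≤ : ∀ v → N.deg v ≤ deg v
      deg-≤ v = Unique-length (N.nbrs-unique v) λ i → nbrs⁺ (minus⇒adj G x y (N.nbrs⁻ i))
      deg-< : N.deg x < deg x
      deg-< = Unique-length {xs = y ∷ N.nbrs x}
        (All.tabulate (λ {z} z∈ e → minus⇒≢ G x y (N.nbrs⁻ z∈) (inj₁ (refl , sym e))) ∷ N.nbrs-unique x)
        λ { (here refl) → nbrs⁺ xy ; (there i) → nbrs⁺ (minus⇒adj G x y (N.nbrs⁻ i)) }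
      mad′ : madLessThan4 G′
      mad′ H = mad (record { S = Subgraph.S H ; F = Subgraph.F H ; F-sym = F-sym H ; F-inside = F-inside H
                           ; F-sub = λ u v e → minus⇒adj G x y (F-sub H u v e) })
      to-minus : ∀ {c} → N.On [] c → Minus G x y c
      to-minus on = record
        { covers = λ e ¬p ¬q → N.On.covers on (adj⇒minus G x y e [ ¬p , ¬q ]′) (λ ()) (λ ())
        ; within = λ e → minus⇒adj G x y (proj₁ (N.On.within on e)) }
      smaller : ¬ ¬ (Σ Colouring λ c → Good c × Minus G x y c)
      smaller no! = colourable m G′ k≡ (λ v → ℕ.≤-trans (deg-≤ v) (deg≤ v)) mad′
        (ℕ.<-≤-trans (∑-strict deg-≤ (∈-allFin x) deg-<) size)
        λ { (c , good , on) → no! (c , good , to-minus on) }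
    crit : Critical G
    crit = record { Δ = Δ ; k≡ = k≡ ; deg≤ = deg≤ ; noCol = λ good on → none! (_ , good , on) ; minimal = smaller }

  -- The argument above is by contradiction; since validity of a colouring is decidable,
  -- one is then found by exhaustive search.

  Searchable : Set → Set₁
  Searchable A = ∀ {P : A → Set} → (∀ a → Dec (P a)) → Dec (∃ P)

  search-Vec : ∀ {A m} → Searchable A → Searchable (Vec A m)
  search-Vec {m = zero} s P? = map′ (λ p → [] , p) (λ { ([] , p) → p }) (P? [])
  search-Vec {m = suc m} s P? = map′ (λ (a , v , p) → a ∷ v , p) (λ { (a ∷ v , p) → a , v , p })
    (s λ a → search-Vec {m = m} s λ v → P? (a ∷ v))

  -- Decidable validity and cycles given as lists.

  module Extract (G : Graph n) where
    open Nbrs G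

    -- Candidates are matrices, so that the search needs no extensionality of functions.
    colour : Vec (Vec (Fin k) n) n → Fin n → Fin n → Fin k
    colour M u v = lookup (lookup M u) v

    Step : (Fin n → Fin n → Fin k) → Subset n → Fin k → Fin n → Set
    Step col S a w = ∃ λ w′ → w′ Subset.∈ S × Adj w w′ × col w w′ ≡ a

    Closed : (Fin n → Fin n → Fin k) → Fin k → Fin k → Subset n → Set
    Closed col a b S = Subset.Nonempty S × (∀ w → w Subset.∈ S → Step col S a w × Step col S b w)

    -- Acyclicity is tested on vertex subsets, of which there are finitely many, rather than on
    -- lists.
    Valid : (Fin n → Fin n → Fin k) → Set
    Valid col = IsProper G col × (∀ a b → a ≢ b → ¬ ∃ (Closed col a b))

    adj? : ∀ u v → Dec (Adj u v)
    adj? u v = adj G u v Bool.≟ true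

    valid? : ∀ col → Dec (Valid col)
    valid? col =
      ((all? λ u → all? λ v → adj? u v →-dec (col u v ≟ col v u)) ×-dec
       (all? λ u → all? λ v → all? λ w → adj? u v →-dec (adj? u w →-dec (¬? (v ≟ w) →-dec ¬? (col u v ≟ col u w))))) ×-dec
      (all? λ a → all? λ b → ¬? (a ≟ b) →-dec ¬? (anySubset? λ S →
        Subset.nonempty? S ×-dec (all? λ w → (w Subset.∈? S) →-dec (step? S a w ×-dec step? S b w))))
      where
      step? : ∀ S a w → Dec (Step col S a w)
      step? S a w = any? λ w′ → (w′ Subset.∈? S) ×-dec (adj? w w′ ×-dec (col w w′ ≟ a))

    good⇒valid : Fin k → (Σ Colouring λ c → Good c × On [] c) → ∃ λ M → Valid (colour M)
    good⇒valid d (c , good , on) = M , ((λ u v e → just-injective (trans (sym (at e)) (trans (symm u v) (at (Adj-sym e))))) ,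
        (λ u v w e e′ ne q → ne (proper (at e) (trans (at e′) (cong just (sym q)))))) ,
        λ { a b a≢b (S , (w , w∈) , cl) → acyclic (Subset._∈ S) a≢b (λ w w∈ → let (α , β) = cl w w∈ in up α , up β) w w∈ }
      where
      open Good good
      M : Vec (Vec (Fin k) n) n
      -- The default d only fills pairs that are not edges.
      M = tabulate λ u → tabulate λ v → fromMaybe d (c u v)
      at : ∀ {u v} → Adj u v → c u v ≡ just (colour M u v)
      at {u} {v} e with On.covers on e (λ ()) (λ ())
      ... | a , g = trans g (cong just (sym (begin
        lookup (lookup M u) v ≡⟨ cong (λ r → lookup r v) (lookup∘tabulate (λ u → tabulate λ v → fromMaybe d (c u v)) u) ⟩
        lookup (tabulate λ v → fromMaybe d (c u v)) v ≡⟨ lookup∘tabulate (λ v → fromMaybe d (c u v)) v ⟩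
        fromMaybe d (c u v) ≡⟨ cong (fromMaybe d) g ⟩
        a ∎)))
        where open ≡-Reasoning
      up : ∀ {S a w} → Step (colour M) S a w → NbrIn c (Subset._∈ S) a w
      up (w′ , w′∈ , e , refl) = w′ , w′∈ , at e

    module _ {col : Fin n → Fin n → Fin k} (col-sym : ∀ u v → Adj u v → col u v ≡ col v u)
             (col-inj : ∀ u v w → Adj u v → Adj u w → v ≢ w → col u v ≢ col u w) (a b : Fin k) where

      R : Fin n → Fin n → Set
      R u v = Adj u v × (col u v ≡ a ⊎ col u v ≡ b)

      R-sym : ∀ {u v} → R u v → R v u
      R-sym {u} {v} (e , q) = Adj-sym e , Data.Sum.map (trans (sym (col-sym u v e))) (trans (sym (col-sym u v e))) q

      Path : List (Fin n × Fin n) → Set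
      Path = All (λ e → R (proj₁ e) (proj₂ e))

      Two : List (Fin n) → Fin n → Set
      Two vs w = ∃₂ λ p s → p ≢ s × p ∈ vs × s ∈ vs × R w p × R w s

      last-edge : ∀ {first} cur rest → Path (cycleEdgesAux first (cur ∷ rest)) → ∃ λ l → l ∈ cur ∷ rest × R l first
      last-edge cur [] (r ∷ []) = cur , here refl , r
      last-edge cur (x ∷ rest) (_ ∷ rs) = let (l , l∈ , r) = last-edge x rest rs in l , there l∈ , r

      -- Predecessor and successor on the cycle differ because nothing is repeated. The last vertex
      -- has `first` as successor, and the side condition covers the case that only one vertex
      -- remains.
      both-nbrs : ∀ {first vs} prev cur rest → R prev cur → Path (cycleEdgesAux first (cur ∷ rest)) →
        prev ∉ cur ∷ rest → Unique (cur ∷ rest) → first ∉ cur ∷ rest → (rest ≡ [] → prev ≢ first) →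
        prev ∈ vs → first ∈ vs → (∀ {w} → w ∈ cur ∷ rest → w ∈ vs) → ∀ {w} → w ∈ cur ∷ rest → Two vs w
      both-nbrs {first} prev cur [] r (r′ ∷ []) p∉ _ _ ne p∈ f∈ _ (here refl) =
        prev , first , ne refl , p∈ , f∈ , R-sym r , r′
      both-nbrs prev cur (x ∷ rest) r (r′ ∷ rs) p∉ _ _ _ p∈ _ ⊆ (here refl) =
        prev , x , (λ e → p∉ (there (here e))) , p∈ , ⊆ (there (here refl)) , R-sym r , r′
      both-nbrs prev cur (x ∷ rest) r (r′ ∷ rs) p∉ (c∉ ∷ uq) f∉ _ p∈ f∈ ⊆ (there w∈) =
        both-nbrs cur x rest r′ rs (λ i → All.lookup c∉ i refl) uq (f∉ ∘ there) (λ _ e → f∉ (here (sym e)))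
          (⊆ (here refl)) f∈ (⊆ ∘ there) w∈

      cycle-nbrs : ∀ {vs} → 3 ≤ length vs → Unique vs → Path (cycleEdges vs) → ∀ {w} → w ∈ vs → Two vs w
      cycle-nbrs {v₀ ∷ v₁ ∷ v₂ ∷ vs} _ (v₀∉ ∷ uq) (r ∷ rs) (there w∈) =
        both-nbrs v₀ v₁ (v₂ ∷ vs) r rs (λ i → All.lookup v₀∉ i refl) uq (λ i → All.lookup v₀∉ i refl) (λ ())
          (here refl) (here refl) there w∈
      cycle-nbrs {v₀ ∷ v₁ ∷ v₂ ∷ vs} _ (v₀∉ ∷ v₁∉ ∷ uq) (r ∷ _ ∷ rs) (here refl) =
        let (l , l∈ , r′) = last-edge v₂ vs rs in
        v₁ , l , (λ { refl → All.lookup v₁∉ l∈ refl }) , there (here refl) , there (there l∈) , r , R-sym r′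
      cycle-nbrs {[]} ()
      cycle-nbrs {_ ∷ []} (s≤s ())
      cycle-nbrs {_ ∷ _ ∷ []} (s≤s (s≤s ()))

    -- The vertices of a bichromatic cycle form a closed set: by properness the two cycle edges at a
    -- vertex have different colours, so both a and b occur.
    valid⇒acyclic : ∀ {col} → Valid col → IsAcyclic G col
    valid⇒acyclic {col} ((col-sym , col-inj) , no-closed) a b vs (len , uq , edges) bi = go (a ≟ b)
      where
      path : ∀ {es} → All (λ e → adj G (proj₁ e) (proj₂ e) ≡ true) es →
        All (λ e → col (proj₁ e) (proj₂ e) ≡ a ⊎ col (proj₁ e) (proj₂ e) ≡ b) es → Path col-sym col-inj a b es
      path [] [] = []
      path (e ∷ es) (q ∷ qs) = (e , q) ∷ path es qs
      two : ∀ {w} → w ∈ vs → Two col-sym col-inj a b vs w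
      two = cycle-nbrs col-sym col-inj a b len uq (path edges bi)
      member : ∀ {us} → 3 ≤ length us → ∃ λ w → w ∈ us
      member {[]} ()
      member {w ∷ _} _ = w , here refl
      S : Subset n
      S = tabulate λ w → does (w ∈ᶠ? vs)
      S⁺ : ∀ {w} → w ∈ vs → w Subset.∈ S
      S⁺ {w} w∈ = lookup⇒[]= w S (trans (lookup∘tabulate (λ w → does (w ∈ᶠ? vs)) w) (dec-true (w ∈ᶠ? vs) w∈))
      S⁻ : ∀ {w} → w Subset.∈ S → w ∈ vs
      S⁻ {w} w∈ with w ∈ᶠ? vs | trans (sym (lookup∘tabulate (λ w → does (w ∈ᶠ? vs)) w)) ([]=⇒lookup w∈)
      ... | yes i | _ = i
      ... | no _ | ()
      differ : ∀ {w p s} → p ≢ s → R col-sym col-inj a b w p → R col-sym col-inj a b w s → col w p ≢ col w s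
      differ ne (e , _) (e′ , _) = col-inj _ _ _ e e′ ne
      steps : ∀ {w} → Two col-sym col-inj a b vs w → Step col S a w × Step col S b w
      steps (p , s , ne , p∈ , s∈ , r@(e , q) , r′@(e′ , q′)) with q | q′
      ... | inj₁ α | inj₂ β = (p , S⁺ p∈ , e , α) , (s , S⁺ s∈ , e′ , β)
      ... | inj₂ β | inj₁ α = (s , S⁺ s∈ , e′ , α) , (p , S⁺ p∈ , e , β)
      ... | inj₁ α | inj₁ α′ = ⊥-elim (differ ne r r′ (trans α (sym α′)))
      ... | inj₂ β | inj₂ β′ = ⊥-elim (differ ne r r′ (trans β (sym β′)))
      go : Dec (a ≡ b) → ⊥
      go (no a≢b) = no-closed a b a≢b (S , (proj₁ some , S⁺ (proj₂ some)) , λ w w∈ → steps (two (S⁻ w∈)))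
        where some = member len
      -- With a single colour the two cycle edges at one vertex already contradict properness.
      go (yes refl) = mono (two (proj₂ (member len)))
        where
        mono : ∀ {w} → Two col-sym col-inj a b vs w → ⊥
        mono (p , s , ne , _ , _ , r , r′) = differ ne r r′ (trans (one (proj₂ r)) (sym (one (proj₂ r′))))
          where
          one : ∀ {d} → d ≡ a ⊎ d ≡ a → d ≡ a
          one (inj₁ e) = e
          one (inj₂ e) = e

    extract : Fin k → ¬ ¬ (Σ Colouring λ c → Good c × On [] c) → AcyclicEdgeColourable G k
    extract d nn = let (M , valid) = decidable-stable (search-Vec (search-Vec any?) (valid? ∘ colour)) λ ¬v → nn λ g → ¬v (good⇒valid d g)
      in colour M , proj₁ valid , valid⇒acyclic valid

degree-≤-max : (G : Graph n) (v : Fin n) → degree G v ≤ maxDegree G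
degree-≤-max G v = go (∈-allFin v)
  where
  go : ∀ {xs} → v ∈ xs → degree G v ≤ foldr _⊔_ 0 (map (degree G) xs)
  go {x ∷ xs} (here refl) = ℕ.m≤m⊔n (degree G x) _
  go {x ∷ xs} (there i) = ℕ.≤-trans (go i) (ℕ.m≤n⊔m (degree G x) _)

theorem1 : ∀ (n : ℕ) (G : Graph n) → madLessThan4 G →
    AcyclicEdgeColourable G (maxDegree G + 2)
-- There are at least two colours, so a default colour exists.
theorem1 n G mad = Colourings.Extract.extract n colours G (subst Fin (sym k≡) zero)
  (Colourings.colourable n colours _ G k≡
    (λ v → subst (_≤ maxDegree G) (sym (Colourings.Nbrs.deg≡degree n colours G v)) (degree-≤-max G v)) mad ℕ.≤-refl)
  where
  colours = maxDegree G + 2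
  k≡ : maxDegree G + 2 ≡ 2 + maxDegree G
  k≡ = ℕ.+-comm (maxDegree G) 2
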